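{- Let $0<\delta<1$, $0<\varepsilon<1/7$, $2<\alpha<\min(\frac{2}{1-\delta},3)$ and $0<\rho<\min\!\left(\frac{1-\delta}{2},\frac{2-\alpha(1-\delta)}{4}\right)$ be constants, let $p=n^{\delta-1}$, let $H$ be a balanced graph on $m=n^{\rho}$ vertices with average degree $\alpha$ having an independent set of size $k'$, and let $k'\le k\le n-m$. Let $f$ be an arbitrary function mapping $n$-vertex graphs to $\{0,1\}$. Let $p_A=\Pr[f(G)=1]$ for $G\sim A_HG(n,p,k)$ and $p_H=\Pr[f(G)=1]$ for $G\sim G_H(n,p,k)$. Then for every constant $\beta\in[0,1)$ and all sufficiently large $n$, $p_H\ge\beta\left(p_A-\frac{4\varepsilon}{(1-\beta)^2}\right)$.
   Context: A graph with average degree $\alpha$ is balanced if every induced subgraph has average degree at most $\alpha$. $G(n,p)$ is the Erdős–Rényi random graph on vertex set $[n]$. Let $H$ have vertex set $[m]$, $m$ dividing $n$; partition $[n]$ into parts $P_i=\{(i-1)\frac nm+1,\dots,i\frac nm\}$, $1\le i\le m$. A set $S=\{v_1,\dots,v_m\}$ with $v_i\in P_i$ obeys the partition; it is an induced copy of $H$ obeying the partition in a graph $F$ if $i\mapsto v_i$ is an isomorphism from $H$ onto $F[S]$. Distribution $G_H(n,p,k)$: sample $G'\sim G(n,p)$; choose a uniformly random $M=\{v_1,\dots,v_m\}$ obeying the partition and replace $G'[M]$ by $H$ (vertex $i$ placed at $v_i$), giving $G_H$; among the vertices with no neighbor in $M$ choose a uniformly random set $I'$ of size $k-k'$ and delete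 all edges inside $I'$; if there are fewer than $k-k'$ such vertices, instead delete all edges inside a uniformly random set of $k$ vertices of $G_H$. Distribution $A_HG(n,p,k)$: sample $G'\sim G(n,p)$; choose uniformly at random one induced copy $S$ of $H$ in $G'$ obeying the partition; among the vertices with no neighbor in $S$ choose a uniformly random set of size $k-k'$ and delete all edges inside it; if no such copy exists or there are fewer than $k-k'$ such vertices, instead delete all edges inside a uniformly random set of $k$ vertices of $G'$. -}

module Defs where

open import Data.Bool using (Bool; true; false; if_then_else_; _∧_; not) renaming (_≟_ to _≟ᵇ_)
open import Data.Fin using (Fin; zero; suc; toℕ)
open import Data.Fin.Properties using (all?) renaming (_≟_ to _≟ᶠ_)
open import Data.Fin.Subset using (Subset; Nonempty; _∈_; _∩_; ⊤) renaming (∣_∣ to card)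
open import Data.Fin.Subset.Properties using (_⊆?_)
open import Data.Integer using (ℤ; +_; -[1+_])
open import Data.List using (List; []; _∷_; _++_; map; concatMap; filter; foldr; length; allFin)
open import Data.Maybe using (Maybe; just; nothing) renaming (map to mapᴹ)
open import Data.Nat using (ℕ; zero; suc; NonZero) renaming (_*_ to _*ₙ_; _^_ to _^ₙ_; _∸_ to _∸ₙ_; _≤_ to _≤ₙ_; _<_ to _<ₙ_; _≤ᵇ_ to _≤ᵇₙ_; _/_ to _/ₙ_; _⊔_ to _⊔ₙ_)
import Data.Nat.Properties as ℕₚ
open import Data.Product using (Σ; ∃; _×_; _,_)
open import Data.Rational using (ℚ; 0ℚ; 1ℚ; ½; _+_; _*_; -_; _-_; _≤_; _<_; ∣_∣; _/_; 1/_; ↥_; ↧ₙ_; positive; nonNegative; ≢-nonZero; >-nonZero)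
open import Data.Rational.Properties
open import Data.Rational.Solver using (module +-*-Solver)
open import Data.Vec using (Vec; []; _∷_; lookup; tabulate; sum)
open import Relation.Binary.PropositionalEquality using (_≡_; refl; sym; trans; cong; cong₂; subst; subst₂)
open import Relation.Nullary using (Dec; yes; no; does; contradiction)
open import Relation.Nullary.Decidable using (_×-dec_)

open +-*-Solver using (solve; con; _:=_; _:+_; _:*_; :-_; _:-_)

Eventually : (ℕ → Set) → Set
Eventually P = ∃ λ N → ∀ i → N ≤ₙ i → P i

IsCauchy : (ℕ → ℚ) → Set
IsCauchy s = ∀ e → 0ℚ < e → ∃ λ N → ∀ i j → N ≤ₙ i → N ≤ₙ j → ∣ s i - s j ∣ ≤ e

record ℝ : Set where
  constructor mkℝ
  field
    seq    : ℕ → ℚ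
    cauchy : IsCauchy seq

open ℝ public

infix 4 _<ℝ_ _≤ℝ_ _≈ℝ_

_<ℝ_ : ℝ → ℝ → Set
x <ℝ y = ∃ λ e → 0ℚ < e × Eventually (λ i → seq x i + e ≤ seq y i)

_≤ℝ_ : ℝ → ℝ → Set
x ≤ℝ y = ∀ e → 0ℚ < e → Eventually (λ i → seq x i ≤ seq y i + e)

_≈ℝ_ : ℝ → ℝ → Set
x ≈ℝ y = ∀ e → 0ℚ < e → Eventually (λ i → ∣ seq x i - seq y i ∣ ≤ e)

private
  pos* : ∀ {a b} → 0ℚ < a → 0ℚ < b → 0ℚ < a * b
  pos* {a} {b} a>0 b>0 =
    positive⁻¹ (a * b) {{pos*pos⇒pos a {{positive a>0}} b {{positive b>0}}}}

  half> : ∀ {e} → 0ℚ < e → 0ℚ < ½ * e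
  half> = pos* (positive⁻¹ ½)

  halves : ∀ e → ½ * e + ½ * e ≡ e
  halves = solve 1 (λ e → con ½ :* e :+ con ½ :* e := e) refl

  *-mono : ∀ {a b c d} → 0ℚ ≤ c → 0ℚ ≤ b → a ≤ b → c ≤ d → a * c ≤ b * d
  *-mono {b = b} {c = c} c≥0 b≥0 a≤b c≤d =
    ≤-trans (*-monoʳ-≤-nonNeg c {{nonNegative c≥0}} a≤b)
            (*-monoˡ-≤-nonNeg b {{nonNegative b≥0}} c≤d)

  1/> : ∀ {a} (a>0 : 0ℚ < a) → 0ℚ < (1/ a) {{>-nonZero a>0}}
  1/> {a} a>0 = positive⁻¹ _ {{1/pos⇒pos a {{positive a>0}}}}

fromℚ : ℚ → ℝ
fromℚ q = mkℝ (λ _ → q) λ e e>0 → 0 , λ _ _ _ _ →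
  subst (_≤ e) (sym (cong ∣_∣ (+-inverseʳ q))) (<⇒≤ e>0)

fromℕ : ℕ → ℝ
fromℕ a = fromℚ (+ a / 1)

0ℝ 1ℝ : ℝ
0ℝ = fromℕ 0
1ℝ = fromℕ 1

infixl 6 _+ℝ_ _-ℝ_
infixl 7 _*ℝ_
infix  8 -ℝ_
infixr 9 _^ℝ_

private abstract
  +-cauchy : ∀ {s t} → IsCauchy s → IsCauchy t → IsCauchy (λ i → s i + t i)
  +-cauchy {s} {t} cs ct e e>0 =
    let M , ps = cs (½ * e) (half> e>0)
        N , pt = ct (½ * e) (half> e>0)
    in M ⊔ₙ N , λ i j i≥ j≥ → subst₂ _≤_
         (cong ∣_∣ (solve 4 (λ a b c d → (a :- b) :+ (c :- d) := (a :+ c) :- (b :+ d)) refl (s i) (s j) (t i) (t j)))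
         (halves e)
         (≤-trans (∣p+q∣≤∣p∣+∣q∣ (s i - s j) (t i - t j))
           (+-mono-≤ (ps i j (ℕₚ.m⊔n≤o⇒m≤o M N i≥) (ℕₚ.m⊔n≤o⇒m≤o M N j≥))
                     (pt i j (ℕₚ.m⊔n≤o⇒n≤o M N i≥) (ℕₚ.m⊔n≤o⇒n≤o M N j≥))))

  neg-cauchy : ∀ {s} → IsCauchy s → IsCauchy (λ i → - s i)
  neg-cauchy {s} cs e e>0 =
    let N , ps = cs e e>0
    in N , λ i j i≥ j≥ → subst (_≤ e)
         (cong ∣_∣ (solve 2 (λ a b → b :- a := (:- a) :- (:- b)) refl (s i) (s j)))
         (ps j i j≥ i≥)

_+ℝ_ : ℝ → ℝ → ℝ
mkℝ s cs +ℝ mkℝ t ct = mkℝ (λ i → s i + t i) (+-cauchy {s} {t} cs ct)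

-ℝ_ : ℝ → ℝ
-ℝ mkℝ s cs = mkℝ (λ i → - s i) (neg-cauchy {s} cs)

_-ℝ_ : ℝ → ℝ → ℝ
x -ℝ y = x +ℝ (-ℝ y)

private
  bounded : ∀ x → ∃ λ B → 0ℚ < B × Eventually (λ i → ∣ seq x i ∣ ≤ B)
  bounded (mkℝ s cs) =
    let N , ps = cs 1ℚ (positive⁻¹ 1ℚ)
    in 1ℚ + ∣ s N ∣
     , positive⁻¹ _ {{pos+nonNeg⇒pos 1ℚ ∣ s N ∣ {{∣-∣-nonNeg (s N)}}}}
     , N
     , λ i i≥ → ≤-trans
         (subst (λ a → ∣ a ∣ ≤ ∣ s i - s N ∣ + ∣ s N ∣)
            (solve 2 (λ a b → (a :- b) :+ b := a) refl (s i) (s N))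
            (∣p+q∣≤∣p∣+∣q∣ (s i - s N) (s N)))
         (+-monoˡ-≤ ∣ s N ∣ (ps i N i≥ ℕₚ.≤-refl))

private abstract
  *-cauchy : ∀ {s t} → IsCauchy s → IsCauchy t → IsCauchy (λ i → s i * t i)
  *-cauchy {s} {t} cs ct e e>0 =
    let A , A>0 , K , bs = bounded (mkℝ s cs)
        B , B>0 , L , bt = bounded (mkℝ t ct)
        A+B>0 = positive⁻¹ (A + B) {{pos+pos⇒pos A {{positive A>0}} B {{positive B>0}}}}
        r     = (1/ (A + B)) {{>-nonZero A+B>0}}
        e′    = e * r
        e′>0  = pos* e>0 (1/> A+B>0)
        M , ps = cs e′ e′>0
        N , pt = ct e′ e′>0
        KL = K ⊔ₙ L
        MN = M ⊔ₙ N
    in KL ⊔ₙ MN , λ i j i≥ j≥ →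
       let i≥KL = ℕₚ.m⊔n≤o⇒m≤o KL MN i≥
           i≥MN = ℕₚ.m⊔n≤o⇒n≤o KL MN i≥
           j≥KL = ℕₚ.m⊔n≤o⇒m≤o KL MN j≥
           j≥MN = ℕₚ.m⊔n≤o⇒n≤o KL MN j≥
           first = subst (_≤ A * e′) (sym (∣p*q∣≡∣p∣*∣q∣ (s i) (t i - t j)))
             (*-mono (0≤∣p∣ _) (<⇒≤ A>0) (bs i (ℕₚ.m⊔n≤o⇒m≤o K L i≥KL))
                (pt i j (ℕₚ.m⊔n≤o⇒n≤o M N i≥MN) (ℕₚ.m⊔n≤o⇒n≤o M N j≥MN)))
           second = subst (_≤ B * e′) (sym (∣p*q∣≡∣p∣*∣q∣ (t j) (s i - s j)))
             (*-mono (0≤∣p∣ _) (<⇒≤ B>0) (bt j (ℕₚ.m⊔n≤o⇒n≤o K L j≥KL))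
                (ps i j (ℕₚ.m⊔n≤o⇒m≤o M N i≥MN) (ℕₚ.m⊔n≤o⇒m≤o M N j≥MN)))
       in subst₂ _≤_
            (cong ∣_∣ (solve 4 (λ a b c d → a :* (c :- d) :+ d :* (a :- b) := a :* c :- b :* d) refl (s i) (s j) (t i) (t j)))
            (trans (solve 4 (λ A B e r → A :* (e :* r) :+ B :* (e :* r) := e :* ((A :+ B) :* r)) refl A B e r)
              (trans (cong (e *_) (*-inverseʳ (A + B) {{>-nonZero A+B>0}})) (*-identityʳ e)))
            (≤-trans (∣p+q∣≤∣p∣+∣q∣ (s i * (t i - t j)) (t j * (s i - s j)))
              (+-mono-≤ first second))

_*ℝ_ : ℝ → ℝ → ℝ
mkℝ s cs *ℝ mkℝ t ct = mkℝ (λ i → s i * t i) (*-cauchy {s} {t} cs ct)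

_^ℝ_ : ℝ → ℕ → ℝ
x ^ℝ zero  = 1ℝ
x ^ℝ suc k = x *ℝ x ^ℝ k

recip : ℚ → ℚ
recip q with q ≟ 0ℚ
... | yes _   = 0ℚ
... | no  q≢0 = (1/ q) {{≢-nonZero q≢0}}

private
  recip-inverse : ∀ q → 0ℚ < q → recip q * q ≡ 1ℚ
  recip-inverse q q>0 with q ≟ 0ℚ
  ... | yes q≡0 = contradiction q>0 (<-irrefl (sym q≡0))
  ... | no  q≢0 = *-inverseˡ q {{≢-nonZero q≢0}}

private abstract
  recip-cauchy : ∀ x → 0ℝ <ℝ x → IsCauchy (λ i → recip (seq x i))
  recip-cauchy (mkℝ s cs) (c , c>0 , K , s≥c) e e>0 =
    let N , ps = cs (e * (c * c)) (pos* e>0 (pos* c>0 c>0))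
    in K ⊔ₙ N , λ i j i≥ j≥ →
      let c≤a = subst (_≤ s i) (+-identityˡ c) (s≥c i (ℕₚ.m⊔n≤o⇒m≤o K N i≥))
          c≤b = subst (_≤ s j) (+-identityˡ c) (s≥c j (ℕₚ.m⊔n≤o⇒m≤o K N j≥))
          a = s i
          b = s j
          a>0 = <-≤-trans c>0 c≤a
          b>0 = <-≤-trans c>0 c≤b
          ab>0 = pos* a>0 b>0
          u = recip a
          v = recip b
          eq : (u - v) * (a * b) ≡ b - a
          eq = trans (solve 4 (λ u v a b → (u :- v) :* (a :* b) := (u :* a) :* b :- (v :* b) :* a) refl u v a b)
                 (cong₂ _-_ (trans (cong (_* b) (recip-inverse a a>0)) (*-identityˡ b))
                            (trans (cong (_* a) (recip-inverse b b>0)) (*-identityˡ a)))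
          eq′ : ∣ u - v ∣ * (a * b) ≡ ∣ b - a ∣
          eq′ = trans (cong (∣ u - v ∣ *_) (sym (0≤p⇒∣p∣≡p (<⇒≤ ab>0))))
                  (trans (sym (∣p*q∣≡∣p∣*∣q∣ (u - v) (a * b))) (cong ∣_∣ eq))
          cc≤ab = *-mono (<⇒≤ c>0) (<⇒≤ a>0) c≤a c≤b
      in *-cancelʳ-≤-pos (a * b) {{positive ab>0}}
           (subst (_≤ e * (a * b)) (sym eq′)
             (≤-trans (ps j i (ℕₚ.m⊔n≤o⇒n≤o K N j≥) (ℕₚ.m⊔n≤o⇒n≤o K N i≥))
               (*-monoˡ-≤-nonNeg e {{nonNegative (<⇒≤ e>0)}} cc≤ab)))

-- Termwise reciprocal; the value 0 at zero terms is harmless, since the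
-- terms of a positive real are eventually bounded away from 0.
invℝ : (x : ℝ) → 0ℝ <ℝ x → ℝ
invℝ x x>0 = mkℝ (λ i → recip (seq x i)) (recip-cauchy x x>0)

infixl 7 _÷ℝ_[_]

_÷ℝ_[_] : ℝ → (y : ℝ) → 0ℝ <ℝ y → ℝ
x ÷ℝ y [ y>0 ] = x *ℝ invℝ y y>0

x<1⇒0<1-x : ∀ x → x <ℝ 1ℝ → 0ℝ <ℝ 1ℝ -ℝ x
x<1⇒0<1-x (mkℝ s _) (e , e>0 , N , p) = e , e>0 , N , λ i i≥ →
  subst (_≤ 1ℚ - s i)
    (solve 2 (λ a e → (a :+ e) :- a := con 0ℚ :+ e) refl (s i) e)
    (+-monoˡ-≤ (- s i) (p i i≥))

0<x⇒0<x² : ∀ x → 0ℝ <ℝ x → 0ℝ <ℝ x ^ℝ 2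
0<x⇒0<x² (mkℝ s _) (e , e>0 , N , p) = e * e , pos* e>0 e>0 , N , λ i i≥ →
  let e≤s = subst (_≤ s i) (+-identityˡ e) (p i i≥)
  in subst₂ _≤_ (sym (+-identityˡ (e * e))) (cong (s i *_) (sym (*-identityʳ (s i))))
       (*-mono (<⇒≤ e>0) (<⇒≤ (<-≤-trans e>0 e≤s)) e≤s e≤s)

infixr 8 _^ℤ_

_^ℤ_ : (n : ℕ) → ℤ → .{{_ : NonZero n}} → ℚ
n ^ℤ (+ a)    = + (n ^ₙ a) / 1
n ^ℤ -[1+ a ] = (+ 1 / (n ^ₙ suc a)) {{ℕₚ.m^n≢0 n (suc a)}}

-- IsPower n y z says z = n^y, i.e. z is the common value of
-- sup { n^r : r rational, r < y } and inf { n^r : r rational, y < r };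
-- for r = a/b, the comparison of n^r with z ≥ 0 is that of n^a with z^b.
IsPower : (n : ℕ) → .{{_ : NonZero n}} → ℝ → ℝ → Set
IsPower n y z =
  0ℝ ≤ℝ z ×
  (∀ r → fromℚ r <ℝ y → fromℚ (n ^ℤ (↥ r)) ≤ℝ z ^ℝ (↧ₙ r)) ×
  (∀ r → y <ℝ fromℚ r → z ^ℝ (↧ₙ r) ≤ℝ fromℚ (n ^ℤ (↥ r)))

Dist : Set → Set
Dist A = List (ℝ × A)

return : {A : Set} → A → Dist A
return x = (1ℝ , x) ∷ []

infixl 1 _>>=_

_>>=_ : {A B : Set} → Dist A → (A → Dist B) → Dist B
d >>= g = concatMap (λ (w , x) → map (λ (v , y) → w *ℝ v , y) (g x)) d

-- a / b, with junk value 0 for b = 0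
ratio : ℕ → ℕ → ℚ
ratio a zero    = 0ℚ
ratio a (suc b) = + a / suc b

-- A probability distribution only when the list is non-empty.
uniform : {A : Set} → List A → Dist A
uniform xs = map (λ x → fromℚ (ratio 1 (length xs)) , x) xs

Pr : {A : Set} → (A → Bool) → Dist A → ℝ
Pr f d = foldr (λ (w , x) s → (if f x then w else 0ℝ) +ℝ s) 0ℝ d

bernoulli : ℝ → Dist Bool
bernoulli p = (p , true) ∷ (1ℝ -ℝ p , false) ∷ []

iid : {A : Set} → Dist A → (n : ℕ) → Dist (Vec A n)
iid d zero    = return []
iid d (suc n) = d >>= λ x → iid d n >>= λ xs → return (x ∷ xs)

-- In row ◁ G, vertex 0 has its adjacencies to the vertices suc j listed in
-- row, and G is the graph on the remaining vertices. Each simple graph on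
-- Fin n is represented exactly once.
infixr 5 _◁_

data Graph : ℕ → Set where
  ∅   : Graph 0
  _◁_ : ∀ {n} → Vec Bool n → Graph n → Graph (suc n)

adj : ∀ {n} → Graph n → Fin n → Fin n → Bool
adj (row ◁ G) zero    zero    = false
adj (row ◁ G) zero    (suc j) = lookup row j
adj (row ◁ G) (suc i) zero    = lookup row i
adj (row ◁ G) (suc i) (suc j) = adj G i j

-- Only the values a i j with i < j are used.
mkGraph : ∀ {n} → (Fin n → Fin n → Bool) → Graph n
mkGraph {zero}  a = ∅
mkGraph {suc n} a = tabulate (λ j → a zero (suc j)) ◁ mkGraph (λ i j → a (suc i) (suc j))

neighbours : ∀ {n} → Graph n → Fin n → Subset n
neighbours G i = tabulate (adj G i)

-- Average degree of the subgraph induced by U (0 if U is empty).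
avgDegreeOn : ∀ {n} → Graph n → Subset n → ℚ
avgDegreeOn G U = ratio (sum (tabulate degree)) (card U)
  where
  degree : Fin _ → ℕ
  degree i = if lookup U i then card (neighbours G i ∩ U) else 0

avgDegree : ∀ {n} → Graph n → ℚ
avgDegree G = avgDegreeOn G ⊤

Balanced : ∀ {n} → Graph n → Set
Balanced G = ∀ U → Nonempty U → avgDegreeOn G U ≤ avgDegree G

HasIndependentSet : ∀ {n} → Graph n → ℕ → Set
HasIndependentSet {n} G s = Σ (Subset n) λ I →
  card I ≡ s × (∀ i j → i ∈ I → j ∈ I → adj G i j ≡ false)

Gnp : (n : ℕ) → ℝ → Dist (Graph n)
Gnp zero    p = return ∅
Gnp (suc n) p = iid (bernoulli p) n >>= λ row → Gnp n p >>= λ G → return (row ◁ G)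

-- Zero-based: the part of index i is { i·(n/m), …, (i+1)·(n/m) − 1 }.
InPart : (m : ℕ) .{{_ : NonZero m}} {n : ℕ} → Fin m → Fin n → Set
InPart m {n} i v = toℕ i *ₙ (n /ₙ m) ≤ₙ toℕ v × toℕ v <ₙ suc (toℕ i) *ₙ (n /ₙ m)

inPart? : (m : ℕ) .{{_ : NonZero m}} {n : ℕ} (i : Fin m) (v : Fin n) → Dec (InPart m i v)
inPart? m {n} i v = (toℕ i *ₙ (n /ₙ m) ℕₚ.≤? toℕ v) ×-dec (toℕ v ℕₚ.<? suc (toℕ i) *ₙ (n /ₙ m))

choices : {A : Set} {m : ℕ} → Vec (List A) m → List (Vec A m)
choices []         = [] ∷ []
choices (xs ∷ xss) = concatMap (λ x → map (x ∷_) (choices xss)) xs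

-- The sets { v₁, …, vₘ } with vᵢ in the i-th part, each listed once as the
-- vector (v₁, …, vₘ); the parts being disjoint, the set determines the vector.
obeying : (m n : ℕ) .{{_ : NonZero m}} → List (Vec (Fin n) m)
obeying m n = choices (tabulate λ i → filter (inPart? m i) (allFin n))

IsInducedCopy : ∀ {m n} → Graph m → Graph n → Vec (Fin n) m → Set
IsInducedCopy H F v = ∀ i j → adj F (lookup v i) (lookup v j) ≡ adj H i j

isInducedCopy? : ∀ {m n} (H : Graph m) (F : Graph n) v → Dec (IsInducedCopy H F v)
isInducedCopy? H F v = all? λ i → all? λ j →
  adj F (lookup v i) (lookup v j) ≟ᵇ adj H i j

copies : ∀ {m n} .{{_ : NonZero m}} → Graph m → Graph n → List (Vec (Fin n) m)
copies {m} {n} H F = filter (isInducedCopy? H F) (obeying m n)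

position : ∀ {m n} → Vec (Fin n) m → Fin n → Maybe (Fin m)
position []       u = nothing
position (v ∷ vs) u = if does (v ≟ᶠ u) then just zero else mapᴹ suc (position vs u)

plant : ∀ {m n} → Graph m → Vec (Fin n) m → Graph n → Graph n
plant {m} {n} H v G = mkGraph λ u w → edge u w (position v u) (position v w)
  where
  edge : Fin n → Fin n → Maybe (Fin m) → Maybe (Fin m) → Bool
  edge u w (just i) (just j) = adj H i j
  edge u w _        _        = adj G u w

noNeighbourIn : ∀ {m n} → Graph n → Vec (Fin n) m → Subset n
noNeighbourIn G v = tabulate λ u → does (all? λ i → adj G u (lookup v i) ≟ᵇ false)

allSubsets : (n : ℕ) → List (Subset n)
allSubsets zero    = [] ∷ []
allSubsets (suc n) = map (true ∷_) (allSubsets n) ++ map (false ∷_) (allSubsets n)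

subsetsOfSize : ∀ {n} → ℕ → Subset n → List (Subset n)
subsetsOfSize {n} s C = filter (λ I → (card I ℕₚ.≟ s) ×-dec (I ⊆? C)) (allSubsets n)

deleteInside : ∀ {n} → Graph n → Subset n → Graph n
deleteInside G I = mkGraph λ u w → adj G u w ∧ not (lookup I u ∧ lookup I w)

deleteInRandom : ∀ {n} → Graph n → ℕ → Subset n → Dist (Graph n)
deleteInRandom G s C = uniform (subsetsOfSize s C) >>= λ I → return (deleteInside G I)

hide : ∀ {m n} → Graph n → Vec (Fin n) m → (k k' : ℕ) → Dist (Graph n)
hide G S k k' =
  if (k ∸ₙ k') ≤ᵇₙ card (noNeighbourIn G S)
  then deleteInRandom G (k ∸ₙ k') (noNeighbourIn G S)
  else deleteInRandom G k ⊤

G[_] : ∀ {m} .{{_ : NonZero m}} → Graph m → (n : ℕ) → ℝ → (k k' : ℕ) → Dist (Graph n)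
G[_] {m} H n p k k' =
  Gnp n p >>= λ G' →
  uniform (obeying m n) >>= λ M →
  hide (plant H M G') M k k'

AG[_] : ∀ {m} .{{_ : NonZero m}} → Graph m → (n : ℕ) → ℝ → (k k' : ℕ) → Dist (Graph n)
AG[_] {m} H n p k k' = Gnp n p >>= λ G' → attack G' (copies H G')
  where
  attack : Graph n → List (Vec (Fin n) m) → Dist (Graph n)
  attack G' []         = deleteInRandom G' k ⊤
  attack G' cs@(_ ∷ _) = uniform cs >>= λ S → hide G' S k k'

{-# OPTIONS --safe #-}
module Submission where

-- Let X be the number of induced copies of H obeying the partition. Planting H
-- at a uniformly random place reweights G(n, p) by X / E X, and, given the
-- resulting graph, the planted set is a uniformly random copy. So where
-- X ≥ β E X the density of the planted model is at least β times that of the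
-- attacked model, and by Chebyshev's inequality the remaining graphs have
-- probability at most Var X / ((1 − β) E X)².
-- Two sets obeying the partition meet exactly in the coordinates where they
-- agree. As H is balanced, any u of its vertices span at most α u / 2 edges, so
-- the correlation caused by u common vertices is at most w^u with w = x n / m²
-- for large n; this is where 4 ρ + α (1 − δ) < 2 enters. Summing over the pairs
-- coordinatewise gives E X² / (E X)² ≤ (1 + w m / n)^m = (1 + x / m)^m ≤ 1 + 2 x.
-- Every strict inequality between reals leaves room to pass to rational
-- exponents and to the rational terms of p, β and ε.

open import Defs
open import Data.Bool using (Bool; true; false; if_then_else_; _∧_; T) renaming (_≟_ to _≟ᵇ_)
open import Data.Bool.Properties using (∧-comm)
open import Data.Fin using (Fin; zero; suc; toℕ) renaming (_<_ to _<ᶠ_)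
open import Data.Fin.Properties using (¬∀⟶∃¬; toℕ<n; suc-injective; all?) renaming (_≟_ to _≟ᶠ_; <-cmp to <ᶠ-cmp)
open import Data.Fin.Subset using (Subset; _∩_; ⊤) renaming (∣_∣ to card)
open import Data.Fin.Subset.Properties using (nonempty?; ∣p∣≤n; x∈p⇒∣p-x∣<∣p∣)
open import Data.Integer using (+_; -[1+_])
import Data.Integer.Properties as ℤₚ
import Data.Integer as ℤ
open import Data.List using (List; []; _∷_; _++_; map; concatMap; filter; foldr; length; allFin)
import Data.List.Properties as Listₚ
open import Data.List.Relation.Unary.AllPairs using ([]; _∷_)
open import Data.List.Relation.Unary.Unique.Propositional using (Unique)
import Data.List.Relation.Unary.Unique.Propositional.Properties as Uniqueₚ
import Data.List.Relation.Unary.All.Properties as Allₚ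
open import Data.List.Relation.Unary.All as All using (All; []; _∷_)
open import Data.Maybe using (Maybe; just; nothing; fromMaybe; _<∣>_) renaming (map to mapᴹ; zipWith to zipWithᴹ)
open import Data.Vec using (Vec; []; _∷_; lookup; tabulate; zipWith; sum)
open import Data.Vec.Properties using (tabulate-cong; lookup-zipWith; lookup∘tabulate; lookup⇒[]=)
open import Data.Nat.Divisibility using (_∣_)
open import Data.Nat.DivMod using (m*[n/m]≡n)
open import Data.Nat using (ℕ; zero; suc; pred; NonZero; _≤_; _∸_; z≤n; s≤s) renaming (_+_ to _+ₙ_; _*_ to _*ₙ_; _^_ to _^ₙ_; _<_ to _<ₙ_; _<ᵇ_ to _<ᵇₙ_; _/_ to _/ₙ_)
import Data.Nat as ℕ
import Data.Nat.Properties as ℕₚ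
open import Data.Nat.Solver using () renaming (module +-*-Solver to ℕ-Solver)
open import Data.Product using (∃; _×_; _,_; proj₁; proj₂)
open import Data.Rational using (ℚ; 0ℚ; 1ℚ; ½; mkℚ; _+_; _*_; -_; _-_; _/_; ↥_; ↧ₙ_; toℚᵘ; positive; nonNegative; nonPositive) renaming (_≤_ to _≤ℚ_; _<_ to _<ℚ_)
import Data.Rational as ℚ
import Data.Rational.Properties as ℚₚ
open import Data.Rational.Solver using (module +-*-Solver)
open import Data.Rational.Unnormalised using (mkℚᵘ; *≡*) renaming (_≃_ to _≃ᵘ_; _+_ to _+ᵘ_; _*_ to _*ᵘ_)
import Data.Rational.Unnormalised.Properties as ℚᵘₚ
open import Data.Sum using (_⊎_; inj₁; inj₂)
open import Data.Empty using (⊥)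
open import Data.Unit using (tt)
open import Function using (_∘_)
open import Relation.Binary.Definitions using (tri<; tri≈; tri>)
open import Relation.Binary.PropositionalEquality
open import Relation.Nullary using (¬_; Dec; yes; no; does; contradiction)
open import Relation.Unary using (Decidable)
open import Algebra.Bundles using (CommutativeRing)
open import Algebra.Properties.CommutativeMonoid.Sum ℚₚ.*-1-commutativeMonoid using () renaming (sum to ∏; sum-cong-≗ to ∏-cong; ∑-distrib-+ to ∏-distrib-*; sum-replicate-zero to ∏-ones)
open import Algebra.Properties.CommutativeSemiring.Exp (CommutativeRing.commutativeSemiring ℚₚ.+-*-commutativeRing) using (_^_; ^-homo-*; ^-assocʳ; ^-distrib-*)

open ℕ-Solver using () renaming (solve to ℕ-solve; con to ℕ-con; _:=_ to _⊜_; _:*_ to _⊗_)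
open +-*-Solver using (solve; con; _:=_; _:+_; _:*_; :-_; _:-_)

-- A real is a Cauchy sequence of rationals, and `Pr` is a polynomial in its weights, so the i-th
-- term of a probability is the same probability computed with the i-th term of p. The second moment
-- argument therefore takes place in ℚ at one fixed index i; the reals return at the end, where `≤ℝ`
-- asks for the inequality at all large i up to a slack e. The obstacle is the order of quantifiers:
-- n₀ must not depend on i, yet the terms of p need not be powers of n. Rational exponents on either
-- side of δ - 1 bound them up to a factor 2, and strict inequalities between exponents leave a
-- spare factor n that absorbs such constants uniformly in i. Roots are avoided by raising both
-- sides to a common denominator. Non-edges have a price too: inside u common vertices they lower
-- the squared weight by at most (1 - p)^(u²), which is at least 2^(-u) because u ≤ m and p m ≤ 1/2.
-- This is where ρ < (1 - δ)/2 enters. The x of the overview is a rational lower bound for the late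
-- terms of ε, so the relative variance 2 x stays below 4 ε.

private variable
  a b c d : ℚ
  A B : Set

-- Order and powers in ℚ

*-monoʳ-≤ : 0ℚ ≤ℚ c → a ≤ℚ b → c * a ≤ℚ c * b
*-monoʳ-≤ {c} 0≤c = ℚₚ.*-monoˡ-≤-nonNeg c {{nonNegative 0≤c}}

*-monoˡ-≤ : 0ℚ ≤ℚ c → a ≤ℚ b → a * c ≤ℚ b * c
*-monoˡ-≤ {c} 0≤c = ℚₚ.*-monoʳ-≤-nonNeg c {{nonNegative 0≤c}}

*-mono-≤ : 0ℚ ≤ℚ a → 0ℚ ≤ℚ c → a ≤ℚ b → c ≤ℚ d → a * c ≤ℚ b * d
*-mono-≤ 0≤a 0≤c a≤b c≤d =
  ℚₚ.≤-trans (*-monoˡ-≤ 0≤c a≤b) (*-monoʳ-≤ (ℚₚ.≤-trans 0≤a a≤b) c≤d)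

*-≥0 : 0ℚ ≤ℚ a → 0ℚ ≤ℚ b → 0ℚ ≤ℚ a * b
*-≥0 {a} {b} 0≤a 0≤b = subst (_≤ℚ a * b) (ℚₚ.*-zeroʳ a) (*-monoʳ-≤ 0≤a 0≤b)

*->0 : 0ℚ <ℚ a → 0ℚ <ℚ b → 0ℚ <ℚ a * b
*->0 {a} {b} 0<a 0<b = ℚₚ.positive⁻¹ (a * b) {{ℚₚ.pos*pos⇒pos a {{positive 0<a}} b {{positive 0<b}}}}

*-cancelˡ-≤ : 0ℚ <ℚ c → c * a ≤ℚ c * b → a ≤ℚ b
*-cancelˡ-≤ {c} 0<c = ℚₚ.*-cancelˡ-≤-pos c {{positive 0<c}}

+-≥0 : 0ℚ ≤ℚ a → 0ℚ ≤ℚ b → 0ℚ ≤ℚ a + b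
+-≥0 0≤a 0≤b = ℚₚ.+-mono-≤ 0≤a 0≤b

a≤b⇒0≤b-a : a ≤ℚ b → 0ℚ ≤ℚ b - a
a≤b⇒0≤b-a {a} {b} a≤b = subst (_≤ℚ b - a) (ℚₚ.+-inverseʳ a) (ℚₚ.+-monoˡ-≤ (- a) a≤b)

0≤b-a⇒a≤b : 0ℚ ≤ℚ b - a → a ≤ℚ b
0≤b-a⇒a≤b {b} {a} 0≤b-a = subst₂ _≤ℚ_ (ℚₚ.+-identityˡ a) (solve 2 (λ a b → (b :- a) :+ a := b) refl a b) (ℚₚ.+-monoˡ-≤ a 0≤b-a)

0≤1 : 0ℚ ≤ℚ 1ℚ
0≤1 = ℚₚ.nonNegative⁻¹ 1ℚ

0<1 : 0ℚ <ℚ 1ℚ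
0<1 = ℚₚ.positive⁻¹ 1ℚ

square-≥0 : ∀ a → 0ℚ ≤ℚ a * a
square-≥0 a with ℚₚ.≤-total 0ℚ a
... | inj₁ 0≤a = *-≥0 0≤a 0≤a
... | inj₂ a≤0 = ℚₚ.nonNegative⁻¹ (a * a) {{ℚₚ.nonPos*nonPos⇒nonPos a {{nonPositive a≤0}} a {{nonPositive a≤0}}}}

^-≥0 : ∀ k → 0ℚ ≤ℚ a → 0ℚ ≤ℚ a ^ k
^-≥0 zero    0≤a = 0≤1
^-≥0 (suc k) 0≤a = *-≥0 0≤a (^-≥0 k 0≤a)

^->0 : ∀ k → 0ℚ <ℚ a → 0ℚ <ℚ a ^ k
^->0 zero    0<a = 0<1
^->0 (suc k) 0<a = *->0 0<a (^->0 k 0<a)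

^-monoˡ-≤ : ∀ k → 0ℚ ≤ℚ a → a ≤ℚ b → a ^ k ≤ℚ b ^ k
^-monoˡ-≤ zero    0≤a a≤b = ℚₚ.≤-refl
^-monoˡ-≤ (suc k) 0≤a a≤b = *-mono-≤ 0≤a (^-≥0 k 0≤a) a≤b (^-monoˡ-≤ k 0≤a a≤b)

^-comm : ∀ a j k → (a ^ j) ^ k ≡ (a ^ k) ^ j
^-comm a j k = trans (^-assocʳ a j k) (trans (cong (a ^_) (ℕₚ.*-comm j k)) (sym (^-assocʳ a k j)))

1^k≡1 : ∀ k → 1ℚ ^ k ≡ 1ℚ
1^k≡1 zero    = refl
1^k≡1 (suc k) = trans (ℚₚ.*-identityˡ _) (1^k≡1 k)

1≤^ : ∀ k → 1ℚ ≤ℚ a → 1ℚ ≤ℚ a ^ k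
1≤^ k 1≤a = subst (_≤ℚ _ ^ k) (1^k≡1 k) (^-monoˡ-≤ k 0≤1 1≤a)

^≤1 : ∀ k → 0ℚ ≤ℚ a → a ≤ℚ 1ℚ → a ^ k ≤ℚ 1ℚ
^≤1 k 0≤a a≤1 = subst (_ ^ k ≤ℚ_) (1^k≡1 k) (^-monoˡ-≤ k 0≤a a≤1)

^-monoʳ-≤ : ∀ {k l} → 1ℚ ≤ℚ a → k ≤ l → a ^ k ≤ℚ a ^ l
^-monoʳ-≤ {l = l} 1≤a z≤n      = 1≤^ l 1≤a
^-monoʳ-≤         1≤a (s≤s k≤l) = *-monoʳ-≤ (ℚₚ.≤-trans 0≤1 1≤a) (^-monoʳ-≤ 1≤a k≤l)

^-antimonoʳ-≤ : ∀ {k l} → 0ℚ ≤ℚ a → a ≤ℚ 1ℚ → k ≤ l → a ^ l ≤ℚ a ^ k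
^-antimonoʳ-≤ {l = l} 0≤a a≤1 z≤n       = ^≤1 l 0≤a a≤1
^-antimonoʳ-≤         0≤a a≤1 (s≤s k≤l) = *-monoʳ-≤ 0≤a (^-antimonoʳ-≤ 0≤a a≤1 k≤l)

^-monoˡ-< : ∀ k → 0ℚ ≤ℚ a → a <ℚ b → a ^ suc k <ℚ b ^ suc k
^-monoˡ-< {a} {b} k 0≤a a<b =
  ℚₚ.≤-<-trans (*-monoʳ-≤ 0≤a (^-monoˡ-≤ k 0≤a (ℚₚ.<⇒≤ a<b)))
    (ℚₚ.*-monoˡ-<-pos (b ^ k) {{positive (^->0 k (ℚₚ.≤-<-trans 0≤a a<b))}} a<b)

-- This takes the place of extracting roots: a bound with exponent a/b is proved after raising both
-- sides to the power b.
^-cancelˡ-≤ : ∀ k .{{_ : NonZero k}} → 0ℚ ≤ℚ b → a ^ k ≤ℚ b ^ k → a ≤ℚ b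
^-cancelˡ-≤ {b} {a} (suc k) 0≤b aᵏ≤bᵏ with a ℚₚ.≤? b
... | yes a≤b = a≤b
... | no  a≰b = contradiction (ℚₚ.<-≤-trans (^-monoˡ-< k 0≤b (ℚₚ.≰⇒> a≰b)) aᵏ≤bᵏ) (ℚₚ.<-irrefl refl)

opaque
  ι : ℕ → ℚ
  ι n = + n / 1

private
  toℚᵘ-/ : ∀ n d .{{_ : NonZero d}} → toℚᵘ (+ n / d) ≃ᵘ mkℚᵘ (+ n) (pred d)
  toℚᵘ-/ n (suc d) = ℚₚ.toℚᵘ-fromℚᵘ (mkℚᵘ (+ n) d)

opaque
  unfolding ι

  ι-def : ∀ n → ι n ≡ + n / 1
  ι-def n = refl

  ι0≡0 : ι 0 ≡ 0ℚ
  ι0≡0 = refl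

  ι1≡1 : ι 1 ≡ 1ℚ
  ι1≡1 = refl

  0≤ι : ∀ n → 0ℚ ≤ℚ ι n
  0≤ι n = ℚₚ.nonNegative⁻¹ (+ n / 1) {{ℚₚ.normalize-nonNeg n 1}}

  ι-+ : ∀ m n → ι (m +ₙ n) ≡ ι m + ι n
  ι-+ m n = ℚₚ.toℚᵘ-injective (begin
    toℚᵘ (ι (m +ₙ n))               ≈⟨ toℚᵘ-/ (m +ₙ n) 1 ⟩
    mkℚᵘ (+ (m +ₙ n)) 0             ≈⟨ *≡* (cong (ℤ._* ℤ.1ℤ) (sym (cong₂ ℤ._+_ (ℤₚ.*-identityʳ (+ m)) (ℤₚ.*-identityʳ (+ n))))) ⟩
    mkℚᵘ (+ m) 0 +ᵘ mkℚᵘ (+ n) 0    ≈⟨ ℚᵘₚ.+-cong (toℚᵘ-/ m 1) (toℚᵘ-/ n 1) ⟨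
    toℚᵘ (ι m) +ᵘ toℚᵘ (ι n)        ≈⟨ ℚₚ.toℚᵘ-homo-+ (ι m) (ι n) ⟨
    toℚᵘ (ι m + ι n)                ∎)
    where open ℚᵘₚ.≃-Reasoning

  ι-* : ∀ m n → ι (m *ₙ n) ≡ ι m * ι n
  ι-* m n = ℚₚ.toℚᵘ-injective (begin
    toℚᵘ (ι (m *ₙ n))               ≈⟨ toℚᵘ-/ (m *ₙ n) 1 ⟩
    mkℚᵘ (+ (m *ₙ n)) 0             ≈⟨ *≡* (cong (ℤ._* ℤ.1ℤ) (ℤₚ.pos-* m n)) ⟩
    mkℚᵘ (+ m) 0 *ᵘ mkℚᵘ (+ n) 0    ≈⟨ ℚᵘₚ.*-cong (toℚᵘ-/ m 1) (toℚᵘ-/ n 1) ⟨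
    toℚᵘ (ι m) *ᵘ toℚᵘ (ι n)        ≈⟨ ℚₚ.toℚᵘ-homo-* (ι m) (ι n) ⟨
    toℚᵘ (ι m * ι n)                ∎)
    where open ℚᵘₚ.≃-Reasoning

  /-*-cancel : ∀ n d .{{_ : NonZero d}} → (+ n / d) * ι d ≡ ι n
  /-*-cancel n (suc d) = ℚₚ.toℚᵘ-injective (begin
    toℚᵘ ((+ n / suc d) * ι (suc d))          ≈⟨ ℚₚ.toℚᵘ-homo-* (+ n / suc d) (ι (suc d)) ⟩
    toℚᵘ (+ n / suc d) *ᵘ toℚᵘ (ι (suc d))    ≈⟨ ℚᵘₚ.*-cong (toℚᵘ-/ n (suc d)) (toℚᵘ-/ (suc d) 1) ⟩
    mkℚᵘ (+ n) d *ᵘ mkℚᵘ (+ suc d) 0          ≈⟨ *≡* (trans (ℤₚ.*-identityʳ _) (cong (λ k → + n ℤ.* + k) (sym (ℕₚ.*-identityʳ (suc d))))) ⟩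
    mkℚᵘ (+ n) 0                              ≈⟨ toℚᵘ-/ n 1 ⟨
    toℚᵘ (ι n)                                ∎)
    where open ℚᵘₚ.≃-Reasoning

ι-suc : ∀ n → ι (suc n) ≡ 1ℚ + ι n
ι-suc n = trans (ι-+ 1 n) (cong (_+ ι n) ι1≡1)

ι-^ : ∀ m k → ι (m ^ₙ k) ≡ ι m ^ k
ι-^ m zero    = ι1≡1
ι-^ m (suc k) = trans (ι-* m (m ^ₙ k)) (cong (ι m *_) (ι-^ m k))

ι-mono-≤ : ∀ {m n} → m ≤ n → ι m ≤ℚ ι n
ι-mono-≤ {n = n} z≤n = subst (_≤ℚ ι n) (sym ι0≡0) (0≤ι n)
ι-mono-≤ {suc m} {suc n} (s≤s m≤n) = subst₂ _≤ℚ_ (sym (ι-suc m)) (sym (ι-suc n)) (ℚₚ.+-monoʳ-≤ 1ℚ (ι-mono-≤ m≤n))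

ι-cancel-< : ∀ {m n} → ι m <ℚ ι n → m <ₙ n
ι-cancel-< {m} {n} ιm<ιn with n ℕₚ.≤? m
... | yes n≤m = contradiction (ℚₚ.<-≤-trans ιm<ιn (ι-mono-≤ n≤m)) (ℚₚ.<-irrefl refl)
... | no  n≰m = ℕₚ.≰⇒> n≰m

ι-cancel-≤ : ∀ {m n} → ι m ≤ℚ ι n → m ≤ n
ι-cancel-≤ {m} {n} ιm≤ιn with m ℕₚ.≤? n
... | yes m≤n = m≤n
... | no  m≰n = contradiction (ℚₚ.<-≤-trans (ι-mono-< (ℕₚ.≰⇒> m≰n)) ιm≤ιn) (ℚₚ.<-irrefl refl)
  where
  ι-mono-< : ∀ {m n} → m <ₙ n → ι m <ℚ ι n
  ι-mono-< {m} m<n = ℚₚ.<-≤-trans (subst₂ _<ℚ_ (ℚₚ.+-identityˡ (ι m)) (sym (ι-suc m)) (ℚₚ.+-monoˡ-< (ι m) 0<1)) (ι-mono-≤ m<n)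

1≤ι : ∀ n .{{_ : NonZero n}} → 1ℚ ≤ℚ ι n
1≤ι (suc n) = subst (_≤ℚ ι (suc n)) ι1≡1 (ι-mono-≤ {1} {suc n} (s≤s z≤n))

0<ι : ∀ n .{{_ : NonZero n}} → 0ℚ <ℚ ι n
0<ι n = ℚₚ.<-≤-trans 0<1 (1≤ι n)

q*↧q≡↥q : ∀ q {n} → ↥ q ≡ + n → q * ι (↧ₙ q) ≡ ι n
q*↧q≡↥q q {n} ↥q≡n = begin
  q * ι (↧ₙ q)               ≡⟨ cong (_* ι (↧ₙ q)) (ℚₚ.↥p/↧p≡p q) ⟨
  (↥ q / ↧ₙ q) * ι (↧ₙ q)    ≡⟨ cong (λ i → (i / ↧ₙ q) * ι (↧ₙ q)) ↥q≡n ⟩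
  (+ n / ↧ₙ q) * ι (↧ₙ q)    ≡⟨ /-*-cancel n (↧ₙ q) ⟩
  ι n                        ∎
  where open ≡-Reasoning

ratio-*-cancel : ∀ n d .{{_ : NonZero d}} → ratio n d * ι d ≡ ι n
ratio-*-cancel n (suc d) = /-*-cancel n (suc d)

ratio-≥0 : ∀ n d → 0ℚ ≤ℚ ratio n d
ratio-≥0 n zero    = ℚₚ.≤-refl
ratio-≥0 n (suc d) = ℚₚ.nonNegative⁻¹ _ {{ℚₚ.normalize-nonNeg n (suc d)}}

bernoulli-≤ : ∀ k → 0ℚ ≤ℚ a → a ≤ℚ 1ℚ → 1ℚ - ι k * a ≤ℚ (1ℚ - a) ^ k
bernoulli-≤ {a} zero    0≤a a≤1 = ℚₚ.≤-reflexive (trans (cong (λ z → 1ℚ - z * a) ι0≡0) (solve 1 (λ a → con 1ℚ :- con 0ℚ :* a := con 1ℚ) refl a))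
bernoulli-≤ {a} (suc k) 0≤a a≤1 = ℚₚ.≤-trans
  (0≤b-a⇒a≤b (subst (0ℚ ≤ℚ_)
     (trans (solve 2 (λ a k → k :* (a :* a) := (con 1ℚ :- a) :* (con 1ℚ :- k :* a) :- (con 1ℚ :- (con 1ℚ :+ k) :* a)) refl a (ι k))
            (cong (λ z → (1ℚ - a) * (1ℚ - ι k * a) - (1ℚ - z * a)) (sym (ι-suc k))))
     (*-≥0 (0≤ι k) (*-≥0 0≤a 0≤a))))
  (*-monoʳ-≤ (a≤b⇒0≤b-a a≤1) (bernoulli-≤ k 0≤a a≤1))

-- Finite sums over lists

𝟙 : Bool → ℚ
𝟙 b = if b then 1ℚ else 0ℚ

0≤𝟙 : ∀ b → 0ℚ ≤ℚ 𝟙 b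
0≤𝟙 true  = 0≤1
0≤𝟙 false = ℚₚ.≤-refl

𝟙≤1 : ∀ b → 𝟙 b ≤ℚ 1ℚ
𝟙≤1 true  = ℚₚ.≤-refl
𝟙≤1 false = 0≤1

opaque
  ∑ : (A → ℚ) → List A → ℚ
  ∑ f = foldr (λ x s → f x + s) 0ℚ

  ∑-[] : ∀ (f : A → ℚ) → ∑ f [] ≡ 0ℚ
  ∑-[] f = refl

  ∑-∷ : ∀ (f : A → ℚ) x xs → ∑ f (x ∷ xs) ≡ f x + ∑ f xs
  ∑-∷ f x xs = refl

  ∑-cong : ∀ {f g : A → ℚ} {xs} → All (λ x → f x ≡ g x) xs → ∑ f xs ≡ ∑ g xs
  ∑-cong []         = refl
  ∑-cong (eq ∷ eqs) = cong₂ _+_ eq (∑-cong eqs)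

  ∑-cong-≗ : ∀ {f g : A → ℚ} xs → f ≗ g → ∑ f xs ≡ ∑ g xs
  ∑-cong-≗ []       f≗g = refl
  ∑-cong-≗ (x ∷ xs) f≗g = cong₂ _+_ (f≗g x) (∑-cong-≗ xs f≗g)

  ∑-mono : ∀ {f g : A → ℚ} {xs} → All (λ x → f x ≤ℚ g x) xs → ∑ f xs ≤ℚ ∑ g xs
  ∑-mono []         = ℚₚ.≤-refl
  ∑-mono (le ∷ les) = ℚₚ.+-mono-≤ le (∑-mono les)

  ∑-++ : ∀ (f : A → ℚ) xs ys → ∑ f (xs ++ ys) ≡ ∑ f xs + ∑ f ys
  ∑-++ f []       ys = sym (ℚₚ.+-identityˡ _)
  ∑-++ f (x ∷ xs) ys = trans (cong (_+_ (f x)) (∑-++ f xs ys)) (sym (ℚₚ.+-assoc (f x) _ _))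

  ∑-map : ∀ (f : B → ℚ) (g : A → B) xs → ∑ f (map g xs) ≡ ∑ (f ∘ g) xs
  ∑-map f g []       = refl
  ∑-map f g (x ∷ xs) = cong (_+_ (f (g x))) (∑-map f g xs)

  ∑-concatMap : ∀ (f : B → ℚ) (g : A → List B) xs → ∑ f (concatMap g xs) ≡ ∑ (λ x → ∑ f (g x)) xs
  ∑-concatMap f g []       = refl
  ∑-concatMap f g (x ∷ xs) = trans (∑-++ f (g x) (concatMap g xs)) (cong (_+_ (∑ f (g x))) (∑-concatMap f g xs))

  ∑-*ˡ : ∀ a (f : A → ℚ) xs → ∑ (λ x → a * f x) xs ≡ a * ∑ f xs
  ∑-*ˡ a f []       = sym (ℚₚ.*-zeroʳ a)
  ∑-*ˡ a f (x ∷ xs) = trans (cong (_+_ (a * f x)) (∑-*ˡ a f xs)) (sym (ℚₚ.*-distribˡ-+ a (f x) _))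

  ∑-*ʳ : ∀ a (f : A → ℚ) xs → ∑ (λ x → f x * a) xs ≡ ∑ f xs * a
  ∑-*ʳ a f xs = trans (∑-cong-≗ xs λ x → ℚₚ.*-comm (f x) a) (trans (∑-*ˡ a f xs) (ℚₚ.*-comm a _))

  ∑-+ : ∀ (f g : A → ℚ) xs → ∑ (λ x → f x + g x) xs ≡ ∑ f xs + ∑ g xs
  ∑-+ f g []       = refl
  ∑-+ f g (x ∷ xs) = trans (cong (_+_ (f x + g x)) (∑-+ f g xs))
    (solve 4 (λ a b c d → (a :+ b) :+ (c :+ d) := (a :+ c) :+ (b :+ d)) refl (f x) (g x) _ _)

  ∑-const : ∀ a (xs : List A) → ∑ (λ _ → a) xs ≡ ι (length xs) * a
  ∑-const a []       = sym (trans (cong (_* a) ι0≡0) (ℚₚ.*-zeroˡ a))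
  ∑-const a (x ∷ xs) = trans (cong (_+_ a) (∑-const a xs))
    (trans (solve 2 (λ a k → a :+ k :* a := (con 1ℚ :+ k) :* a) refl a (ι (length xs))) (cong (_* a) (sym (ι-suc (length xs)))))

  ∑-filter : ∀ {P : A → Set} (P? : Decidable P) (f : A → ℚ) xs →
             ∑ f (filter P? xs) ≡ ∑ (λ x → 𝟙 (does (P? x)) * f x) xs
  ∑-filter P? f []       = refl
  ∑-filter P? f (x ∷ xs) with does (P? x)
  ... | true  = cong₂ _+_ (sym (ℚₚ.*-identityˡ (f x))) (∑-filter P? f xs)
  ... | false = trans (∑-filter P? f xs) (trans (sym (ℚₚ.+-identityˡ _)) (cong (_+ _) (sym (ℚₚ.*-zeroˡ (f x)))))

∑-≥0 : ∀ {f : A → ℚ} xs → (∀ x → 0ℚ ≤ℚ f x) → 0ℚ ≤ℚ ∑ f xs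
∑-≥0 {f = f} []       f≥0 = ℚₚ.≤-reflexive (sym (∑-[] f))
∑-≥0 {f = f} (x ∷ xs) f≥0 = subst (0ℚ ≤ℚ_) (sym (∑-∷ f x xs)) (+-≥0 (f≥0 x) (∑-≥0 xs f≥0))

-- Distributions

opaque
  -- The expectation with every real weight replaced by the i-th term of its Cauchy sequence.
  𝔼 : ℕ → Dist A → (A → ℚ) → ℚ
  𝔼 i d f = ∑ (λ (w , x) → seq w i * f x) d

module _ (i : ℕ) where

  opaque
    unfolding 𝔼 ∑

    -- Addition and multiplication of reals act term by term, so this equality is exact at every
    -- index. It is the passage from ℝ to ℚ.
    Pr≡𝔼 : ∀ (f : A → Bool) (d : Dist A) → seq (Pr f d) i ≡ 𝔼 i d (𝟙 ∘ f)
    Pr≡𝔼 f []            = refl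
    Pr≡𝔼 f ((w , x) ∷ d) = cong₂ _+_ (head (f x)) (Pr≡𝔼 f d)
      where
      head : ∀ b → seq (if b then w else 0ℝ) i ≡ seq w i * 𝟙 b
      head true  = sym (ℚₚ.*-identityʳ (seq w i))
      head false = sym (ℚₚ.*-zeroʳ (seq w i))

    𝔼-return : ∀ (x : A) f → 𝔼 i (return x) f ≡ f x
    𝔼-return x f = trans (ℚₚ.+-identityʳ (1ℚ * f x)) (ℚₚ.*-identityˡ (f x))

    𝔼-bernoulli : ∀ p f → 𝔼 i (bernoulli p) f ≡ seq p i * f true + (1ℚ - seq p i) * f false
    𝔼-bernoulli p f = cong (_+_ (seq p i * f true)) (ℚₚ.+-identityʳ ((1ℚ - seq p i) * f false))

  opaque
    unfolding 𝔼

    𝔼->>= : ∀ (d : Dist A) (g : A → Dist B) f → 𝔼 i (d >>= g) f ≡ 𝔼 i d (λ x → 𝔼 i (g x) f)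
    𝔼->>= d g f = trans (∑-concatMap _ _ d) (∑-cong-≗ d λ (w , x) →
      trans (∑-map _ _ (g x)) (trans (∑-cong-≗ (g x) λ (v , y) → ℚₚ.*-assoc (seq w i) (seq v i) (f y)) (∑-*ˡ (seq w i) _ (g x))))

    𝔼-uniform : ∀ (xs : List A) f → 𝔼 i (uniform xs) f ≡ ratio 1 (length xs) * ∑ f xs
    𝔼-uniform xs f = trans (∑-map _ _ xs) (∑-*ˡ (ratio 1 (length xs)) f xs)

    𝔼-cong : ∀ (d : Dist A) {f g : A → ℚ} → f ≗ g → 𝔼 i d f ≡ 𝔼 i d g
    𝔼-cong d f≗g = ∑-cong-≗ d λ (w , x) → cong (seq w i *_) (f≗g x)

    𝔼-*ˡ : ∀ (d : Dist A) a f → 𝔼 i d (λ x → a * f x) ≡ a * 𝔼 i d f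
    𝔼-*ˡ d a f = trans (∑-cong-≗ d λ (w , x) → solve 3 (λ w a y → w :* (a :* y) := a :* (w :* y)) refl (seq w i) a (f x)) (∑-*ˡ a (λ (w , x) → seq w i * f x) d)

    𝔼-+ : ∀ (d : Dist A) f g → 𝔼 i d (λ x → f x + g x) ≡ 𝔼 i d f + 𝔼 i d g
    𝔼-+ d f g = trans (∑-cong-≗ d λ (w , x) → ℚₚ.*-distribˡ-+ (seq w i) (f x) (g x)) (∑-+ (λ (w , x) → seq w i * f x) (λ (w , x) → seq w i * g x) d)

  𝔼-0 : ∀ (d : Dist A) → 𝔼 i d (λ _ → 0ℚ) ≡ 0ℚ
  𝔼-0 d = trans (𝔼-cong d λ x → sym (ℚₚ.*-zeroˡ 0ℚ)) (trans (𝔼-*ˡ d 0ℚ (λ _ → 0ℚ)) (ℚₚ.*-zeroˡ (𝔼 i d (λ _ → 0ℚ))))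

  𝔼-∑ : ∀ (d : Dist A) (f : B → A → ℚ) xs → 𝔼 i d (λ x → ∑ (λ y → f y x) xs) ≡ ∑ (λ y → 𝔼 i d (f y)) xs
  𝔼-∑ d f []       = trans (𝔼-cong d λ x → ∑-[] λ y → f y x) (trans (𝔼-0 d) (sym (∑-[] λ y → 𝔼 i d (f y))))
  𝔼-∑ d f (y ∷ xs) = begin
    𝔼 i d (λ x → ∑ (λ y → f y x) (y ∷ xs))        ≡⟨ 𝔼-cong d (λ x → ∑-∷ (λ y → f y x) y xs) ⟩
    𝔼 i d (λ x → f y x + ∑ (λ y → f y x) xs)      ≡⟨ 𝔼-+ d (f y) (λ x → ∑ (λ y → f y x) xs) ⟩
    𝔼 i d (f y) + 𝔼 i d (λ x → ∑ (λ y → f y x) xs) ≡⟨ cong (_+_ (𝔼 i d (f y))) (𝔼-∑ d f xs) ⟩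
    𝔼 i d (f y) + ∑ (λ y → 𝔼 i d (f y)) xs        ≡⟨ ∑-∷ (λ y → 𝔼 i d (f y)) y xs ⟨
    ∑ (λ y → 𝔼 i d (f y)) (y ∷ xs)                ∎
    where open ≡-Reasoning

  -- Mass at most 1 rather than equal to 1, because `uniform []` has mass 0; the bounds then cover
  -- every list of candidate subsets without a case distinction.
  record SubProb (d : Dist A) : Set where
    field
      𝔼-≥0 : ∀ f → (∀ x → 0ℚ ≤ℚ f x) → 0ℚ ≤ℚ 𝔼 i d f
      𝔼-1≤1 : 𝔼 i d (λ _ → 1ℚ) ≤ℚ 1ℚ

    𝔼-mono : ∀ f g → (∀ x → f x ≤ℚ g x) → 𝔼 i d f ≤ℚ 𝔼 i d g
    𝔼-mono f g f≤g = 0≤b-a⇒a≤b (subst (0ℚ ≤ℚ_)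
      (trans (𝔼-cong d λ x → solve 2 (λ a b → b :- a := b :+ con (- 1ℚ) :* a) refl (f x) (g x))
        (trans (𝔼-+ d g (λ x → (- 1ℚ) * f x)) (trans (cong (_+_ (𝔼 i d g)) (𝔼-*ˡ d (- 1ℚ) f))
          (solve 2 (λ a b → b :+ con (- 1ℚ) :* a := b :- a) refl (𝔼 i d f) (𝔼 i d g)))))
      (𝔼-≥0 (λ x → g x - f x) λ x → a≤b⇒0≤b-a (f≤g x)))

    𝔼-≤1 : ∀ f → (∀ x → f x ≤ℚ 1ℚ) → 𝔼 i d f ≤ℚ 1ℚ
    𝔼-≤1 f f≤1 = ℚₚ.≤-trans (𝔼-mono f (λ _ → 1ℚ) f≤1) 𝔼-1≤1

  open SubProb public

  return-subProb : ∀ (x : A) → SubProb (return x)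
  return-subProb x = record
    { 𝔼-≥0  = λ f f≥0 → subst (0ℚ ≤ℚ_) (sym (𝔼-return x f)) (f≥0 x)
    ; 𝔼-1≤1 = ℚₚ.≤-reflexive (𝔼-return x (λ _ → 1ℚ))
    }

  >>=-subProb : ∀ {d : Dist A} {g : A → Dist B} → SubProb d → (∀ x → SubProb (g x)) → SubProb (d >>= g)
  >>=-subProb {d = d} {g} sd sg = record
    { 𝔼-≥0  = λ f f≥0 → subst (0ℚ ≤ℚ_) (sym (𝔼->>= d g f)) (𝔼-≥0 sd _ λ x → 𝔼-≥0 (sg x) f f≥0)
    ; 𝔼-1≤1 = subst (_≤ℚ 1ℚ) (sym (𝔼->>= d g (λ _ → 1ℚ))) (𝔼-≤1 sd _ λ x → 𝔼-1≤1 (sg x))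
    }

  uniform-subProb : ∀ (xs : List A) → SubProb (uniform xs)
  uniform-subProb xs = record
    { 𝔼-≥0  = λ f f≥0 → subst (0ℚ ≤ℚ_) (sym (𝔼-uniform xs f)) (*-≥0 (ratio-≥0 1 (length xs)) (∑-≥0 xs f≥0))
    ; 𝔼-1≤1 = subst (_≤ℚ 1ℚ) (sym (trans (𝔼-uniform xs (λ _ → 1ℚ)) (cong (ratio 1 (length xs) *_) (trans (∑-const 1ℚ xs) (ℚₚ.*-identityʳ (ι (length xs))))))) (mass (length xs))
    }
    where
    mass : ∀ l → ratio 1 l * ι l ≤ℚ 1ℚ
    mass zero    = ℚₚ.≤-trans (ℚₚ.≤-reflexive (ℚₚ.*-zeroˡ (ι 0))) 0≤1
    mass (suc l) = ℚₚ.≤-reflexive (trans (ratio-*-cancel 1 (suc l)) ι1≡1)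

  if-subProb : ∀ b {d e : Dist A} → SubProb d → SubProb e → SubProb (if b then d else e)
  if-subProb true  sd se = sd
  if-subProb false sd se = se

  𝔼-1 : Dist A → Set
  𝔼-1 d = 𝔼 i d (λ _ → 1ℚ) ≡ 1ℚ

  >>=-𝔼-1 : ∀ {d : Dist A} {g : A → Dist B} → 𝔼-1 d → (∀ x → 𝔼-1 (g x)) → 𝔼-1 (d >>= g)
  >>=-𝔼-1 {d = d} {g} ed eg = trans (𝔼->>= d g (λ _ → 1ℚ)) (trans (𝔼-cong d eg) ed)

-- Products over pairs i < j

∏< : ∀ {n} → (Fin n → Fin n → ℚ) → ℚ
∏< f = ∏ λ u → ∏ λ w → if toℕ u <ᵇₙ toℕ w then f u w else 1ℚ

∏<-suc : ∀ {n} (f : Fin (suc n) → Fin (suc n) → ℚ) →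
         ∏< f ≡ ∏ (λ j → f zero (suc j)) * ∏< (λ i j → f (suc i) (suc j))
∏<-suc {n} f = cong₂ _*_ (ℚₚ.*-identityˡ (∏ λ j → f zero (suc j))) (∏-cong {n} λ i →
  ℚₚ.*-identityˡ (∏ λ j → if toℕ i <ᵇₙ toℕ j then f (suc i) (suc j) else 1ℚ))

∏-ones-≗ : ∀ {n} (f : Fin n → ℚ) → (∀ i → f i ≡ 1ℚ) → ∏ f ≡ 1ℚ
∏-ones-≗ {n} f f≡1 = trans (∏-cong f≡1) (∏-ones n)

∏-zero : ∀ {n} (f : Fin n → ℚ) i → f i ≡ 0ℚ → ∏ f ≡ 0ℚ
∏-zero f zero    eq = trans (cong (_* ∏ (f ∘ suc)) eq) (ℚₚ.*-zeroˡ (∏ (f ∘ suc)))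
∏-zero f (suc i) eq = trans (cong (f zero *_) (∏-zero (f ∘ suc) i eq)) (ℚₚ.*-zeroʳ (f zero))

∏-≥0 : ∀ {n} (f : Fin n → ℚ) → (∀ i → 0ℚ ≤ℚ f i) → 0ℚ ≤ℚ ∏ f
∏-≥0 {zero}  f f≥0 = 0≤1
∏-≥0 {suc n} f f≥0 = *-≥0 (f≥0 zero) (∏-≥0 (f ∘ suc) (f≥0 ∘ suc))

∏->0 : ∀ {n} (f : Fin n → ℚ) → (∀ i → 0ℚ <ℚ f i) → 0ℚ <ℚ ∏ f
∏->0 {zero}  f f>0 = 0<1
∏->0 {suc n} f f>0 = *->0 (f>0 zero) (∏->0 (f ∘ suc) (f>0 ∘ suc))

∏-mono : ∀ {n} (f g : Fin n → ℚ) → (∀ i → 0ℚ ≤ℚ f i) → (∀ i → f i ≤ℚ g i) → ∏ f ≤ℚ ∏ g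
∏-mono {zero}  f g f≥0 f≤g = ℚₚ.≤-refl
∏-mono {suc n} f g f≥0 f≤g = *-mono-≤ (f≥0 zero) (∏-≥0 (f ∘ suc) (f≥0 ∘ suc)) (f≤g zero) (∏-mono (f ∘ suc) (g ∘ suc) (f≥0 ∘ suc) (f≤g ∘ suc))

∏<-cong : ∀ {n} {f g : Fin n → Fin n → ℚ} → (∀ u w → f u w ≡ g u w) → ∏< f ≡ ∏< g
∏<-cong f≗g = ∏-cong λ u → ∏-cong λ w → cong (λ x → if toℕ u <ᵇₙ toℕ w then x else 1ℚ) (f≗g u w)

-- Partial graphs

fill : Maybe Bool → Bool → Bool
fill r b = fromMaybe b r

overlay : ∀ {n} → (Fin n → Fin n → Maybe Bool) → Graph n → Graph n
overlay c G = mkGraph λ u w → fill (c u w) (adj G u w)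

agrees : Maybe Bool → Bool → ℚ
agrees nothing  b = 1ℚ
agrees (just r) b = 𝟙 (does (r ≟ᵇ b))

-- A product of 0/1 factors rather than a decision, so that it splits along the rows of the graph in
-- the same way as the probability.
extends : ∀ {n} → (Fin n → Fin n → Maybe Bool) → Graph n → ℚ
extends c G = ∏< λ u w → agrees (c u w) (adj G u w)

-- For p ∈ [0, 1], weight p r is the probability that a p-biased bit agrees with r.
weight : ℚ → Maybe Bool → ℚ
weight p nothing      = 1ℚ
weight p (just true)  = p
weight p (just false) = 1ℚ - p

module _ (i : ℕ) (p : ℝ) where

  private
    p̂ = seq p i

  iid-suc : ∀ n φ → 𝔼 i (iid (bernoulli p) (suc n)) φ ≡
                    p̂ * 𝔼 i (iid (bernoulli p) n) (λ r → φ (true ∷ r)) + (1ℚ - p̂) * 𝔼 i (iid (bernoulli p) n) (λ r → φ (false ∷ r))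
  iid-suc n φ = trans (𝔼->>= i (bernoulli p) (λ b → iid (bernoulli p) n >>= λ r → return (b ∷ r)) φ) (trans (𝔼-bernoulli i p _)
    (cong₂ (λ a b → p̂ * a + (1ℚ - p̂) * b) (tail true) (tail false)))
    where
    tail : ∀ b → 𝔼 i (iid (bernoulli p) n >>= λ r → return (b ∷ r)) φ ≡ 𝔼 i (iid (bernoulli p) n) (λ r → φ (b ∷ r))
    tail b = trans (𝔼->>= i (iid (bernoulli p) n) _ φ) (𝔼-cong i (iid (bernoulli p) n) λ r → 𝔼-return i (b ∷ r) φ)

  Gnp-suc : ∀ n φ → 𝔼 i (Gnp (suc n) p) φ ≡ 𝔼 i (iid (bernoulli p) n) (λ r → 𝔼 i (Gnp n p) (λ G → φ (r ◁ G)))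
  Gnp-suc n φ = trans (𝔼->>= i (iid (bernoulli p) n) _ φ) (𝔼-cong i (iid (bernoulli p) n) λ r →
    trans (𝔼->>= i (Gnp n p) _ φ) (𝔼-cong i (Gnp n p) λ G → 𝔼-return i (r ◁ G) φ))

  -- Weighting by the probability of the prescribed bits turns overwriting them into conditioning on
  -- them. The bits are independent, so one bit is split off at a time.
  𝔼-fill-row : ∀ n (c : Fin n → Maybe Bool) (φ : Vec Bool n → ℚ) →
    ∏ (weight p̂ ∘ c) * 𝔼 i (iid (bernoulli p) n) (λ r → φ (tabulate λ j → fill (c j) (lookup r j))) ≡
    𝔼 i (iid (bernoulli p) n) (λ r → ∏ (λ j → agrees (c j) (lookup r j)) * φ r)
  𝔼-fill-row zero    c φ = trans (ℚₚ.*-identityˡ (𝔼 i (iid (bernoulli p) 0) λ _ → φ [])) (𝔼-cong i (iid (bernoulli p) 0) λ { [] → sym (ℚₚ.*-identityˡ (φ [])) })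
  𝔼-fill-row (suc n) c φ = begin
    weight p̂ (c zero) * w * 𝔼 i (iid (bernoulli p) (suc n)) (λ r → φ (tabulate λ j → fill (c j) (lookup r j)))
      ≡⟨ cong (weight p̂ (c zero) * w *_) (iid-suc n _) ⟩
    weight p̂ (c zero) * w * (p̂ * e (fill (c zero) true) + (1ℚ - p̂) * e (fill (c zero) false))
      ≡⟨ solve 5 (λ v w p a b → v :* w :* (p :* a :+ (con 1ℚ :- p) :* b) := v :* (p :* (w :* a) :+ (con 1ℚ :- p) :* (w :* b)))
           refl (weight p̂ (c zero)) w p̂ (e (fill (c zero) true)) (e (fill (c zero) false)) ⟩
    weight p̂ (c zero) * (p̂ * (w * e (fill (c zero) true)) + (1ℚ - p̂) * (w * e (fill (c zero) false)))
      ≡⟨ cong₂ (λ a b → weight p̂ (c zero) * (p̂ * a + (1ℚ - p̂) * b)) (ih _) (ih _) ⟩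
    weight p̂ (c zero) * (p̂ * s (fill (c zero) true) + (1ℚ - p̂) * s (fill (c zero) false))
      ≡⟨ first (c zero) ⟩
    p̂ * (agrees (c zero) true * s true) + (1ℚ - p̂) * (agrees (c zero) false * s false)
      ≡⟨ cong₂ (λ a b → p̂ * a + (1ℚ - p̂) * b) (absorb true) (absorb false) ⟨
    p̂ * 𝔼 i row (λ r → agrees (c zero) true * ∏ (λ j → agrees (c (suc j)) (lookup r j)) * φ (true ∷ r)) +
    (1ℚ - p̂) * 𝔼 i row (λ r → agrees (c zero) false * ∏ (λ j → agrees (c (suc j)) (lookup r j)) * φ (false ∷ r))
      ≡⟨ iid-suc n (λ r → ∏ (λ j → agrees (c j) (lookup r j)) * φ r) ⟨
    𝔼 i (iid (bernoulli p) (suc n)) (λ r → ∏ (λ j → agrees (c j) (lookup r j)) * φ r) ∎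
    where
    open ≡-Reasoning
    row = iid (bernoulli p) n
    w = ∏ (weight p̂ ∘ c ∘ suc)
    e s : Bool → ℚ
    e b = 𝔼 i row (λ r → φ (b ∷ tabulate λ j → fill (c (suc j)) (lookup r j)))
    s b = 𝔼 i row (λ r → ∏ (λ j → agrees (c (suc j)) (lookup r j)) * φ (b ∷ r))
    ih : ∀ b → w * e b ≡ s b
    ih b = 𝔼-fill-row n (c ∘ suc) (λ r → φ (b ∷ r))
    absorb : ∀ b → 𝔼 i row (λ r → agrees (c zero) b * ∏ (λ j → agrees (c (suc j)) (lookup r j)) * φ (b ∷ r)) ≡ agrees (c zero) b * s b
    absorb b = trans (𝔼-cong i row λ r → ℚₚ.*-assoc (agrees (c zero) b) (∏ λ j → agrees (c (suc j)) (lookup r j)) (φ (b ∷ r))) (𝔼-*ˡ i row (agrees (c zero) b) _)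
    -- For a prescribed bit both branches on the left take the same value, with total coefficient p
    -- + (1 - p) = 1; on the right `agrees` keeps a single branch.
    first : ∀ x → weight p̂ x * (p̂ * s (fill x true) + (1ℚ - p̂) * s (fill x false)) ≡ p̂ * (agrees x true * s true) + (1ℚ - p̂) * (agrees x false * s false)
    first nothing      = solve 3 (λ p a b → con 1ℚ :* (p :* a :+ (con 1ℚ :- p) :* b) := p :* (con 1ℚ :* a) :+ (con 1ℚ :- p) :* (con 1ℚ :* b)) refl p̂ (s true) (s false)
    first (just true)  = solve 3 (λ p a b → p :* (p :* a :+ (con 1ℚ :- p) :* a) := p :* (con 1ℚ :* a) :+ (con 1ℚ :- p) :* (con 0ℚ :* b)) refl p̂ (s true) (s false)
    first (just false) = solve 3 (λ p a b → (con 1ℚ :- p) :* (p :* b :+ (con 1ℚ :- p) :* b) := p :* (con 0ℚ :* a) :+ (con 1ℚ :- p) :* (con 1ℚ :* b)) refl p̂ (s true) (s false)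

  -- Since pairs are independent, conditioning G(n, p) on agreeing with `c` amounts to overwriting
  -- the prescribed pairs. Cleared of the division by the probability of `c`, this is a polynomial
  -- identity in p and follows row by row.
  𝔼-overlay : ∀ n (c : Fin n → Fin n → Maybe Bool) φ →
    ∏< (λ u w → weight p̂ (c u w)) * 𝔼 i (Gnp n p) (φ ∘ overlay c) ≡ 𝔼 i (Gnp n p) (λ G → extends c G * φ G)
  𝔼-overlay zero    c φ = trans (ℚₚ.*-identityˡ (𝔼 i (Gnp 0 p) λ _ → φ ∅)) (𝔼-cong i (Gnp 0 p) λ { ∅ → sym (ℚₚ.*-identityˡ (φ ∅)) })
  𝔼-overlay (suc n) c φ = begin
    ∏< (λ u w → weight p̂ (c u w)) * 𝔼 i (Gnp (suc n) p) (φ ∘ overlay c)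
      ≡⟨ cong₂ _*_ (∏<-suc λ u w → weight p̂ (c u w)) (Gnp-suc n (φ ∘ overlay c)) ⟩
    v * w * 𝔼 i row (λ r → 𝔼 i (Gnp n p) (λ G → φ (tabulate (λ j → fill (c zero (suc j)) (lookup r j)) ◁ overlay c′ G)))
      ≡⟨ ℚₚ.*-assoc v w (𝔼 i row (λ r → 𝔼 i (Gnp n p) (λ G → φ (tabulate (λ j → fill (c zero (suc j)) (lookup r j)) ◁ overlay c′ G)))) ⟩
    v * (w * 𝔼 i row (λ r → 𝔼 i (Gnp n p) (λ G → φ (tabulate (λ j → fill (c zero (suc j)) (lookup r j)) ◁ overlay c′ G))))
      ≡⟨ cong (v *_) (𝔼-*ˡ i row w _) ⟨
    v * 𝔼 i row (λ r → w * 𝔼 i (Gnp n p) (λ G → φ (tabulate (λ j → fill (c zero (suc j)) (lookup r j)) ◁ overlay c′ G)))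
      ≡⟨ cong (v *_) (𝔼-cong i row λ r → 𝔼-overlay n c′ (λ G → φ (tabulate (λ j → fill (c zero (suc j)) (lookup r j)) ◁ G))) ⟩
    v * 𝔼 i row (λ r → ψ (tabulate (λ j → fill (c zero (suc j)) (lookup r j))))
      ≡⟨ 𝔼-fill-row n (c zero ∘ suc) ψ ⟩
    𝔼 i row (λ r → ∏ (λ j → agrees (c zero (suc j)) (lookup r j)) * ψ r)
      ≡⟨ 𝔼-cong i row (λ r → trans (sym (𝔼-*ˡ i (Gnp n p) (∏ λ j → agrees (c zero (suc j)) (lookup r j)) λ G → extends c′ G * φ (r ◁ G))) (𝔼-cong i (Gnp n p) λ G →
           trans (sym (ℚₚ.*-assoc (∏ λ j → agrees (c zero (suc j)) (lookup r j)) (extends c′ G) (φ (r ◁ G)))) (cong (_* φ (r ◁ G)) (sym (∏<-suc λ u w → agrees (c u w) (adj (r ◁ G) u w)))))) ⟩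
    𝔼 i row (λ r → 𝔼 i (Gnp n p) (λ G → extends c (r ◁ G) * φ (r ◁ G)))
      ≡⟨ Gnp-suc n _ ⟨
    𝔼 i (Gnp (suc n) p) (λ G → extends c G * φ G) ∎
    where
    open ≡-Reasoning
    row = iid (bernoulli p) n
    c′ : Fin n → Fin n → Maybe Bool
    c′ u w = c (suc u) (suc w)
    v = ∏ (λ j → weight p̂ (c zero (suc j)))
    w = ∏< (λ x y → weight p̂ (c′ x y))
    ψ : Vec Bool n → ℚ
    ψ r = 𝔼 i (Gnp n p) (λ G → extends c′ G * φ (r ◁ G))

  bernoulli-𝔼-1 : 𝔼-1 i (bernoulli p)
  bernoulli-𝔼-1 = trans (𝔼-bernoulli i p _) (solve 1 (λ p → p :* con 1ℚ :+ (con 1ℚ :- p) :* con 1ℚ := con 1ℚ) refl p̂)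

  iid-𝔼-1 : ∀ n → 𝔼-1 i (iid (bernoulli p) n)
  iid-𝔼-1 zero    = 𝔼-return i {A = Vec Bool 0} [] (λ _ → 1ℚ)
  iid-𝔼-1 (suc n) = >>=-𝔼-1 i {d = bernoulli p} bernoulli-𝔼-1 λ b → >>=-𝔼-1 i {d = iid (bernoulli p) n} (iid-𝔼-1 n) λ r → 𝔼-return i (b ∷ r) (λ _ → 1ℚ)

  Gnp-𝔼-1 : ∀ n → 𝔼-1 i (Gnp n p)
  Gnp-𝔼-1 zero    = 𝔼-return i ∅ (λ _ → 1ℚ)
  Gnp-𝔼-1 (suc n) = >>=-𝔼-1 i {d = iid (bernoulli p) n} (iid-𝔼-1 n) λ r → >>=-𝔼-1 i {d = Gnp n p} (Gnp-𝔼-1 n) λ G → 𝔼-return i (r ◁ G) (λ _ → 1ℚ)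

  module _ (0≤p : 0ℚ ≤ℚ p̂) (p≤1 : p̂ ≤ℚ 1ℚ) where

    bernoulli-subProb : SubProb i (bernoulli p)
    bernoulli-subProb = record
      { 𝔼-≥0  = λ f f≥0 → subst (0ℚ ≤ℚ_) (sym (𝔼-bernoulli i p f)) (+-≥0 (*-≥0 0≤p (f≥0 true)) (*-≥0 (a≤b⇒0≤b-a p≤1) (f≥0 false)))
      ; 𝔼-1≤1 = ℚₚ.≤-reflexive bernoulli-𝔼-1
      }

    iid-subProb : ∀ n → SubProb i (iid (bernoulli p) n)
    iid-subProb zero    = return-subProb i []
    iid-subProb (suc n) = >>=-subProb i bernoulli-subProb λ b → >>=-subProb i (iid-subProb n) λ r → return-subProb i (b ∷ r)

    Gnp-subProb : ∀ n → SubProb i (Gnp n p)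
    Gnp-subProb zero    = return-subProb i ∅
    Gnp-subProb (suc n) = >>=-subProb i (iid-subProb n) λ r → >>=-subProb i (Gnp-subProb n) λ G → return-subProb i (r ◁ G)

if-<-cong : ∀ {n} (u w : Fin n) {x y : ℚ} → (u <ᶠ w → x ≡ y) →
            (if toℕ u <ᵇₙ toℕ w then x else 1ℚ) ≡ (if toℕ u <ᵇₙ toℕ w then y else 1ℚ)
if-<-cong u w eq with toℕ u <ᵇₙ toℕ w in u<ᵇw
... | true  = eq (ℕₚ.<ᵇ⇒< (toℕ u) (toℕ w) (subst T (sym u<ᵇw) tt))
... | false = refl

if-1 : ∀ b → (if b then 1ℚ else 1ℚ) ≡ 1ℚ
if-1 true  = refl
if-1 false = refl

∏<-* : ∀ {n} (f g : Fin n → Fin n → ℚ) → ∏< (λ u w → f u w * g u w) ≡ ∏< f * ∏< g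
∏<-* f g = trans (∏-cong λ u → trans (∏-cong λ w → if-* (toℕ u <ᵇₙ toℕ w) (f u w) (g u w))
                                      (∏-distrib-* (λ w → if toℕ u <ᵇₙ toℕ w then f u w else 1ℚ) λ w → if toℕ u <ᵇₙ toℕ w then g u w else 1ℚ))
                  (∏-distrib-* (λ u → ∏ λ w → if toℕ u <ᵇₙ toℕ w then f u w else 1ℚ) λ u → ∏ λ w → if toℕ u <ᵇₙ toℕ w then g u w else 1ℚ)
  where
  if-* : ∀ b x y → (if b then x * y else 1ℚ) ≡ (if b then x else 1ℚ) * (if b then y else 1ℚ)
  if-* true  x y = refl
  if-* false x y = refl

if-≥0 : ∀ b {x y} → 0ℚ ≤ℚ x → 0ℚ ≤ℚ y → 0ℚ ≤ℚ (if b then x else y)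
if-≥0 true  0≤x 0≤y = 0≤x
if-≥0 false 0≤x 0≤y = 0≤y

if->0 : ∀ b {x y} → 0ℚ <ℚ x → 0ℚ <ℚ y → 0ℚ <ℚ (if b then x else y)
if->0 true  0<x 0<y = 0<x
if->0 false 0<x 0<y = 0<y

∏<-≥0 : ∀ {n} (f : Fin n → Fin n → ℚ) → (∀ u w → 0ℚ ≤ℚ f u w) → 0ℚ ≤ℚ ∏< f
∏<-≥0 f f≥0 = ∏-≥0 _ λ u → ∏-≥0 _ λ w → if-≥0 (toℕ u <ᵇₙ toℕ w) (f≥0 u w) 0≤1

∏<->0 : ∀ {n} (f : Fin n → Fin n → ℚ) → (∀ u w → 0ℚ <ℚ f u w) → 0ℚ <ℚ ∏< f
∏<->0 f f>0 = ∏->0 _ λ u → ∏->0 _ λ w → if->0 (toℕ u <ᵇₙ toℕ w) (f>0 u w) 0<1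

∏<-ones : ∀ {n} (f : Fin n → Fin n → ℚ) → (∀ u w → u <ᶠ w → f u w ≡ 1ℚ) → ∏< f ≡ 1ℚ
∏<-ones f f≡1 = ∏-ones-≗ _ λ u → ∏-ones-≗ _ λ w → trans (if-<-cong u w (f≡1 u w)) (if-1 (toℕ u <ᵇₙ toℕ w))

∏<-zero : ∀ {n} (f : Fin n → Fin n → ℚ) u w → u <ᶠ w → f u w ≡ 0ℚ → ∏< f ≡ 0ℚ
∏<-zero f u w u<w f≡0 = ∏-zero _ u (∏-zero _ w factor)
  where
  factor : (if toℕ u <ᵇₙ toℕ w then f u w else 1ℚ) ≡ 0ℚ
  factor with toℕ u <ᵇₙ toℕ w | ℕₚ.<⇒<ᵇ u<w
  ... | true | _ = f≡0

-- Products over the vertices and pairs of a placed copy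

position-just : ∀ {m n} (v : Vec (Fin n) m) u {i} → position v u ≡ just i → lookup v i ≡ u
position-just (x ∷ v) u eq with x ≟ᶠ u
position-just (x ∷ v) u refl | yes x≡u = x≡u
... | no _ with position v u in eq′
position-just (x ∷ v) u refl | no _ | just i = position-just v u eq′

position-nothing : ∀ {m n} (v : Vec (Fin n) m) u → (∀ i → lookup v i ≢ u) → position v u ≡ nothing
position-nothing []      u v≢u = refl
position-nothing (x ∷ v) u v≢u with x ≟ᶠ u
... | yes x≡u = contradiction x≡u (v≢u zero)
... | no _    = cong (mapᴹ suc) (position-nothing v u (v≢u ∘ suc))

InjectiveVec : ∀ {m n} → Vec (Fin n) m → Set
InjectiveVec v = ∀ {i j} → lookup v i ≡ lookup v j → i ≡ j

position-lookup : ∀ {m n} (v : Vec (Fin n) m) → InjectiveVec v → ∀ i → position v (lookup v i) ≡ just i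
position-lookup v inj i with position v (lookup v i) in eq
... | just j  = cong just (inj (position-just v (lookup v i) eq))
... | nothing = contradiction eq (found v i)
  where
  found : ∀ {m n} (v : Vec (Fin n) m) i → position v (lookup v i) ≢ nothing
  found (x ∷ v) zero eq with x ≟ᶠ x
  found (x ∷ v) zero () | yes _
  ... | no x≢x = x≢x refl
  found (x ∷ v) (suc i) eq with x ≟ᶠ lookup v i
  found (x ∷ v) (suc i) () | yes _
  ... | no _ with position v (lookup v i) in eq′
  found (x ∷ v) (suc i) () | no _ | just _
  ... | nothing = found v i eq′

∏-single : ∀ {n} (x : Fin n) a → ∏ (λ u → if does (x ≟ᶠ u) then a else 1ℚ) ≡ a
∏-single {suc n} zero    a = trans (cong (a *_) (∏-ones n)) (ℚₚ.*-identityʳ a)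
∏-single {suc n} (suc x) a = trans (ℚₚ.*-identityˡ (∏ λ u → if does (x ≟ᶠ u) then a else 1ℚ)) (∏-single x a)

-- An injective `v` realises each coordinate at exactly one vertex, and every vertex outside `v`
-- contributes the factor `F nothing`, which is 1.
∏-position : ∀ {m n} (v : Vec (Fin n) m) → InjectiveVec v → ∀ (F : Maybe (Fin m) → ℚ) → F nothing ≡ 1ℚ →
             ∏ (λ u → F (position v u)) ≡ ∏ (λ i → F (just i))
∏-position {n = n} [] inj F F≡1 = ∏-ones-≗ {n} (λ _ → F nothing) λ _ → F≡1
∏-position {n = n} (x ∷ v) inj F F≡1 = begin
  ∏ (λ u → F (position (x ∷ v) u))                          ≡⟨ ∏-cong split ⟩
  ∏ (λ u → first u * F (mapᴹ suc (position v u)))           ≡⟨ ∏-distrib-* first (λ u → F (mapᴹ suc (position v u))) ⟩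
  ∏ first * ∏ (λ u → F (mapᴹ suc (position v u)))           ≡⟨ cong₂ _*_ (∏-single x (F (just zero))) (∏-position v (suc-injective ∘ inj) (F ∘ mapᴹ suc) F≡1) ⟩
  F (just zero) * ∏ (λ i → F (just (suc i)))                ∎
  where
  open ≡-Reasoning
  first : Fin n → ℚ
  first u = if does (x ≟ᶠ u) then F (just zero) else 1ℚ
  split : ∀ u → F (position (x ∷ v) u) ≡ first u * F (mapᴹ suc (position v u))
  split u with x ≟ᶠ u
  ... | no _     = sym (ℚₚ.*-identityˡ (F (mapᴹ suc (position v u))))
  -- By injectivity the first vertex does not recur in the tail, so its second factor is 1.
  ... | yes refl = sym (trans (cong (F (just zero) *_) (trans (cong (F ∘ mapᴹ suc) (position-nothing v x λ i eq → case-0≡suc (inj {suc i} {zero} eq))) F≡1)) (ℚₚ.*-identityʳ (F (just zero))))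
    where
    case-0≡suc : ∀ {k} {i : Fin k} → suc i ≢ zero
    case-0≡suc ()

onJust : ∀ {m} → (Fin m → Fin m → ℚ) → Maybe (Fin m) → Maybe (Fin m) → ℚ
onJust f (just i) (just j) = f i j
onJust f _        _        = 1ℚ

onJust-nothing : ∀ {m} (f : Fin m → Fin m → ℚ) x → onJust f x nothing ≡ 1ℚ
onJust-nothing f (just _) = refl
onJust-nothing f nothing  = refl

Increasing : ∀ {m n} → Vec (Fin n) m → Set
Increasing v = ∀ i j → i <ᶠ j → lookup v i <ᶠ lookup v j

increasing⇒injective : ∀ {m n} (v : Vec (Fin n) m) → Increasing v → InjectiveVec v
increasing⇒injective v inc {i} {j} eq with <ᶠ-cmp i j
... | tri< i<j _ _ = contradiction (inc i j i<j) (ℕₚ.<-irrefl (cong toℕ eq))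
... | tri≈ _ i≡j _ = i≡j
... | tri> _ _ j<i = contradiction (inc j i j<i) (ℕₚ.<-irrefl (cong toℕ (sym eq)))

<ᵇ-increasing : ∀ {m n} (v : Vec (Fin n) m) → Increasing v → ∀ i j →
                (toℕ (lookup v i) <ᵇₙ toℕ (lookup v j)) ≡ (toℕ i <ᵇₙ toℕ j)
<ᵇ-increasing v inc i j with toℕ i <ᵇₙ toℕ j in eq
... | true  = T-≡true (ℕₚ.<⇒<ᵇ (inc i j (ℕₚ.<ᵇ⇒< (toℕ i) (toℕ j) (subst T (sym eq) tt))))
  where
  T-≡true : ∀ {b} → T b → b ≡ true
  T-≡true {true} _ = refl
... | false with toℕ (lookup v i) <ᵇₙ toℕ (lookup v j) in eq′
...   | false = refl
...   | true with <ᶠ-cmp i j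
...     | tri< i<j _ _  = contradiction (ℕₚ.<⇒<ᵇ i<j) (subst (λ b → T b → ⊥) (sym eq) λ ())
...     | tri≈ _ refl _ = contradiction (ℕₚ.<ᵇ⇒< (toℕ (lookup v i)) (toℕ (lookup v i)) (subst T (sym eq′) tt)) (ℕₚ.<-irrefl refl)
...     | tri> _ _ j<i  = contradiction (inc j i j<i) (ℕₚ.<-asym (ℕₚ.<ᵇ⇒< (toℕ (lookup v i)) (toℕ (lookup v j)) (subst T (sym eq′) tt)))

-- Pairs not inside `v` contribute 1. Monotonicity of `v` makes the order of vertices agree with
-- that of coordinates, so each remaining pair is counted once, in the same order, on both sides.
∏<-position : ∀ {m n} (v : Vec (Fin n) m) → Increasing v → ∀ (f : Fin m → Fin m → ℚ) →
              ∏< (λ u w → onJust f (position v u) (position v w)) ≡ ∏< f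
∏<-position {m} v inc f = begin
  ∏< (λ u w → onJust f (position v u) (position v w))
    ≡⟨ ∏-cong (λ u → ∏-cong λ w → pointwise u w (position v u) (position v w) refl refl) ⟩
  ∏ (λ u → ∏ λ w → onJust f< (position v u) (position v w))
    ≡⟨ ∏-cong (λ u → ∏-position v inj (onJust f< (position v u)) (onJust-nothing f< (position v u))) ⟩
  ∏ (λ u → ∏ λ j → onJust f< (position v u) (just j))
    ≡⟨ ∏-position v inj (λ x → ∏ λ j → onJust f< x (just j)) (∏-ones m) ⟩
  ∏< f ∎
  where
  open ≡-Reasoning
  inj : InjectiveVec v
  inj = increasing⇒injective v inc
  f< : Fin m → Fin m → ℚ
  f< i j = if toℕ i <ᵇₙ toℕ j then f i j else 1ℚ
  pointwise : ∀ u w x y → position v u ≡ x → position v w ≡ y →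
              (if toℕ u <ᵇₙ toℕ w then onJust f x y else 1ℚ) ≡ onJust f< x y
  pointwise u w (just i) (just j) eq eq′ = cong (λ b → if b then f i j else 1ℚ)
    (trans (cong₂ (λ a b → toℕ a <ᵇₙ toℕ b) (sym (position-just v u eq)) (sym (position-just v w eq′))) (<ᵇ-increasing v inc i j))
  pointwise u w (just i) nothing  eq eq′ = if-1 (toℕ u <ᵇₙ toℕ w)
  pointwise u w nothing  y        eq eq′ = if-1 (toℕ u <ᵇₙ toℕ w)

-- The partial graph prescribed by a copy of H

copyOf : ∀ {m n} → Graph m → Vec (Fin n) m → Fin n → Fin n → Maybe Bool
copyOf H v u w = zipWithᴹ (adj H) (position v u) (position v w)

mkGraph-cong : ∀ {n} {a b : Fin n → Fin n → Bool} → (∀ u w → a u w ≡ b u w) → mkGraph a ≡ mkGraph b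
mkGraph-cong {zero}  a≗b = refl
mkGraph-cong {suc n} a≗b = cong₂ _◁_ (tabulate-cong λ j → a≗b zero (suc j)) (mkGraph-cong λ i j → a≗b (suc i) (suc j))

-- The left-hand side of plant-edge is the local function of plant, which has no name here.
mutual
  plant≡overlay : ∀ {m n} (H : Graph m) (v : Vec (Fin n) m) G → plant H v G ≡ overlay (copyOf H v) G
  plant≡overlay H v G = mkGraph-cong (plant-edge H v G)

  plant-edge : ∀ {m n} (H : Graph m) (v : Vec (Fin n) m) G u w → _ ≡ fill (copyOf H v u w) (adj G u w)
  plant-edge H v G u w with position v u | position v w
  ... | just _  | just _  = refl
  ... | just _  | nothing = refl
  ... | nothing | just _  = refl
  ... | nothing | nothing = refl

adj-sym : ∀ {n} (G : Graph n) i j → adj G i j ≡ adj G j i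
adj-sym (r ◁ G) zero    zero    = refl
adj-sym (r ◁ G) zero    (suc j) = refl
adj-sym (r ◁ G) (suc i) zero    = refl
adj-sym (r ◁ G) (suc i) (suc j) = adj-sym G i j

adj-irrefl : ∀ {n} (G : Graph n) i → adj G i i ≡ false
adj-irrefl (r ◁ G) zero    = refl
adj-irrefl (r ◁ G) (suc i) = adj-irrefl G i

agrees-≡ : ∀ {r b} → r ≡ b → agrees (just r) b ≡ 1ℚ
agrees-≡ {true}  refl = refl
agrees-≡ {false} refl = refl

agrees-≢ : ∀ {r b} → r ≢ b → agrees (just r) b ≡ 0ℚ
agrees-≢ {r} {b} r≢b with r ≟ᵇ b
... | yes r≡b = contradiction r≡b r≢b
... | no  _   = refl

Extends : ∀ {n} → (Fin n → Fin n → Maybe Bool) → Graph n → Set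
Extends c G = ∀ u w b → c u w ≡ just b → b ≡ adj G u w

extends-≥0 : ∀ {n} c (G : Graph n) → 0ℚ ≤ℚ extends c G
extends-≥0 c G = ∏<-≥0 _ λ u w → agrees-≥0 (c u w) (adj G u w)
  where
  agrees-≥0 : ∀ x b → 0ℚ ≤ℚ agrees x b
  agrees-≥0 nothing  b = 0≤1
  agrees-≥0 (just r) b = 0≤𝟙 (does (r ≟ᵇ b))

extends≡1 : ∀ {n} c (G : Graph n) → Extends c G → extends c G ≡ 1ℚ
extends≡1 c G ext = ∏<-ones _ λ u w _ → factor u w (c u w) refl
  where
  factor : ∀ u w x → c u w ≡ x → agrees x (adj G u w) ≡ 1ℚ
  factor u w nothing  eq = refl
  factor u w (just b) eq = agrees-≡ (ext u w b eq)

copy⇒extends : ∀ {m n} (H : Graph m) (G : Graph n) v → IsInducedCopy H G v → Extends (copyOf H v) G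
copy⇒extends H G v copy u w b eq with position v u in eq₁ | position v w in eq₂
copy⇒extends H G v copy u w b refl | just i | just j =
  trans (sym (copy i j)) (cong₂ (adj G) (position-just v u eq₁) (position-just v w eq₂))

𝟙-does : ∀ {P : Set} (P? : Dec P) → (P → a ≡ 1ℚ) → (¬ P → a ≡ 0ℚ) → 𝟙 (does P?) ≡ a
𝟙-does (yes p) a≡1 a≡0 = sym (a≡1 p)
𝟙-does (no ¬p) a≡1 a≡0 = sym (a≡0 ¬p)

-- `extends` inspects only pairs u < w, while a copy is tested on all pairs of coordinates. A
-- mismatch at a reversed pair moves to the ordered one by symmetry, and the diagonal cannot
-- mismatch because both adjacencies are irreflexive.
𝟙copy≡extends : ∀ {m n} (H : Graph m) (G : Graph n) v → Increasing v →
                𝟙 (does (isInducedCopy? H G v)) ≡ extends (copyOf H v) G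
𝟙copy≡extends {m} H G v inc = 𝟙-does (isInducedCopy? H G v)
  (extends≡1 (copyOf H v) G ∘ copy⇒extends H G v)
  (mismatch-any ∘ ¬∀⟶∃¬ m _ (λ i → all? λ j → adj G (lookup v i) (lookup v j) ≟ᵇ adj H i j))
  where
  inj : InjectiveVec v
  inj = increasing⇒injective v inc

  mismatch : ∀ i j → i <ᶠ j → adj G (lookup v i) (lookup v j) ≢ adj H i j → extends (copyOf H v) G ≡ 0ℚ
  mismatch i j i<j neq = ∏<-zero _ (lookup v i) (lookup v j) (inc i j i<j)
    (trans (cong₂ (λ x y → agrees (zipWithᴹ (adj H) x y) (adj G (lookup v i) (lookup v j))) (position-lookup v inj i) (position-lookup v inj j))
      (agrees-≢ (neq ∘ sym)))

  mismatch-any : (∃ λ i → (∀ j → adj G (lookup v i) (lookup v j) ≡ adj H i j) → ⊥) → extends (copyOf H v) G ≡ 0ℚ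
  mismatch-any (i , ¬row) with ¬∀⟶∃¬ m _ (λ j → adj G (lookup v i) (lookup v j) ≟ᵇ adj H i j) ¬row
  ... | j , neq with <ᶠ-cmp i j
  ...   | tri< i<j _ _  = mismatch i j i<j neq
  ...   | tri≈ _ refl _ = contradiction (trans (adj-irrefl G (lookup v i)) (sym (adj-irrefl H i))) neq
  ...   | tri> _ _ j<i  = mismatch j i j<i λ eq → neq (trans (adj-sym G (lookup v i) (lookup v j)) (trans eq (adj-sym H j i)))

edgeWeight : ∀ {m} → ℚ → Graph m → Fin m → Fin m → ℚ
edgeWeight p H i j = weight p (just (adj H i j))

-- The probability that a G(m, p) graph equals H.
copyWeight : ∀ {m} → ℚ → Graph m → ℚ
copyWeight p H = ∏< (edgeWeight p H)

weight-copyOf : ∀ {m n} p (H : Graph m) (v : Vec (Fin n) m) u w →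
                weight p (copyOf H v u w) ≡ onJust (edgeWeight p H) (position v u) (position v w)
weight-copyOf p H v u w with position v u | position v w
... | just _  | just _  = refl
... | just _  | nothing = refl
... | nothing | just _  = refl
... | nothing | nothing = refl

∏<-weight-copyOf : ∀ {m n} p (H : Graph m) (v : Vec (Fin n) m) → Increasing v →
                   ∏< (λ u w → weight p (copyOf H v u w)) ≡ copyWeight p H
∏<-weight-copyOf p H v inc = trans (∏<-cong (weight-copyOf p H v)) (∏<-position v inc (edgeWeight p H))

both : ∀ {m} → Subset m → Fin m → Fin m → Bool
both U i j = lookup U i ∧ lookup U j

-- When U is the set of coordinates shared by two placements, the inside factor is the one that
-- treating the two copies as independent would count twice.
weightInside weightOutside : ∀ {m} → ℚ → Graph m → Subset m → ℚ
weightInside  p H U = ∏< λ i j → if both U i j then edgeWeight p H i j else 1ℚ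
weightOutside p H U = ∏< λ i j → if both U i j then 1ℚ else edgeWeight p H i j

inside*outside : ∀ {m} p (H : Graph m) U → weightOutside p H U * weightInside p H U ≡ copyWeight p H
inside*outside p H U = trans (sym (∏<-* (λ i j → if both U i j then 1ℚ else edgeWeight p H i j) λ i j → if both U i j then edgeWeight p H i j else 1ℚ))
  (∏<-cong λ i j → split (both U i j) (edgeWeight p H i j))
  where
  split : ∀ b x → (if b then 1ℚ else x) * (if b then x else 1ℚ) ≡ x
  split true  x = ℚₚ.*-identityˡ x
  split false x = ℚₚ.*-identityʳ x

agreement : ∀ {m n} → Vec (Fin n) m → Vec (Fin n) m → Subset m
agreement = zipWith λ s t → does (s ≟ᶠ t)

Aligned : ∀ {m n} → Vec (Fin n) m → Vec (Fin n) m → Set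
Aligned S T = ∀ i j → lookup S i ≡ lookup T j → i ≡ j

module _ {m n} (p : ℚ) (H : Graph m) (S T : Vec (Fin n) m) (incS : Increasing S) (incT : Increasing T) (al : Aligned S T) where

  private
    U = agreement S T

    -- Alignment forbids a vertex of T from occurring in S at a different coordinate.
    position-S : ∀ j → (lookup U j ≡ true × position S (lookup T j) ≡ just j) ⊎ (lookup U j ≡ false × position S (lookup T j) ≡ nothing)
    position-S j rewrite lookup-zipWith (λ s t → does (s ≟ᶠ t)) j S T with lookup S j ≟ᶠ lookup T j
    ... | yes eq = inj₁ (refl , trans (cong (position S) (sym eq)) (position-lookup S (increasing⇒injective S incS) j))
    ... | no neq = inj₂ (refl , position-nothing S (lookup T j) λ i eq → neq (trans (cong (lookup S) (sym (al i j eq))) eq))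

    weight-<∣>-nothing : ∀ x → weight p (x <∣> nothing) ≡ weight p x * 1ℚ
    weight-<∣>-nothing (just x) = sym (ℚₚ.*-identityʳ (weight p (just x)))
    weight-<∣>-nothing nothing  = refl

    outside : Fin m → Fin m → ℚ
    outside i j = if both U i j then 1ℚ else edgeWeight p H i j

    factor : ∀ u w x y → position T u ≡ x → position T w ≡ y →
             weight p (copyOf H S u w <∣> zipWithᴹ (adj H) x y) ≡ weight p (copyOf H S u w) * onJust outside x y
    factor u w (just i) (just j) eq eq′ rewrite sym (position-just T u eq) | sym (position-just T w eq′)
      with position-S i | position-S j
    ... | inj₁ (a , b) | inj₁ (c , d) rewrite a | b | c | d = sym (ℚₚ.*-identityʳ (edgeWeight p H i j))
    ... | inj₁ (a , b) | inj₂ (c , d) rewrite a | b | c | d = sym (ℚₚ.*-identityˡ (edgeWeight p H i j))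
    ... | inj₂ (a , b) | _            rewrite a | b         = sym (ℚₚ.*-identityˡ (edgeWeight p H i j))
    factor u w (just i) nothing eq eq′ = weight-<∣>-nothing (copyOf H S u w)
    factor u w nothing  y       eq eq′ = weight-<∣>-nothing (copyOf H S u w)

  -- The union of the two prescriptions costs all pairs of S and those pairs of T that do not lie
  -- inside the agreement set; shared pairs carry the same bit of H and are paid for once.
  ∏<-weight-pair : ∏< (λ u w → weight p (copyOf H S u w <∣> copyOf H T u w)) ≡ copyWeight p H * weightOutside p H (agreement S T)
  ∏<-weight-pair = begin
    ∏< (λ u w → weight p (copyOf H S u w <∣> copyOf H T u w))
      ≡⟨ ∏<-cong (λ u w → factor u w (position T u) (position T w) refl refl) ⟩
    ∏< (λ u w → weight p (copyOf H S u w) * onJust outside (position T u) (position T w))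
      ≡⟨ ∏<-* (λ u w → weight p (copyOf H S u w)) (λ u w → onJust outside (position T u) (position T w)) ⟩
    ∏< (λ u w → weight p (copyOf H S u w)) * ∏< (λ u w → onJust outside (position T u) (position T w))
      ≡⟨ cong₂ _*_ (∏<-weight-copyOf p H S incS) (∏<-position T incT outside) ⟩
    copyWeight p H * weightOutside p H U ∎
    where open ≡-Reasoning

-- Sets obeying the partition

concatMap⁺ : ∀ {P : B → Set} {f : A → List B} {xs} → All (All P ∘ f) xs → All P (concatMap f xs)
concatMap⁺ = Allₚ.concat⁺ ∘ Allₚ.map⁺

choices⁺ : ∀ {m} (P : Fin m → A → Set) (xss : Vec (List A) m) →
           (∀ i → All (P i) (lookup xss i)) → All (λ S → ∀ i → P i (lookup S i)) (choices xss)
choices⁺ P []         ps = (λ ()) ∷ []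
choices⁺ P (xs ∷ xss) ps = concatMap⁺ (All.map (λ px → Allₚ.map⁺ (All.map (λ pS → λ { zero → px ; (suc i) → pS i })
  (choices⁺ (P ∘ suc) xss (ps ∘ suc)))) (ps zero))

module _ (m n : ℕ) .{{_ : NonZero m}} where

  part : Fin m → List (Fin n)
  part i = filter (inPart? m i) (allFin n)

  InParts : Vec (Fin n) m → Set
  InParts S = ∀ i → InPart m i (lookup S i)

  obeying-inParts : All InParts (obeying m n)
  obeying-inParts = choices⁺ (InPart m) (tabulate part) λ i →
    subst (All (InPart m i)) (sym (lookup∘tabulate part i)) (Allₚ.all-filter (inPart? m i) (allFin n))

  inPart-< : ∀ {i j} {u w : Fin n} → InPart m i u → InPart m j w → i <ᶠ j → u <ᶠ w
  inPart-< {i} {j} (_ , u<) (≤w , _) i<j = ℕₚ.<-≤-trans u< (ℕₚ.≤-trans (ℕₚ.*-monoˡ-≤ (n /ₙ m) i<j) ≤w)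

  inParts⇒increasing : ∀ S → InParts S → Increasing S
  inParts⇒increasing S in-S i j = inPart-< (in-S i) (in-S j)

  inParts⇒aligned : ∀ S T → InParts S → InParts T → Aligned S T
  inParts⇒aligned S T in-S in-T i j eq with <ᶠ-cmp i j
  ... | tri< i<j _ _ = contradiction (inPart-< (in-S i) (in-T j) i<j) (ℕₚ.<-irrefl (cong toℕ eq))
  ... | tri≈ _ i≡j _ = i≡j
  ... | tri> _ _ j<i = contradiction (inPart-< (in-T j) (in-S i) j<i) (ℕₚ.<-irrefl (cong toℕ (sym eq)))

  part-unique : ∀ i → Unique (part i)
  part-unique i = Uniqueₚ.filter⁺ (inPart? m i) (Uniqueₚ.allFin⁺ n)

-- Removing vertex 0 either shifts the interval down by one or, when it begins at 0, uses up one of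
-- its l members; hence an induction on n with a varying start a.
interval-length : ∀ l {n} a {P : Fin n → Set} (P? : Decidable P) → a +ₙ l ≤ n →
                  (∀ u → a ≤ toℕ u → toℕ u <ₙ a +ₙ l → P u) → l ≤ length (filter P? (allFin n))
interval-length l {zero} a P? a+l≤n in-P = ℕₚ.≤-trans (ℕₚ.m≤n+m l a) (ℕₚ.≤-trans a+l≤n z≤n)
interval-length l {suc n} a {P} P? a+l≤n in-P = subst (λ xs → l ≤ length (filter P? (zero ∷ xs))) (Listₚ.map-tabulate (λ i → i) suc) (step l a a+l≤n in-P)
  where
  tail : ∀ l a → a +ₙ l ≤ n → (∀ u → a ≤ toℕ u → toℕ u <ₙ a +ₙ l → P (suc u)) → l ≤ length (filter P? (map suc (allFin n)))
  tail l a le in-P′ = subst (l ≤_) (trans (sym (Listₚ.length-map suc (filter (P? ∘ suc) (allFin n)))) (cong length (sym (filter-map suc P? (allFin n)))))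
    (interval-length l a (P? ∘ suc) le in-P′)
    where
    filter-map : ∀ {A B : Set} (f : A → B) {Q : B → Set} (Q? : Decidable Q) xs → filter Q? (map f xs) ≡ map f (filter (Q? ∘ f) xs)
    filter-map f Q? []       = refl
    filter-map f Q? (x ∷ xs) with does (Q? (f x))
    ... | true  = cong (f x ∷_) (filter-map f Q? xs)
    ... | false = filter-map f Q? xs

  step : ∀ l a → a +ₙ l ≤ suc n → (∀ u → a ≤ toℕ u → toℕ u <ₙ a +ₙ l → P u) → l ≤ length (filter P? (zero ∷ map suc (allFin n)))
  step zero    a       le in-P′ = z≤n
  step (suc l) zero    (s≤s le) in-P′ = subst (λ xs → suc l ≤ length xs) (sym (Listₚ.filter-accept P? (in-P′ zero z≤n (s≤s z≤n))))
    (s≤s (tail l zero le λ u _ u< → in-P′ (suc u) z≤n (s≤s u<)))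
  step l@(suc _) (suc a) (s≤s le) in-P′ = ℕₚ.≤-trans (tail l a le λ u a≤u u< → in-P′ (suc u) (s≤s a≤u) (s≤s u<)) longer
    where
    longer : length (filter P? (map suc (allFin n))) ≤ length (filter P? (zero ∷ map suc (allFin n)))
    longer with does (P? zero)
    ... | true  = ℕₚ.n≤1+n _
    ... | false = ℕₚ.≤-refl

part-length : ∀ m n .{{_ : NonZero m}} → m ∣ n → ∀ i → n /ₙ m ≤ length (part m n i)
part-length m n m∣n i = interval-length (n /ₙ m) (toℕ i *ₙ (n /ₙ m)) (inPart? m i)
  (ℕₚ.≤-trans (ℕₚ.≤-reflexive (ℕₚ.+-comm (toℕ i *ₙ (n /ₙ m)) (n /ₙ m))) (ℕₚ.≤-trans (ℕₚ.*-monoˡ-≤ (n /ₙ m) (toℕ<n i)) (ℕₚ.≤-reflexive (m*[n/m]≡n m∣n))))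
  (λ u ≤u u< → ≤u , subst (toℕ u <ₙ_) (ℕₚ.+-comm (toℕ i *ₙ (n /ₙ m)) (n /ₙ m)) u<)

∑-choices : ∀ {m} (f : Vec A (suc m) → ℚ) xs (xss : Vec (List A) m) →
            ∑ f (choices (xs ∷ xss)) ≡ ∑ (λ x → ∑ (λ S → f (x ∷ S)) (choices xss)) xs
∑-choices f xs xss = trans (∑-concatMap f (λ x → map (x ∷_) (choices xss)) xs) (∑-cong-≗ xs λ x → ∑-map f (x ∷_) (choices xss))

ι-length-choices : ∀ {m} xs (xss : Vec (List A) m) → ι (length (choices (xs ∷ xss))) ≡ ι (length xs) * ι (length (choices xss))
ι-length-choices xs xss = begin
  ι (length (choices (xs ∷ xss)))                  ≡⟨ ι-length (choices (xs ∷ xss)) ⟨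
  ∑ (λ _ → 1ℚ) (choices (xs ∷ xss))                ≡⟨ ∑-choices (λ _ → 1ℚ) xs xss ⟩
  ∑ (λ _ → ∑ (λ _ → 1ℚ) (choices xss)) xs          ≡⟨ ∑-const (∑ (λ _ → 1ℚ) (choices xss)) xs ⟩
  ι (length xs) * ∑ (λ _ → 1ℚ) (choices xss)       ≡⟨ cong (ι (length xs) *_) (ι-length (choices xss)) ⟩
  ι (length xs) * ι (length (choices xss))         ∎
  where
  open ≡-Reasoning
  ι-length : ∀ {B : Set} (ys : List B) → ∑ (λ _ → 1ℚ) ys ≡ ι (length ys)
  ι-length ys = trans (∑-const 1ℚ ys) (ℚₚ.*-identityʳ (ι (length ys)))

module _ {n : ℕ} {w y : ℚ} (0≤w : 0ℚ ≤ℚ w) (0≤y : 0ℚ ≤ℚ y) where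

  private
    match : Fin n → Fin n → ℚ
    match s t = if does (s ≟ᶠ t) then w else 1ℚ

    ∑-match-≢ : ∀ s ts → All (s ≢_) ts → ∑ (match s) ts ≡ ι (length ts)
    ∑-match-≢ s []       []           = trans (∑-[] (match s)) (sym ι0≡0)
    ∑-match-≢ s (t ∷ ts) (s≢t ∷ s∉ts) = trans (∑-∷ (match s) t ts) (trans (cong₂ _+_ head (∑-match-≢ s ts s∉ts)) (sym (ι-suc (length ts))))
      where
      head : match s t ≡ 1ℚ
      head with s ≟ᶠ t
      ... | yes s≡t = contradiction s≡t s≢t
      ... | no _    = refl

    ∑-match : ∀ s ts → Unique ts → ∑ (match s) ts ≤ℚ ι (length ts) + w
    ∑-match s []       []          = subst₂ _≤ℚ_ (sym (∑-[] (match s))) (cong (_+ w) (sym ι0≡0)) (subst (0ℚ ≤ℚ_) (sym (ℚₚ.+-identityˡ w)) 0≤w)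
    ∑-match s (t ∷ ts) (t∉ts ∷ ts!) = subst₂ _≤ℚ_ (sym (∑-∷ (match s) t ts)) (cong (_+ w) (sym (ι-suc (length ts)))) (bound (s ≟ᶠ t) refl)
      where
      bound : ∀ (d : Dec (s ≡ t)) → match s t ≡ (if does d then w else 1ℚ) → match s t + ∑ (match s) ts ≤ℚ (1ℚ + ι (length ts)) + w
      bound (yes refl) eq = subst₂ _≤ℚ_ (sym (cong₂ _+_ eq (∑-match-≢ s ts t∉ts)))
        (solve 2 (λ l w → con 1ℚ :+ (w :+ l) := (con 1ℚ :+ l) :+ w) refl (ι (length ts)) w)
        (subst (_≤ℚ 1ℚ + (w + ι (length ts))) (ℚₚ.+-identityˡ (w + ι (length ts))) (ℚₚ.+-monoˡ-≤ (w + ι (length ts)) 0≤1))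
      bound (no _) eq = subst₂ _≤ℚ_ (cong (_+ ∑ (match s) ts) (sym eq)) (sym (ℚₚ.+-assoc 1ℚ (ι (length ts)) w)) (ℚₚ.+-monoʳ-≤ 1ℚ (∑-match s ts ts!))

    card-∷ : ∀ {m} b (U : Subset m) → w ^ card (b ∷ U) ≡ (if b then w else 1ℚ) * w ^ card U
    card-∷ true  U = refl
    card-∷ false U = sym (ℚₚ.*-identityˡ (w ^ card U))

  -- The exponent counts agreeing coordinates, so the double sum is a product over coordinates. In a
  -- part of size L each s equals at most one t, so the factor is at most L (L + w), which is at
  -- most (1 + y) L².
  ∑∑-agreement : ∀ {m} (xss : Vec (List (Fin n)) m) → (∀ i → Unique (lookup xss i)) → (∀ i → w ≤ℚ y * ι (length (lookup xss i))) →
    ∑ (λ S → ∑ (λ T → w ^ card (agreement S T)) (choices xss)) (choices xss) ≤ℚ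
    (1ℚ + y) ^ m * (ι (length (choices xss)) * ι (length (choices xss)))
  ∑∑-agreement []         xs! w≤ = ℚₚ.≤-reflexive (trans (∑-singleton _) (trans (∑-singleton _) (sym (cong (1ℚ *_) (cong₂ _*_ ι1≡1 ι1≡1)))))
    where
    ∑-singleton : ∀ (f : Vec (Fin n) 0 → ℚ) → ∑ f ([] ∷ []) ≡ f []
    ∑-singleton f = trans (∑-∷ f [] []) (trans (cong (_+_ (f [])) (∑-[] f)) (ℚₚ.+-identityʳ (f [])))
  ∑∑-agreement {suc m} (xs ∷ xss) xs! w≤ = begin
    ∑ (λ S → ∑ (λ T → w ^ card (agreement S T)) (choices (xs ∷ xss))) (choices (xs ∷ xss))
      ≡⟨ factorise ⟩
    ∑ (λ s → ∑ (match s) xs) xs * K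
      ≤⟨ *-mono-≤ (∑∑-≥0) K≥0 first (∑∑-agreement xss (xs! ∘ suc) (w≤ ∘ suc)) ⟩
    L * (L + y * L) * ((1ℚ + y) ^ m * (N * N))
      ≡⟨ solve 4 (λ l y e n → l :* (l :+ y :* l) :* (e :* (n :* n)) := (con 1ℚ :+ y) :* e :* ((l :* n) :* (l :* n))) refl L y ((1ℚ + y) ^ m) N ⟩
    (1ℚ + y) ^ suc m * ((L * N) * (L * N))
      ≡⟨ cong (λ z → (1ℚ + y) ^ suc m * (z * z)) (ι-length-choices xs xss) ⟨
    (1ℚ + y) ^ suc m * (ι (length (choices (xs ∷ xss))) * ι (length (choices (xs ∷ xss)))) ∎
    where
    open ℚₚ.≤-Reasoning
    L = ι (length xs)
    N = ι (length (choices xss))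
    h : Vec (Fin n) m → Vec (Fin n) m → ℚ
    h S T = w ^ card (agreement S T)
    K = ∑ (λ S → ∑ (h S) (choices xss)) (choices xss)
    match-≥0 : ∀ s t → 0ℚ ≤ℚ match s t
    match-≥0 s t = if-≥0 (does (s ≟ᶠ t)) 0≤w 0≤1
    ∑∑-≥0 : 0ℚ ≤ℚ ∑ (λ s → ∑ (match s) xs) xs
    ∑∑-≥0 = ∑-≥0 xs λ s → ∑-≥0 xs λ t → match-≥0 s t
    K≥0 : 0ℚ ≤ℚ K
    K≥0 = ∑-≥0 (choices xss) λ S → ∑-≥0 (choices xss) λ T → ^-≥0 (card (agreement S T)) 0≤w
    first : ∑ (λ s → ∑ (match s) xs) xs ≤ℚ L * (L + y * L)
    first = subst (∑ (λ s → ∑ (match s) xs) xs ≤ℚ_) (∑-const (L + y * L) xs)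
      (∑-mono (All.universal (λ s → ℚₚ.≤-trans (∑-match s xs (xs! zero)) (ℚₚ.+-monoʳ-≤ L (w≤ zero))) xs))
    inner : ∀ s S → ∑ (λ T → w ^ card (agreement (s ∷ S) T)) (choices (xs ∷ xss)) ≡ ∑ (match s) xs * ∑ (h S) (choices xss)
    inner s S = trans (∑-choices (λ T → w ^ card (agreement (s ∷ S) T)) xs xss)
      (trans (∑-cong-≗ xs λ t → trans (∑-cong-≗ (choices xss) λ T → card-∷ (does (s ≟ᶠ t)) (agreement S T)) (∑-*ˡ (match s t) (h S) (choices xss)))
        (∑-*ʳ (∑ (h S) (choices xss)) (match s) xs))
    factorise : ∑ (λ S → ∑ (λ T → w ^ card (agreement S T)) (choices (xs ∷ xss))) (choices (xs ∷ xss)) ≡ ∑ (λ s → ∑ (match s) xs) xs * K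
    factorise = trans (∑-choices (λ S → ∑ (λ T → w ^ card (agreement S T)) (choices (xs ∷ xss))) xs xss)
      (trans (∑-cong-≗ xs λ s → trans (∑-cong-≗ (choices xss) (inner s)) (∑-*ˡ (∑ (match s) xs) (λ S → ∑ (h S) (choices xss)) (choices xss)))
        (∑-*ʳ K (λ s → ∑ (match s) xs) xs))

-- Balanced graphs

-- By symmetry each unordered pair occurs twice in the double product, and the diagonal factors are
-- at most 1. Passing to the square replaces the number of edges by the sum of degrees, which is
-- what the average degree measures.
∏∏≤∏<² : ∀ {n} (g : Fin n → Fin n → ℚ) → (∀ i j → 0ℚ ≤ℚ g i j) → (∀ i j → g i j ≡ g j i) → (∀ i → g i i ≤ℚ 1ℚ) →
         ∏ (λ i → ∏ (g i)) ≤ℚ ∏< g * ∏< g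
∏∏≤∏<² {zero}  g g≥0 g-sym g-diag = ℚₚ.≤-refl
∏∏≤∏<² {suc n} g g≥0 g-sym g-diag = begin
  g zero zero * R * ∏ (λ i → g (suc i) zero * ∏ (g′ i))
    ≡⟨ cong (g zero zero * R *_) (trans (∏-distrib-* (λ i → g (suc i) zero) (λ i → ∏ (g′ i))) (cong (_* ∏ (λ i → ∏ (g′ i))) (∏-cong λ i → g-sym (suc i) zero))) ⟩
  g zero zero * R * (R * ∏ (λ i → ∏ (g′ i)))
    ≡⟨ solve 3 (λ a r x → a :* r :* (r :* x) := a :* ((r :* r) :* x)) refl (g zero zero) R (∏ (λ i → ∏ (g′ i))) ⟩
  g zero zero * (R * R * ∏ (λ i → ∏ (g′ i)))
    ≤⟨ *-mono-≤ (g≥0 zero zero) (*-≥0 (square-≥0 R) (∏-≥0 _ λ i → ∏-≥0 _ λ j → g≥0 (suc i) (suc j))) (g-diag zero)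
         (*-monoʳ-≤ (square-≥0 R) (∏∏≤∏<² g′ (λ i j → g≥0 (suc i) (suc j)) (λ i j → g-sym (suc i) (suc j)) (g-diag ∘ suc))) ⟩
  1ℚ * (R * R * (∏< g′ * ∏< g′))
    ≡⟨ solve 2 (λ r t → con 1ℚ :* (r :* r :* (t :* t)) := (r :* t) :* (r :* t)) refl R (∏< g′) ⟩
  (R * ∏< g′) * (R * ∏< g′)
    ≡⟨ cong₂ _*_ (∏<-suc g) (∏<-suc g) ⟨
  ∏< g * ∏< g ∎
  where
  open ℚₚ.≤-Reasoning
  R = ∏ λ j → g zero (suc j)
  g′ : Fin n → Fin n → ℚ
  g′ i j = g (suc i) (suc j)

∏-if-lookup : ∀ {n} z (V : Subset n) → ∏ (λ j → if lookup V j then z else 1ℚ) ≡ z ^ card V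
∏-if-lookup z []          = refl
∏-if-lookup z (true  ∷ V) = cong (z *_) (∏-if-lookup z V)
∏-if-lookup z (false ∷ V) = trans (ℚₚ.*-identityˡ (∏ λ j → if lookup V j then z else 1ℚ)) (∏-if-lookup z V)

∏-^ : ∀ {n} z (d : Fin n → ℕ) → ∏ (λ i → z ^ d i) ≡ z ^ sum (tabulate d)
∏-^ {zero}  z d = refl
∏-^ {suc n} z d = trans (cong (z ^ d zero *_) (∏-^ z (d ∘ suc))) (sym (^-homo-* z (d zero) (sum (tabulate (d ∘ suc)))))

-- A named version of the local function in `avgDegreeOn`, so that `avgDegreeOn H U` is by
-- definition the ratio of its sum to `card U`.
degreeOn : ∀ {m} → Graph m → Subset m → Fin m → ℕ
degreeOn H U i = if lookup U i then card (neighbours H i ∩ U) else 0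

module _ {m} (H : Graph m) (U : Subset m) {p : ℚ} (0≤p : 0ℚ ≤ℚ p) (p≤1 : p ≤ℚ 1ℚ) where

  private
    0≤1-p : 0ℚ ≤ℚ 1ℚ - p
    0≤1-p = a≤b⇒0≤b-a p≤1

    1-p≤1 : 1ℚ - p ≤ℚ 1ℚ
    1-p≤1 = 0≤b-a⇒a≤b (subst (0ℚ ≤ℚ_) (solve 1 (λ p → p := con 1ℚ :- (con 1ℚ :- p)) refl p) 0≤p)

    -- `g′` lowers `g` by putting a factor 1 - p on every pair in U, edges and diagonal included.
    -- The product of a row in U is then p^degree (1 - p)^u, whatever the number of non-edges.
    g g′ : Fin m → Fin m → ℚ
    g  i j = if both U i j then edgeWeight p H i j else 1ℚ
    g′ i j = if both U i j then (if adj H i j then p else 1ℚ) * (1ℚ - p) else 1ℚ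

    edge-≥0 : ∀ b → 0ℚ ≤ℚ weight p (just b)
    edge-≥0 true  = 0≤p
    edge-≥0 false = 0≤1-p

    edge-bound : ∀ b → (if b then p else 1ℚ) * (1ℚ - p) ≤ℚ weight p (just b)
    edge-bound true  = subst (p * (1ℚ - p) ≤ℚ_) (ℚₚ.*-identityʳ p) (*-monoʳ-≤ 0≤p 1-p≤1)
    edge-bound false = ℚₚ.≤-reflexive (ℚₚ.*-identityˡ (1ℚ - p))

    g′≥0 : ∀ i j → 0ℚ ≤ℚ g′ i j
    g′≥0 i j = if-≥0 (both U i j) (*-≥0 (if-≥0 (adj H i j) 0≤p 0≤1) 0≤1-p) 0≤1

    g′≤g : ∀ i j → g′ i j ≤ℚ g i j
    g′≤g i j with both U i j
    ... | true  = edge-bound (adj H i j)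
    ... | false = ℚₚ.≤-refl

    g-sym : ∀ i j → g i j ≡ g j i
    g-sym i j = cong₂ (λ b e → if b then weight p (just e) else 1ℚ) (∧-comm (lookup U i) (lookup U j)) (adj-sym H i j)

    g-diag : ∀ i → g i i ≤ℚ 1ℚ
    g-diag i rewrite adj-irrefl H i with both U i i
    ... | true  = 1-p≤1
    ... | false = ℚₚ.≤-refl

    row : ∀ i → ∏ (g′ i) ≡ p ^ degreeOn H U i * (if lookup U i then (1ℚ - p) ^ card U else 1ℚ)
    row i with lookup U i
    ... | false = ∏-ones m
    ... | true  = begin
      ∏ (λ j → if lookup U j then (if adj H i j then p else 1ℚ) * (1ℚ - p) else 1ℚ)
        ≡⟨ ∏-cong factor ⟩
      ∏ (λ j → (if lookup (neighbours H i ∩ U) j then p else 1ℚ) * (if lookup U j then 1ℚ - p else 1ℚ))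
        ≡⟨ ∏-distrib-* (λ j → if lookup (neighbours H i ∩ U) j then p else 1ℚ) (λ j → if lookup U j then 1ℚ - p else 1ℚ) ⟩
      ∏ (λ j → if lookup (neighbours H i ∩ U) j then p else 1ℚ) * ∏ (λ j → if lookup U j then 1ℚ - p else 1ℚ)
        ≡⟨ cong₂ _*_ (∏-if-lookup p (neighbours H i ∩ U)) (∏-if-lookup (1ℚ - p) U) ⟩
      p ^ card (neighbours H i ∩ U) * (1ℚ - p) ^ card U ∎
      where
      open ≡-Reasoning
      factor : ∀ j → (if lookup U j then (if adj H i j then p else 1ℚ) * (1ℚ - p) else 1ℚ) ≡
                     (if lookup (neighbours H i ∩ U) j then p else 1ℚ) * (if lookup U j then 1ℚ - p else 1ℚ)
      factor j rewrite lookup-zipWith _∧_ j (neighbours H i) U | lookup∘tabulate (adj H i) j with adj H i j | lookup U j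
      ... | true  | true  = refl
      ... | true  | false = refl
      ... | false | true  = refl
      ... | false | false = refl

  weightInside²-≥ : p ^ sum (tabulate (degreeOn H U)) * ((1ℚ - p) ^ card U) ^ card U ≤ℚ weightInside p H U * weightInside p H U
  weightInside²-≥ = begin
    p ^ sum (tabulate (degreeOn H U)) * ((1ℚ - p) ^ card U) ^ card U
      ≡⟨ cong₂ _*_ (∏-^ p (degreeOn H U)) (∏-if-lookup ((1ℚ - p) ^ card U) U) ⟨
    ∏ (λ i → p ^ degreeOn H U i) * ∏ (λ i → if lookup U i then (1ℚ - p) ^ card U else 1ℚ)
      ≡⟨ ∏-distrib-* (λ i → p ^ degreeOn H U i) (λ i → if lookup U i then (1ℚ - p) ^ card U else 1ℚ) ⟨
    ∏ (λ i → p ^ degreeOn H U i * (if lookup U i then (1ℚ - p) ^ card U else 1ℚ))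
      ≡⟨ ∏-cong row ⟨
    ∏ (λ i → ∏ (g′ i))
      ≤⟨ ∏-mono _ _ (λ i → ∏-≥0 _ (g′≥0 i)) (λ i → ∏-mono _ _ (g′≥0 i) (g′≤g i)) ⟩
    ∏ (λ i → ∏ (g i))
      ≤⟨ ∏∏≤∏<² g (λ i j → if-≥0 (both U i j) (edge-≥0 (adj H i j)) 0≤1) g-sym g-diag ⟩
    weightInside p H U * weightInside p H U ∎
    where open ℚₚ.≤-Reasoning

  weightInside-≥0 : 0ℚ ≤ℚ weightInside p H U
  weightInside-≥0 = ∏<-≥0 _ λ i j → if-≥0 (both U i j) (edge-≥0 (adj H i j)) 0≤1

  -- In the square, edges cost p^D ≥ p^(A u / B) for the degree sum D, and non-edges cost (1 -
  -- p)^(u²) ≥ 2^(-u) because u ≤ m. What remains is the u-th power of p^(A/B) w² / 2; raising to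
  -- the power B removes the fraction.
  weightInside-≥ : ∀ {w} A B .{{_ : NonZero B}} → 0ℚ ≤ℚ w → sum (tabulate (degreeOn H U)) *ₙ B ≤ A *ₙ card U →
                   ½ ≤ℚ (1ℚ - p) ^ m → 1ℚ ≤ℚ p ^ A * (½ * (w * w)) ^ B → 1ℚ ≤ℚ weightInside p H U * w ^ card U
  weightInside-≥ {w} A B 0≤w deg-bound ½≤ 1≤ =
    ^-cancelˡ-≤ 2 0≤x (^-cancelˡ-≤ B (^-≥0 2 0≤x) (subst (_≤ℚ (x ^ 2) ^ B) (sym (trans (cong (_^ B) (1^k≡1 2)) (1^k≡1 B))) (begin
      1ℚ                                                ≤⟨ 1≤^ u 1≤ ⟩
      (p ^ A * (½ * (w * w)) ^ B) ^ u                   ≡⟨ ^-distrib-* (p ^ A) ((½ * (w * w)) ^ B) u ⟩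
      (p ^ A) ^ u * ((½ * (w * w)) ^ B) ^ u             ≡⟨ cong₂ _*_ (^-assocʳ p A u) (^-comm (½ * (w * w)) B u) ⟩
      p ^ (A *ₙ u) * ((½ * (w * w)) ^ u) ^ B            ≤⟨ *-monoˡ-≤ (^-≥0 B (^-≥0 u 0≤½w²)) (^-antimonoʳ-≤ 0≤p p≤1 deg-bound) ⟩
      p ^ (D *ₙ B) * ((½ * (w * w)) ^ u) ^ B            ≡⟨ cong (_* ((½ * (w * w)) ^ u) ^ B) (^-assocʳ p D B) ⟨
      (p ^ D) ^ B * ((½ * (w * w)) ^ u) ^ B             ≡⟨ ^-distrib-* (p ^ D) ((½ * (w * w)) ^ u) B ⟨
      (p ^ D * (½ * (w * w)) ^ u) ^ B                   ≤⟨ ^-monoˡ-≤ B (*-≥0 (^-≥0 D 0≤p) (^-≥0 u 0≤½w²)) square ⟩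
      (x ^ 2) ^ B                                       ∎)))
    where
    open ℚₚ.≤-Reasoning
    u = card U
    D = sum (tabulate (degreeOn H U))
    x = weightInside p H U * w ^ u
    0≤½ : 0ℚ ≤ℚ ½
    0≤½ = ℚₚ.nonNegative⁻¹ ½
    0≤½w² : 0ℚ ≤ℚ ½ * (w * w)
    0≤½w² = *-≥0 0≤½ (square-≥0 w)
    0≤x : 0ℚ ≤ℚ x
    0≤x = *-≥0 weightInside-≥0 (^-≥0 u 0≤w)
    square : p ^ D * (½ * (w * w)) ^ u ≤ℚ x ^ 2
    square = begin
      p ^ D * (½ * (w * w)) ^ u
        ≡⟨ cong (p ^ D *_) (trans (^-distrib-* ½ (w * w) u) (cong (½ ^ u *_) (^-distrib-* w w u))) ⟩
      p ^ D * (½ ^ u * (w ^ u * w ^ u))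
        ≤⟨ *-monoʳ-≤ (^-≥0 D 0≤p) (*-monoˡ-≤ (square-≥0 (w ^ u))
             (^-monoˡ-≤ u 0≤½ (ℚₚ.≤-trans ½≤ (^-antimonoʳ-≤ 0≤1-p 1-p≤1 (∣p∣≤n U))))) ⟩
      p ^ D * (((1ℚ - p) ^ u) ^ u * (w ^ u * w ^ u))
        ≡⟨ ℚₚ.*-assoc (p ^ D) (((1ℚ - p) ^ u) ^ u) (w ^ u * w ^ u) ⟨
      p ^ D * ((1ℚ - p) ^ u) ^ u * (w ^ u * w ^ u)
        ≤⟨ *-monoˡ-≤ (square-≥0 (w ^ u)) weightInside²-≥ ⟩
      weightInside p H U * weightInside p H U * (w ^ u * w ^ u)
        ≡⟨ solve 2 (λ q v → q :* q :* (v :* v) := (q :* v) :* ((q :* v) :* con 1ℚ)) refl (weightInside p H U) (w ^ u) ⟩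
      x ^ 2 ∎

-- Balancedness speaks of non-empty sets, and an empty U has degree sum 0. For the others,
-- multiplying by `card U` and B clears both denominators.
balanced-degreeOn : ∀ {m} (H : Graph m) → Balanced H → ∀ A B → avgDegree H * ι B ≤ℚ ι A →
                    ∀ U → sum (tabulate (degreeOn H U)) *ₙ B ≤ A *ₙ card U
balanced-degreeOn H bal A B avg≤ U with nonempty? U
... | no ¬ne = subst (λ d → d *ₙ B ≤ A *ₙ card U) (sym (sum-zero (degreeOn H U) no-degree)) z≤n
  where
  sum-zero : ∀ {n} (d : Fin n → ℕ) → (∀ i → d i ≡ 0) → sum (tabulate d) ≡ 0
  sum-zero {zero}  d d≡0 = refl
  sum-zero {suc n} d d≡0 = cong₂ _+ₙ_ (d≡0 zero) (sum-zero (d ∘ suc) (d≡0 ∘ suc))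
  no-degree : ∀ i → degreeOn H U i ≡ 0
  no-degree i with lookup U i in eq
  ... | true  = contradiction (i , lookup⇒[]= i U eq) ¬ne
  ... | false = refl
... | yes ne = ι-cancel-≤ (begin
  ι (D *ₙ B)                           ≡⟨ ι-* D B ⟩
  ι D * ι B                            ≡⟨ cong (_* ι B) (ratio-*-cancel D (card U)) ⟨
  ratio D (card U) * ι (card U) * ι B  ≤⟨ *-monoˡ-≤ (0≤ι B) (*-monoˡ-≤ (0≤ι (card U)) (bal U ne)) ⟩
  avgDegree H * ι (card U) * ι B       ≡⟨ solve 3 (λ a u b → a :* u :* b := a :* b :* u) refl (avgDegree H) (ι (card U)) (ι B) ⟩
  avgDegree H * ι B * ι (card U)       ≤⟨ *-monoˡ-≤ (0≤ι (card U)) avg≤ ⟩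
  ι A * ι (card U)                     ≡⟨ ι-* A (card U) ⟨
  ι (A *ₙ card U)                      ∎)
  where
  open ℚₚ.≤-Reasoning
  D = sum (tabulate (degreeOn H U))
  instance
    card≢0 : NonZero (card U)
    card≢0 = ℕ.>-nonZero (ℕₚ.≤-<-trans z≤n (x∈p⇒∣p-x∣<∣p∣ (proj₂ ne)))

-- First and second moments of the number of copies

attackOn : ∀ {m n} → Graph n → (k k' : ℕ) → List (Vec (Fin n) m) → Dist (Graph n)
attackOn G k k' []         = deleteInRandom G k ⊤
attackOn G k k' cs@(_ ∷ _) = uniform cs >>= λ S → hide G S k k'

𝔼->>=-cong : ∀ i (d : Dist A) {g h : A → Dist B} φ → (∀ x → g x ≡ h x) → 𝔼 i (d >>= g) φ ≡ 𝔼 i d (λ x → 𝔼 i (h x) φ)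
𝔼->>=-cong i d {g} φ g≗h = trans (𝔼->>= i d g φ) (𝔼-cong i d λ x → cong (λ e → 𝔼 i e φ) (g≗h x))

-- The left-hand side of attack≡attackOn is the local function of AG[_].
mutual
  𝔼-AG : ∀ {m} .{{_ : NonZero m}} i (H : Graph m) n p k k' φ →
         𝔼 i (AG[ H ] n p k k') φ ≡ 𝔼 i (Gnp n p) (λ G → 𝔼 i (attackOn G k k' (copies H G)) φ)
  𝔼-AG {m} {{m≢0}} i H n p k k' φ = 𝔼->>=-cong i (Gnp n p) φ (attack≡attackOn {m} {{m≢0}} H n p k k')

  attack≡attackOn : ∀ {m} .{{_ : NonZero m}} (H : Graph m) n (p : ℝ) k k' (G : Graph n) → _ ≡ attackOn G k k' (copies H G)
  attack≡attackOn H n p k k' G with copies H G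
  ... | []    = refl
  ... | _ ∷ _ = refl

module _ (i : ℕ) where

  deleteInRandom-subProb : ∀ {n} (G : Graph n) s C → SubProb i (deleteInRandom G s C)
  deleteInRandom-subProb G s C = >>=-subProb i (uniform-subProb i (subsetsOfSize s C)) λ I → return-subProb i (deleteInside G I)

  hide-subProb : ∀ {m n} (G : Graph n) (S : Vec (Fin n) m) k k' → SubProb i (hide G S k k')
  hide-subProb G S k k' = if-subProb i ((k ∸ k') ℕ.≤ᵇ card (noNeighbourIn G S))
    (deleteInRandom-subProb G (k ∸ k') (noNeighbourIn G S)) (deleteInRandom-subProb G k ⊤)

  attackOn-subProb : ∀ {m n} (G : Graph n) k k' (cs : List (Vec (Fin n) m)) → SubProb i (attackOn G k k' cs)
  attackOn-subProb G k k' []         = deleteInRandom-subProb G k ⊤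
  attackOn-subProb G k k' cs@(_ ∷ _) = >>=-subProb i (uniform-subProb i cs) λ S → hide-subProb G S k k'

-- Chebyshev's argument for one value of X, with denominators cleared: either X ≥ β a, or (X − a)² ≥ (1 − β)² a².
chebyshev-pointwise : ∀ {β a x y t} → 0ℚ ≤ℚ β → β ≤ℚ 1ℚ → 0ℚ ≤ℚ a → 0ℚ ≤ℚ x → 0ℚ ≤ℚ t → t ≤ℚ 1ℚ → x * t ≡ y →
  let K = ((1ℚ - β) * a) * ((1ℚ - β) * a) in β * a * (t * K - (x - a) * (x - a)) ≤ℚ y * K
chebyshev-pointwise {β} {a} {x} {y} {t} 0≤β β≤1 0≤a 0≤x 0≤t t≤1 xt≡y with β * a ℚₚ.≤? x
... | yes βa≤x = begin
  β * a * (t * K - (x - a) * (x - a))  ≤⟨ *-monoʳ-≤ (*-≥0 0≤β 0≤a) (drop (square-≥0 (x - a))) ⟩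
  β * a * (t * K)                      ≤⟨ *-monoˡ-≤ (*-≥0 0≤t 0≤K) βa≤x ⟩
  x * (t * K)                          ≡⟨ trans (sym (ℚₚ.*-assoc x t K)) (cong (_* K) xt≡y) ⟩
  y * K                                ∎
  where
  open ℚₚ.≤-Reasoning
  K = ((1ℚ - β) * a) * ((1ℚ - β) * a)
  0≤K : 0ℚ ≤ℚ K
  0≤K = square-≥0 ((1ℚ - β) * a)
  drop : ∀ {b c} → 0ℚ ≤ℚ c → b - c ≤ℚ b
  drop {b} {c} 0≤c = 0≤b-a⇒a≤b (subst (0ℚ ≤ℚ_) (solve 2 (λ b c → c := b :- (b :- c)) refl b c) 0≤c)
... | no βa≰x = ℚₚ.≤-trans
  (0≤b-a⇒a≤b (subst (0ℚ ≤ℚ_)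
    (solve 4 (λ c t k z → c :* (z :- t :* k) := con 0ℚ :- c :* (t :* k :- z)) refl (β * a) t K ((x - a) * (x - a)))
    (*-≥0 (*-≥0 0≤β 0≤a) (a≤b⇒0≤b-a (begin
      t * K                ≤⟨ *-monoˡ-≤ 0≤K t≤1 ⟩
      1ℚ * K               ≡⟨ ℚₚ.*-identityˡ K ⟩
      K                    ≤⟨ *-mono-≤ 0≤[1-β]a 0≤[1-β]a far far ⟩
      (a - x) * (a - x)    ≡⟨ solve 2 (λ a x → (a :- x) :* (a :- x) := (x :- a) :* (x :- a)) refl a x ⟩
      (x - a) * (x - a)    ∎)))))
  (subst (λ z → 0ℚ ≤ℚ z * K) xt≡y (*-≥0 (*-≥0 0≤x 0≤t) 0≤K))
  where
  open ℚₚ.≤-Reasoning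
  K = ((1ℚ - β) * a) * ((1ℚ - β) * a)
  0≤K : 0ℚ ≤ℚ K
  0≤K = square-≥0 ((1ℚ - β) * a)
  0≤[1-β]a : 0ℚ ≤ℚ (1ℚ - β) * a
  0≤[1-β]a = *-≥0 (a≤b⇒0≤b-a β≤1) 0≤a
  far : (1ℚ - β) * a ≤ℚ a - x
  far = 0≤b-a⇒a≤b (subst (0ℚ ≤ℚ_) (solve 3 (λ β a x → β :* a :- x := (a :- x) :- (con 1ℚ :- β) :* a) refl β a x) (a≤b⇒0≤b-a (ℚₚ.<⇒≤ (ℚₚ.≰⇒> βa≰x))))

𝟙*𝟙≤ : ∀ {P Q : Set} (P? : Dec P) (Q? : Dec Q) → 0ℚ ≤ℚ a → (P → Q → 1ℚ ≤ℚ a) → 𝟙 (does P?) * 𝟙 (does Q?) ≤ℚ a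
𝟙*𝟙≤ (yes p) (yes q) 0≤a 1≤a = 1≤a p q
𝟙*𝟙≤ (yes p) (no ¬q) 0≤a 1≤a = 0≤a
𝟙*𝟙≤ (no ¬p) (yes q) 0≤a 1≤a = 0≤a
𝟙*𝟙≤ (no ¬p) (no ¬q) 0≤a 1≤a = 0≤a

module Moments (i : ℕ) (p : ℝ) {m : ℕ} .{{_ : NonZero m}} (n : ℕ) (H : Graph m)
               (0<p : 0ℚ <ℚ seq p i) (p<1 : seq p i <ℚ 1ℚ) where

  private
    p̂ = seq p i
    obs = obeying m n

  N q : ℚ
  N = ι (length obs)
  q = copyWeight p̂ H

  0≤p : 0ℚ ≤ℚ p̂
  0≤p = ℚₚ.<⇒≤ 0<p

  p≤1 : p̂ ≤ℚ 1ℚ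
  p≤1 = ℚₚ.<⇒≤ p<1

  0<q : 0ℚ <ℚ q
  0<q = ∏<->0 (edgeWeight p̂ H) λ u w → positive-edge (adj H u w)
    where
    positive-edge : ∀ b → 0ℚ <ℚ weight p̂ (just b)
    positive-edge true  = 0<p
    positive-edge false = subst (_<ℚ 1ℚ - p̂) (ℚₚ.+-inverseʳ p̂) (ℚₚ.+-monoˡ-< (- p̂) p<1)

  copy : Vec (Fin n) m → Graph n → ℚ
  copy S G = 𝟙 (does (isInducedCopy? H G S))

  copy-≥0 : ∀ S G → 0ℚ ≤ℚ copy S G
  copy-≥0 S G = 0≤𝟙 (does (isInducedCopy? H G S))

  X : Graph n → ℚ
  X G = ∑ (λ S → copy S G) obs

  Gₙ : Dist (Graph n)
  Gₙ = Gnp n p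

  Gₙ-subProb : SubProb i Gₙ
  Gₙ-subProb = Gnp-subProb i p 0≤p p≤1 n

  𝔼-extends : ∀ c → 𝔼 i Gₙ (extends c) ≡ ∏< (λ u w → weight p̂ (c u w))
  𝔼-extends c = begin
    𝔼 i Gₙ (extends c)                               ≡⟨ 𝔼-cong i Gₙ (λ G → sym (ℚₚ.*-identityʳ (extends c G))) ⟩
    𝔼 i Gₙ (λ G → extends c G * 1ℚ)                  ≡⟨ 𝔼-overlay i p n c (λ _ → 1ℚ) ⟨
    W * 𝔼 i Gₙ (λ _ → 1ℚ)                            ≡⟨ cong (W *_) (Gnp-𝔼-1 i p n) ⟩
    W * 1ℚ                                           ≡⟨ ℚₚ.*-identityʳ W ⟩
    W                                                ∎
    where
    open ≡-Reasoning
    W = ∏< (λ u w → weight p̂ (c u w))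

  -- Planting overwrites exactly the pairs inside S, so it conditions on S being a copy, an event of
  -- probability q.
  𝔼-planted : ∀ (φ : Graph n → ℚ) S → InParts m n S →
              q * 𝔼 i Gₙ (λ G → φ (plant H S G)) ≡ 𝔼 i Gₙ (λ G → copy S G * φ G)
  𝔼-planted φ S in-S = begin
    q * 𝔼 i Gₙ (λ G → φ (plant H S G))
      ≡⟨ cong₂ _*_ (sym (∏<-weight-copyOf p̂ H S inc)) (𝔼-cong i Gₙ λ G → cong φ (plant≡overlay H S G)) ⟩
    ∏< (λ u w → weight p̂ (copyOf H S u w)) * 𝔼 i Gₙ (φ ∘ overlay (copyOf H S))
      ≡⟨ 𝔼-overlay i p n (copyOf H S) φ ⟩
    𝔼 i Gₙ (λ G → extends (copyOf H S) G * φ G)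
      ≡⟨ 𝔼-cong i Gₙ (λ G → cong (_* φ G) (sym (𝟙copy≡extends H G S inc))) ⟩
    𝔼 i Gₙ (λ G → copy S G * φ G) ∎
    where
    open ≡-Reasoning
    inc : Increasing S
    inc = inParts⇒increasing m n S in-S

  𝔼-X : 𝔼 i Gₙ X ≡ N * q
  𝔼-X = trans (𝔼-∑ i Gₙ copy obs) (trans (∑-cong (All.map (λ {S} → each S) (obeying-inParts m n))) (∑-const q obs))
    where
    each : ∀ S → InParts m n S → 𝔼 i Gₙ (copy S) ≡ q
    each S in-S = trans (𝔼-cong i Gₙ λ G → 𝟙copy≡extends H G S (inParts⇒increasing m n S in-S))
      (trans (𝔼-extends (copyOf H S)) (∏<-weight-copyOf p̂ H S (inParts⇒increasing m n S in-S)))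

  -- Here w is the price of one common vertex in the correlation of two copies, y is that price
  -- relative to the size of a part, and v is the resulting bound on Var X / (E X)².
  module _ {w y v : ℚ} (0≤w : 0ℚ ≤ℚ w) (0≤y : 0ℚ ≤ℚ y) (w≤ : ∀ j → w ≤ℚ y * ι (length (part m n j)))
           ([1+y]^m≤ : (1ℚ + y) ^ m ≤ℚ 1ℚ + v) (inside-≥ : ∀ U → 1ℚ ≤ℚ weightInside p̂ H U * w ^ card U) where

    𝔼-pair : ∀ S T → InParts m n S → InParts m n T →
             𝔼 i Gₙ (λ G → copy S G * copy T G) ≤ℚ q * q * w ^ card (agreement S T)
    𝔼-pair S T in-S in-T = begin
      𝔼 i Gₙ (λ G → copy S G * copy T G)                  ≤⟨ 𝔼-mono Gₙ-subProb _ _ pointwise ⟩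
      𝔼 i Gₙ (extends cST)                                ≡⟨ 𝔼-extends cST ⟩
      ∏< (λ u w → weight p̂ (cST u w))                     ≡⟨ ∏<-weight-pair p̂ H S T (inParts⇒increasing m n S in-S) (inParts⇒increasing m n T in-T) (inParts⇒aligned m n S T in-S in-T) ⟩
      q * out                                             ≡⟨ cong (q *_) (ℚₚ.*-identityʳ out) ⟨
      -- Since out · inside = q, the bound 1 ≤ inside · w^u gives out ≤ q w^u without a division by
      -- the inside weight.
      q * (out * 1ℚ)                                      ≤⟨ *-monoʳ-≤ (ℚₚ.<⇒≤ 0<q) (*-monoʳ-≤ out≥0 (inside-≥ U)) ⟩
      q * (out * (weightInside p̂ H U * w ^ card U))       ≡⟨ solve 4 (λ q o n w → q :* (o :* (n :* w)) := q :* (o :* n) :* w) refl q out (weightInside p̂ H U) (w ^ card U) ⟩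
      q * (out * weightInside p̂ H U) * w ^ card U         ≡⟨ cong (λ z → q * z * w ^ card U) (inside*outside p̂ H U) ⟩
      q * q * w ^ card U                                  ∎
      where
      open ℚₚ.≤-Reasoning
      U = agreement S T
      out = weightOutside p̂ H U
      cST : Fin n → Fin n → Maybe Bool
      cST u w = copyOf H S u w <∣> copyOf H T u w
      out≥0 : 0ℚ ≤ℚ out
      out≥0 = ∏<-≥0 _ λ i j → if-≥0 (both U i j) 0≤1 (edge-≥0 (adj H i j))
        where
        edge-≥0 : ∀ b → 0ℚ ≤ℚ weight p̂ (just b)
        edge-≥0 true  = 0≤p
        edge-≥0 false = a≤b⇒0≤b-a p≤1
      pointwise : ∀ G → copy S G * copy T G ≤ℚ extends cST G
      pointwise G = 𝟙*𝟙≤ (isInducedCopy? H G S) (isInducedCopy? H G T) (extends-≥0 cST G) λ cS cT →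
        ℚₚ.≤-reflexive (sym (extends≡1 cST G (ext G cS cT)))
        where
        ext : ∀ G → IsInducedCopy H G S → IsInducedCopy H G T → Extends cST G
        ext G cS cT u w b eq with copyOf H S u w in eqS
        ... | just b′ = copy⇒extends H G S cS u w b (trans eqS eq)
        ... | nothing = copy⇒extends H G T cT u w b eq

    𝔼-X² : 𝔼 i Gₙ (λ G → X G * X G) ≤ℚ (1ℚ + v) * ((N * q) * (N * q))
    𝔼-X² = begin
      𝔼 i Gₙ (λ G → X G * X G)
        ≡⟨ 𝔼-cong i Gₙ (λ G → trans (sym (∑-*ʳ (X G) (λ S → copy S G) obs)) (∑-cong-≗ obs λ S → sym (∑-*ˡ (copy S G) (λ T → copy T G) obs))) ⟩
      𝔼 i Gₙ (λ G → ∑ (λ S → ∑ (λ T → copy S G * copy T G) obs) obs)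
        ≡⟨ trans (𝔼-∑ i Gₙ (λ S G → ∑ (λ T → copy S G * copy T G) obs) obs) (∑-cong-≗ obs λ S → 𝔼-∑ i Gₙ (λ T G → copy S G * copy T G) obs) ⟩
      ∑ (λ S → ∑ (λ T → 𝔼 i Gₙ (λ G → copy S G * copy T G)) obs) obs
        ≤⟨ ∑-mono (All.map (λ {S} in-S → ∑-mono (All.map (λ {T} in-T → 𝔼-pair S T in-S in-T) (obeying-inParts m n))) (obeying-inParts m n)) ⟩
      ∑ (λ S → ∑ (λ T → q * q * w ^ card (agreement S T)) obs) obs
        ≡⟨ trans (∑-cong-≗ obs λ S → ∑-*ˡ (q * q) (λ T → w ^ card (agreement S T)) obs) (∑-*ˡ (q * q) (λ S → ∑ (λ T → w ^ card (agreement S T)) obs) obs) ⟩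
      q * q * ∑ (λ S → ∑ (λ T → w ^ card (agreement S T)) obs) obs
        ≤⟨ *-monoʳ-≤ (square-≥0 q) (∑∑-agreement 0≤w 0≤y (tabulate (part m n))
             (λ j → subst Unique (sym (lookup∘tabulate (part m n) j)) (part-unique m n j))
             (λ j → subst (λ xs → w ≤ℚ y * ι (length xs)) (sym (lookup∘tabulate (part m n) j)) (w≤ j))) ⟩
      q * q * ((1ℚ + y) ^ m * (N * N))
        ≤⟨ *-monoʳ-≤ (square-≥0 q) (*-monoˡ-≤ (square-≥0 N) [1+y]^m≤) ⟩
      q * q * ((1ℚ + v) * (N * N))
        ≡⟨ solve 3 (λ q v n → q :* q :* ((con 1ℚ :+ v) :* (n :* n)) := (con 1ℚ :+ v) :* ((n :* q) :* (n :* q))) refl q v N ⟩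
      (1ℚ + v) * ((N * q) * (N * q)) ∎
      where open ℚₚ.≤-Reasoning

    -- Expanding the square leaves E X² - μ², because E X = μ and G(n, p) has mass exactly 1.
    variance : 𝔼 i Gₙ (λ G → (X G - N * q) * (X G - N * q)) ≤ℚ v * ((N * q) * (N * q))
    variance = begin
      𝔼 i Gₙ (λ G → (X G - μ) * (X G - μ))
        ≡⟨ 𝔼-cong i Gₙ (λ G → solve 2 (λ x a → (x :- a) :* (x :- a) := x :* x :+ ((:- (a :+ a)) :* x :+ (a :* a) :* con 1ℚ)) refl (X G) μ) ⟩
      𝔼 i Gₙ (λ G → X G * X G + ((- (μ + μ)) * X G + (μ * μ) * 1ℚ))
        ≡⟨ 𝔼-+ i Gₙ (λ G → X G * X G) (λ G → (- (μ + μ)) * X G + (μ * μ) * 1ℚ) ⟩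
      𝔼 i Gₙ (λ G → X G * X G) + 𝔼 i Gₙ (λ G → (- (μ + μ)) * X G + (μ * μ) * 1ℚ)
        ≡⟨ cong (_+_ (𝔼 i Gₙ (λ G → X G * X G))) (trans (𝔼-+ i Gₙ (λ G → (- (μ + μ)) * X G) (λ _ → (μ * μ) * 1ℚ))
             (cong₂ _+_ (trans (𝔼-*ˡ i Gₙ (- (μ + μ)) X) (cong ((- (μ + μ)) *_) 𝔼-X)) (trans (𝔼-*ˡ i Gₙ (μ * μ) (λ _ → 1ℚ)) (cong ((μ * μ) *_) (Gnp-𝔼-1 i p n))))) ⟩
      𝔼 i Gₙ (λ G → X G * X G) + ((- (μ + μ)) * μ + (μ * μ) * 1ℚ)
        ≤⟨ ℚₚ.+-monoˡ-≤ ((- (μ + μ)) * μ + (μ * μ) * 1ℚ) 𝔼-X² ⟩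
      (1ℚ + v) * (μ * μ) + ((- (μ + μ)) * μ + (μ * μ) * 1ℚ)
        ≡⟨ solve 2 (λ v a → (con 1ℚ :+ v) :* (a :* a) :+ ((:- (a :+ a)) :* a :+ (a :* a) :* con 1ℚ) := v :* (a :* a)) refl v μ ⟩
      v * (μ * μ) ∎
      where
      open ℚₚ.≤-Reasoning
      μ = N * q

    module _ {{_ : NonZero (length obs)}} (k k' : ℕ) (f : Graph n → Bool) where

      private
        φ : Graph n → ℚ
        φ = 𝟙 ∘ f
        pA pH μ : ℚ
        pA = 𝔼 i (AG[ H ] n p k k') φ
        pH = 𝔼 i (G[ H ] n p k k') φ
        μ = N * q

      hit : Graph n → Vec (Fin n) m → ℚ
      hit G S = 𝔼 i (hide G S k k') φ

      att Y : Graph n → ℚ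
      att G = 𝔼 i (attackOn G k k' (copies H G)) φ
      Y G = ∑ (λ S → copy S G * hit G S) obs

      0<μ : 0ℚ <ℚ μ
      0<μ = *->0 (0<ι (length obs)) 0<q

      -- G[ H ] is G(n, p) with density X / 𝔼 X, and given the graph M is a uniform copy.
      𝔼-Y : μ * pH ≡ 𝔼 i Gₙ Y
      𝔼-Y = begin
        N * q * pH
          ≡⟨ cong (N * q *_) (trans (𝔼->>= i Gₙ _ φ) (𝔼-cong i Gₙ λ G → trans (𝔼->>= i (uniform obs) _ φ) (𝔼-uniform i obs λ M → hit (plant H M G) M))) ⟩
        N * q * 𝔼 i Gₙ (λ G → r * ∑ (λ M → hit (plant H M G) M) obs)
          ≡⟨ cong (N * q *_) (trans (𝔼-*ˡ i Gₙ r λ G → ∑ (λ M → hit (plant H M G) M) obs) (cong (r *_) (𝔼-∑ i Gₙ (λ M G → hit (plant H M G) M) obs))) ⟩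
        N * q * (r * Σ)
          ≡⟨ solve 4 (λ n q r s → n :* q :* (r :* s) := (r :* n) :* (q :* s)) refl N q r Σ ⟩
        (r * N) * (q * Σ)
          ≡⟨ cong (_* (q * Σ)) (trans (ratio-*-cancel 1 (length obs)) ι1≡1) ⟩
        1ℚ * (q * Σ)
          ≡⟨ trans (ℚₚ.*-identityˡ (q * Σ)) (sym (∑-*ˡ q (λ M → 𝔼 i Gₙ (λ G → hit (plant H M G) M)) obs)) ⟩
        ∑ (λ M → q * 𝔼 i Gₙ (λ G → hit (plant H M G) M)) obs
          ≡⟨ ∑-cong (All.map (λ {M} → 𝔼-planted (λ G → hit G M) M) (obeying-inParts m n)) ⟩
        ∑ (λ M → 𝔼 i Gₙ (λ G → copy M G * hit G M)) obs
          ≡⟨ 𝔼-∑ i Gₙ (λ M G → copy M G * hit G M) obs ⟨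
        𝔼 i Gₙ Y ∎
        where
        open ≡-Reasoning
        r = ratio 1 (length obs)
        Σ = ∑ (λ M → 𝔼 i Gₙ (λ G → hit (plant H M G) M)) obs

      -- X is the number of copies and the attack averages `hit` over them, so the product is the
      -- sum over all copies.
      X*att≡Y : ∀ G → X G * att G ≡ Y G
      X*att≡Y G = trans (cong (_* att G) X≡) (trans (average (copies H G)) (∑-filter (isInducedCopy? H G) (hit G) obs))
        where
        X≡ : X G ≡ ι (length (copies H G))
        X≡ = trans (∑-cong-≗ obs λ S → sym (ℚₚ.*-identityʳ (copy S G))) (trans (sym (∑-filter (isInducedCopy? H G) (λ _ → 1ℚ) obs))
          (trans (∑-const 1ℚ (copies H G)) (ℚₚ.*-identityʳ (ι (length (copies H G))))))
        average : ∀ cs → ι (length cs) * 𝔼 i (attackOn G k k' cs) φ ≡ ∑ (hit G) cs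
        -- Without copies the attack falls back on another deletion, but its value is multiplied by
        -- X = 0.
        average []         = trans (cong (_* 𝔼 i (attackOn {m} G k k' []) φ) ι0≡0) (trans (ℚₚ.*-zeroˡ (𝔼 i (attackOn {m} G k k' []) φ)) (sym (∑-[] (hit G))))
        average cs@(_ ∷ _) = begin
          ι (length cs) * 𝔼 i (attackOn G k k' cs) φ
            ≡⟨ cong (ι (length cs) *_) (trans (𝔼->>= i (uniform cs) (λ S → hide G S k k') φ) (𝔼-uniform i cs (hit G))) ⟩
          ι (length cs) * (ratio 1 (length cs) * ∑ (hit G) cs)
            ≡⟨ solve 3 (λ l r s → l :* (r :* s) := (r :* l) :* s) refl (ι (length cs)) (ratio 1 (length cs)) (∑ (hit G) cs) ⟩
          ratio 1 (length cs) * ι (length cs) * ∑ (hit G) cs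
            ≡⟨ cong (_* ∑ (hit G) cs) (trans (ratio-*-cancel 1 (length cs)) ι1≡1) ⟩
          1ℚ * ∑ (hit G) cs
            ≡⟨ ℚₚ.*-identityˡ (∑ (hit G) cs) ⟩
          ∑ (hit G) cs ∎
          where open ≡-Reasoning

      -- This is the expectation of `chebyshev-pointwise` over G(n, p), with t the success
      -- probability of the attack on the given graph. The left side becomes β μ (p_A K - Var) and
      -- the right side K μ p_H by `𝔼-Y`; the factor μ³ keeps everything free of division.
      comparison : ∀ β → 0ℚ ≤ℚ β → β ≤ℚ 1ℚ → β * (pA * ((1ℚ - β) * (1ℚ - β)) - v) ≤ℚ pH * ((1ℚ - β) * (1ℚ - β))
      comparison β 0≤β β≤1 = *-cancelˡ-≤ (*->0 0<μ (*->0 0<μ 0<μ)) (begin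
        μ * (μ * μ) * (β * (pA * (s * s) - v))
          ≡⟨ solve 5 (λ μ β pA s v → μ :* (μ :* μ) :* (β :* (pA :* (s :* s) :- v)) := β :* μ :* (pA :* ((s :* μ) :* (s :* μ)) :- v :* (μ :* μ))) refl μ β pA s v ⟩
        β * μ * (pA * K - v * (μ * μ))
          ≤⟨ *-monoʳ-≤ 0≤βμ (ℚₚ.+-monoʳ-≤ (pA * K) (ℚₚ.neg-antimono-≤ variance)) ⟩
        β * μ * (pA * K - Var)
          ≡⟨ split ⟨
        𝔼 i Gₙ (λ G → β * μ * (att G * K - D G * D G))
          ≤⟨ 𝔼-mono Gₙ-subProb _ _ (λ G → chebyshev-pointwise 0≤β β≤1 (ℚₚ.<⇒≤ 0<μ) (∑-≥0 obs λ S → copy-≥0 S G)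
               (𝔼-≥0 (attackOn-subProb i G k k' (copies H G)) φ (0≤𝟙 ∘ f)) (𝔼-≤1 (attackOn-subProb i G k k' (copies H G)) φ (𝟙≤1 ∘ f)) (X*att≡Y G)) ⟩
        𝔼 i Gₙ (λ G → Y G * K)
          ≡⟨ trans (𝔼-cong i Gₙ λ G → ℚₚ.*-comm (Y G) K) (trans (𝔼-*ˡ i Gₙ K Y) (cong (K *_) (sym 𝔼-Y))) ⟩
        K * (μ * pH)
          ≡⟨ solve 3 (λ μ s h → ((s :* μ) :* (s :* μ)) :* (μ :* h) := μ :* (μ :* μ) :* (h :* (s :* s))) refl μ s pH ⟩
        μ * (μ * μ) * (pH * (s * s)) ∎)
        where
        open ℚₚ.≤-Reasoning
        s = 1ℚ - β
        K = (s * μ) * (s * μ)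
        D : Graph n → ℚ
        D G = X G - μ
        Var = 𝔼 i Gₙ (λ G → D G * D G)
        0≤βμ : 0ℚ ≤ℚ β * μ
        0≤βμ = *-≥0 0≤β (ℚₚ.<⇒≤ 0<μ)
        split : 𝔼 i Gₙ (λ G → β * μ * (att G * K - D G * D G)) ≡ β * μ * (pA * K - Var)
        split = trans (𝔼-*ˡ i Gₙ (β * μ) λ G → att G * K - D G * D G) (cong (β * μ *_)
          (trans (𝔼-cong i Gₙ λ G → solve 3 (λ t k z → t :* k :- z := k :* t :+ (:- con 1ℚ) :* z) refl (att G) K (D G * D G))
            (trans (𝔼-+ i Gₙ (λ G → K * att G) (λ G → (- 1ℚ) * (D G * D G)))
              (trans (cong₂ _+_ (trans (𝔼-*ˡ i Gₙ K att) (cong (K *_) (sym (𝔼-AG i H n p k k' φ)))) (𝔼-*ˡ i Gₙ (- 1ℚ) (λ G → D G * D G)))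
                (solve 3 (λ t k z → k :* t :+ (:- con 1ℚ) :* z := t :* k :- z) refl pA K Var)))))

-- Estimates with rational exponents, and the comparison at one index

2ℚ : ℚ
2ℚ = 1ℚ + 1ℚ

0≤2 : 0ℚ ≤ℚ 2ℚ
0≤2 = ℚₚ.nonNegative⁻¹ 2ℚ

0<2 : 0ℚ <ℚ 2ℚ
0<2 = ℚₚ.positive⁻¹ 2ℚ

-- If μ ≤ ν^(R/D₂) and p ≤ 2^(1/D₃) ν^(-G₃/D₃) with R/D₂ < G₃/D₃, then p μ → 0.
2pμ≤1 : ∀ {p μ ν} D₂ D₃ R G₃ .{{_ : NonZero D₂}} .{{_ : NonZero D₃}} →
  0ℚ ≤ℚ p → 0ℚ ≤ℚ μ → 1ℚ ≤ℚ ν → μ ^ D₂ ≤ℚ ν ^ R → p ^ D₃ * ν ^ G₃ ≤ℚ 2ℚ → R *ₙ D₃ <ₙ G₃ *ₙ D₂ →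
  2ℚ ^ (D₂ *ₙ D₃) * 2ℚ ^ D₂ ≤ℚ ν → 2ℚ * (p * μ) ≤ℚ 1ℚ
2pμ≤1 {p} {μ} {ν} D₂ D₃ R G₃ 0≤p 0≤μ 1≤ν μ≤ p≤ exp ν≥ =
  ^-cancelˡ-≤ K {{ℕₚ.m*n≢0 D₂ D₃}} 0≤1 (subst (z ^ K ≤ℚ_) (sym (1^k≡1 K)) (*-cancelˡ-≤ 0<ν (begin
    ν * z ^ K                        ≤⟨ *-cancelˡ-≤ (^->0 (R *ₙ D₃) 0<ν) main ⟩
    2ℚ ^ K * 2ℚ ^ D₂                 ≤⟨ ν≥ ⟩
    ν                                ≡⟨ ℚₚ.*-identityʳ ν ⟨
    ν * 1ℚ                           ∎)))
  where
  open ℚₚ.≤-Reasoning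
  K = D₂ *ₙ D₃
  z = 2ℚ * (p * μ)
  0<ν : 0ℚ <ℚ ν
  0<ν = ℚₚ.<-≤-trans 0<1 1≤ν
  0≤ν : 0ℚ ≤ℚ ν
  0≤ν = ℚₚ.<⇒≤ 0<ν
  0≤z : 0ℚ ≤ℚ z
  0≤z = *-≥0 0≤2 (*-≥0 0≤p 0≤μ)
  z^K : z ^ K ≡ 2ℚ ^ K * ((p ^ D₃) ^ D₂ * (μ ^ D₂) ^ D₃)
  z^K = trans (^-distrib-* 2ℚ (p * μ) K) (cong (2ℚ ^ K *_) (trans (^-distrib-* p μ K)
    (cong₂ _*_ (trans (cong (p ^_) (ℕₚ.*-comm D₂ D₃)) (sym (^-assocʳ p D₃ D₂))) (sym (^-assocʳ μ D₂ D₃)))))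
  main : ν ^ (R *ₙ D₃) * (ν * z ^ K) ≤ℚ ν ^ (R *ₙ D₃) * (2ℚ ^ K * 2ℚ ^ D₂)
  main = begin
    ν ^ (R *ₙ D₃) * (ν * z ^ K)
      ≡⟨ solve 3 (λ a b c → a :* (b :* c) := (b :* a) :* c) refl (ν ^ (R *ₙ D₃)) ν (z ^ K) ⟩
    ν ^ suc (R *ₙ D₃) * z ^ K
      -- A strict inequality between natural exponents leaves one whole factor ν, which swallows the
      -- powers of 2.
      ≤⟨ *-monoˡ-≤ (^-≥0 K 0≤z) (^-monoʳ-≤ 1≤ν exp) ⟩
    ν ^ (G₃ *ₙ D₂) * z ^ K
      ≡⟨ cong₂ _*_ (sym (^-assocʳ ν G₃ D₂)) z^K ⟩
    (ν ^ G₃) ^ D₂ * (2ℚ ^ K * ((p ^ D₃) ^ D₂ * (μ ^ D₂) ^ D₃))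
      ≡⟨ solve 4 (λ a b c d → a :* (b :* (c :* d)) := b :* (c :* a) :* d) refl ((ν ^ G₃) ^ D₂) (2ℚ ^ K) ((p ^ D₃) ^ D₂) ((μ ^ D₂) ^ D₃) ⟩
    2ℚ ^ K * ((p ^ D₃) ^ D₂ * (ν ^ G₃) ^ D₂) * (μ ^ D₂) ^ D₃
      ≡⟨ cong (λ e → 2ℚ ^ K * e * (μ ^ D₂) ^ D₃) (sym (^-distrib-* (p ^ D₃) (ν ^ G₃) D₂)) ⟩
    2ℚ ^ K * (p ^ D₃ * ν ^ G₃) ^ D₂ * (μ ^ D₂) ^ D₃
      ≤⟨ *-mono-≤ (*-≥0 (^-≥0 K 0≤2) (^-≥0 D₂ 0≤pν)) (^-≥0 D₃ (^-≥0 D₂ 0≤μ))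
           (*-monoʳ-≤ (^-≥0 K 0≤2) (^-monoˡ-≤ D₂ 0≤pν p≤)) (^-monoˡ-≤ D₃ (^-≥0 D₂ 0≤μ) μ≤) ⟩
    2ℚ ^ K * 2ℚ ^ D₂ * (ν ^ R) ^ D₃
      ≡⟨ trans (ℚₚ.*-comm (2ℚ ^ K * 2ℚ ^ D₂) ((ν ^ R) ^ D₃)) (cong (_* (2ℚ ^ K * 2ℚ ^ D₂)) (^-assocʳ ν R D₃)) ⟩
    ν ^ (R *ₙ D₃) * (2ℚ ^ K * 2ℚ ^ D₂) ∎
    where
    0≤pν : 0ℚ ≤ℚ p ^ D₃ * ν ^ G₃
    0≤pν = *-≥0 (^-≥0 D₃ 0≤p) (^-≥0 G₃ 0≤ν)

-- With α = A/B, γ = G₁/D₁ and ρ = R/D₂, the exponent condition says 4 ρ + α γ < 2.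
2μ⁴≤p^A[xν]² : ∀ {p μ ν x} A B D₁ D₂ R G₁ .{{_ : NonZero D₁}} .{{_ : NonZero D₂}} →
  0ℚ ≤ℚ p → 0ℚ ≤ℚ μ → 1ℚ ≤ℚ ν → 0ℚ ≤ℚ x → μ ^ D₂ ≤ℚ ν ^ R → 1ℚ ≤ℚ 2ℚ * (p ^ D₁ * ν ^ G₁) →
  R *ₙ (4 *ₙ B *ₙ D₁) +ₙ G₁ *ₙ (A *ₙ D₂) <ₙ 2 *ₙ B *ₙ (D₁ *ₙ D₂) →
  2ℚ ^ (B *ₙ (D₁ *ₙ D₂)) * 2ℚ ^ (A *ₙ D₂) ≤ℚ x ^ (2 *ₙ B *ₙ (D₁ *ₙ D₂)) * ν →
  (2ℚ * μ ^ 4) ^ B ≤ℚ p ^ A * ((x * ν) ^ 2) ^ B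
2μ⁴≤p^A[xν]² {p} {μ} {ν} {x} A B D₁ D₂ R G₁ 0≤p 0≤μ 1≤ν 0≤x μ≤ p≥ exp ν≥ =
  ^-cancelˡ-≤ K {{ℕₚ.m*n≢0 D₁ D₂}} (*-≥0 (^-≥0 A 0≤p) (^-≥0 B (^-≥0 2 (*-≥0 0≤x 0≤ν))))
    (*-cancelˡ-≤ (*->0 (^->0 (A *ₙ D₂) 0<2) (^->0 (G₁ *ₙ (A *ₙ D₂)) 0<ν)) (begin
      t * g * ((2ℚ * μ ^ 4) ^ B) ^ K
        ≡⟨ cong (t * g *_) lhs ⟩
      t * g * (h * (μ ^ D₂) ^ (4 *ₙ B *ₙ D₁))
        ≤⟨ *-monoʳ-≤ (*-≥0 0≤t 0≤g) (*-monoʳ-≤ (^-≥0 (B *ₙ K) 0≤2) (^-monoˡ-≤ (4 *ₙ B *ₙ D₁) (^-≥0 D₂ 0≤μ) μ≤)) ⟩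
      t * g * (h * (ν ^ R) ^ (4 *ₙ B *ₙ D₁))
        ≡⟨ cong (λ z → t * g * (h * z)) (^-assocʳ ν R (4 *ₙ B *ₙ D₁)) ⟩
      t * g * (h * r)
        ≡⟨ solve 4 (λ t g b r → t :* g :* (b :* r) := (b :* t) :* (r :* g)) refl t g h r ⟩
      (h * t) * (r * g)
        -- The powers of 2 come from 2 μ⁴ and from the factor 2 lost in the bound on p. The
        -- threshold trades them for a single ν, and `exp` is strict, so the exponent has room for
        -- it.
        ≤⟨ *-monoˡ-≤ (*-≥0 (^-≥0 (R *ₙ (4 *ₙ B *ₙ D₁)) 0≤ν) 0≤g) ν≥ ⟩
      (X * ν) * (r * g)
        ≡⟨ trans (ℚₚ.*-assoc X ν (r * g)) (cong (λ z → X * (ν * z)) (sym (^-homo-* ν (R *ₙ (4 *ₙ B *ₙ D₁)) (G₁ *ₙ (A *ₙ D₂))))) ⟩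
      X * ν ^ suc (R *ₙ (4 *ₙ B *ₙ D₁) +ₙ G₁ *ₙ (A *ₙ D₂))
        ≤⟨ *-monoʳ-≤ (^-≥0 (2 *ₙ B *ₙ K) 0≤x) (^-monoʳ-≤ 1≤ν exp) ⟩
      X * ν ^ (2 *ₙ B *ₙ K)
        ≡⟨ trans (sym (^-distrib-* x ν (2 *ₙ B *ₙ K))) (sym (ℚₚ.*-identityˡ ((x * ν) ^ (2 *ₙ B *ₙ K)))) ⟩
      1ℚ * (x * ν) ^ (2 *ₙ B *ₙ K)
        ≤⟨ *-monoˡ-≤ (^-≥0 (2 *ₙ B *ₙ K) (*-≥0 0≤x 0≤ν)) (1≤^ (A *ₙ D₂) p≥) ⟩
      (2ℚ * (p ^ D₁ * ν ^ G₁)) ^ (A *ₙ D₂) * (x * ν) ^ (2 *ₙ B *ₙ K)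
        ≡⟨ cong₂ _*_ expand (sym rhs) ⟩
      t * ((p ^ A) ^ K * g) * (((x * ν) ^ 2) ^ B) ^ K
        ≡⟨ solve 4 (λ t a g c → t :* (a :* g) :* c := t :* g :* (a :* c)) refl t ((p ^ A) ^ K) g ((((x * ν) ^ 2) ^ B) ^ K) ⟩
      t * g * ((p ^ A) ^ K * (((x * ν) ^ 2) ^ B) ^ K)
        ≡⟨ cong (t * g *_) (^-distrib-* (p ^ A) (((x * ν) ^ 2) ^ B) K) ⟨
      t * g * (p ^ A * ((x * ν) ^ 2) ^ B) ^ K ∎))
  where
  open ℚₚ.≤-Reasoning
  K = D₁ *ₙ D₂
  t = 2ℚ ^ (A *ₙ D₂)
  g = ν ^ (G₁ *ₙ (A *ₙ D₂))
  h = 2ℚ ^ (B *ₙ K)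
  r = ν ^ (R *ₙ (4 *ₙ B *ₙ D₁))
  X = x ^ (2 *ₙ B *ₙ K)
  0<ν : 0ℚ <ℚ ν
  0<ν = ℚₚ.<-≤-trans 0<1 1≤ν
  0≤ν : 0ℚ ≤ℚ ν
  0≤ν = ℚₚ.<⇒≤ 0<ν
  0≤t : 0ℚ ≤ℚ t
  0≤t = ^-≥0 (A *ₙ D₂) 0≤2
  0≤g : 0ℚ ≤ℚ g
  0≤g = ^-≥0 (G₁ *ₙ (A *ₙ D₂)) 0≤ν
  lhs : ((2ℚ * μ ^ 4) ^ B) ^ K ≡ h * (μ ^ D₂) ^ (4 *ₙ B *ₙ D₁)
  lhs = trans (^-assocʳ (2ℚ * μ ^ 4) B K) (trans (^-distrib-* 2ℚ (μ ^ 4) (B *ₙ K)) (cong (h *_)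
    (trans (^-assocʳ μ 4 (B *ₙ K)) (trans (cong (μ ^_) (rearrange B D₁ D₂)) (sym (^-assocʳ μ D₂ (4 *ₙ B *ₙ D₁)))))))
    where
    rearrange : ∀ B D₁ D₂ → 4 *ₙ (B *ₙ (D₁ *ₙ D₂)) ≡ D₂ *ₙ (4 *ₙ B *ₙ D₁)
    rearrange = ℕ-solve 3 (λ B D₁ D₂ → ℕ-con 4 ⊗ (B ⊗ (D₁ ⊗ D₂)) ⊜ D₂ ⊗ (ℕ-con 4 ⊗ B ⊗ D₁)) refl
  rhs : (((x * ν) ^ 2) ^ B) ^ K ≡ (x * ν) ^ (2 *ₙ B *ₙ K)
  rhs = trans (cong (_^ K) (^-assocʳ (x * ν) 2 B)) (^-assocʳ (x * ν) (2 *ₙ B) K)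
  expand : (2ℚ * (p ^ D₁ * ν ^ G₁)) ^ (A *ₙ D₂) ≡ t * ((p ^ A) ^ K * g)
  expand = trans (^-distrib-* 2ℚ (p ^ D₁ * ν ^ G₁) (A *ₙ D₂)) (cong (t *_) (trans (^-distrib-* (p ^ D₁) (ν ^ G₁) (A *ₙ D₂))
    (cong₂ _*_ (trans (^-assocʳ p D₁ (A *ₙ D₂)) (trans (cong (p ^_) (rearrange A D₁ D₂)) (sym (^-assocʳ p A K)))) (^-assocʳ ν G₁ (A *ₙ D₂)))))
    where
    rearrange : ∀ A D₁ D₂ → D₁ *ₙ (A *ₙ D₂) ≡ A *ₙ (D₁ *ₙ D₂)
    rearrange = ℕ-solve 3 (λ A D₁ D₂ → D₁ ⊗ (A ⊗ D₂) ⊜ A ⊗ (D₁ ⊗ D₂)) refl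

-- By Bernoulli's inequality 1 - x ≤ (1 - y)^m, and (1 - y)(1 + y) ≤ 1, so (1 + y)^m is at most 1 /
-- (1 - x), which is at most 1 + 2 x for x ≤ 1/2.
[1+y]^m≤1+2x : ∀ {x y} m → 0ℚ ≤ℚ y → y ≤ℚ 1ℚ → ι m * y ≡ x → x ≤ℚ ½ → (1ℚ + y) ^ m ≤ℚ 1ℚ + (x + x)
[1+y]^m≤1+2x {x} {y} m 0≤y y≤1 my≡x x≤½ = *-cancelˡ-≤ 0<1-x (begin
  (1ℚ - x) * (1ℚ + y) ^ m            ≡⟨ cong (λ z → (1ℚ - z) * (1ℚ + y) ^ m) my≡x ⟨
  (1ℚ - ι m * y) * (1ℚ + y) ^ m      ≤⟨ *-monoˡ-≤ (^-≥0 m 0≤1+y) (bernoulli-≤ m 0≤y y≤1) ⟩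
  (1ℚ - y) ^ m * (1ℚ + y) ^ m        ≡⟨ ^-distrib-* (1ℚ - y) (1ℚ + y) m ⟨
  ((1ℚ - y) * (1ℚ + y)) ^ m          ≤⟨ ^≤1 m (*-≥0 (a≤b⇒0≤b-a y≤1) 0≤1+y) difference-of-squares ⟩
  1ℚ                                 ≤⟨ 0≤b-a⇒a≤b (subst (0ℚ ≤ℚ_) (solve 1 (λ x → x :* (con 1ℚ :- (x :+ x)) := (con 1ℚ :- x) :* (con 1ℚ :+ (x :+ x)) :- con 1ℚ) refl x) (*-≥0 0≤x 0≤1-2x)) ⟩
  (1ℚ - x) * (1ℚ + (x + x))          ∎)
  where
  open ℚₚ.≤-Reasoning
  0≤1+y : 0ℚ ≤ℚ 1ℚ + y
  0≤1+y = +-≥0 0≤1 0≤y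
  0≤x : 0ℚ ≤ℚ x
  0≤x = subst (0ℚ ≤ℚ_) my≡x (*-≥0 (0≤ι m) 0≤y)
  0≤1-2x : 0ℚ ≤ℚ 1ℚ - (x + x)
  0≤1-2x = a≤b⇒0≤b-a (ℚₚ.+-mono-≤ x≤½ x≤½)
  0<1-x : 0ℚ <ℚ 1ℚ - x
  0<1-x = ℚₚ.<-≤-trans (ℚₚ.positive⁻¹ ½) (0≤b-a⇒a≤b (subst (0ℚ ≤ℚ_) (solve 1 (λ x → con ½ :- x := (con 1ℚ :- x) :- con ½) refl x) (a≤b⇒0≤b-a x≤½)))
  difference-of-squares : (1ℚ - y) * (1ℚ + y) ≤ℚ 1ℚ
  difference-of-squares = 0≤b-a⇒a≤b (subst (0ℚ ≤ℚ_) (solve 1 (λ y → y :* y := con 1ℚ :- (con 1ℚ :- y) :* (con 1ℚ :+ y)) refl y) (square-≥0 y))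

recip-*-cancel : ∀ q → 0ℚ <ℚ q → recip q * q ≡ 1ℚ
recip-*-cancel q 0<q with q ℚₚ.≟ 0ℚ
... | yes q≡0 = contradiction 0<q (ℚₚ.<-irrefl (sym q≡0))
... | no  q≢0 = ℚₚ.*-inverseˡ q {{ℚ.≢-nonZero q≢0}}

choices-nonZero : ∀ {m} (xss : Vec (List A) m) → (∀ i → 0ℚ <ℚ ι (length (lookup xss i))) → 0ℚ <ℚ ι (length (choices xss))
choices-nonZero []         xs>0 = 0<ι 1
choices-nonZero (xs ∷ xss) xs>0 = subst (0ℚ <ℚ_) (sym (ι-length-choices xs xss)) (*->0 (xs>0 zero) (choices-nonZero xss (xs>0 ∘ suc)))

½<1 : ½ <ℚ 1ℚ
½<1 = subst (_<ℚ ½ + ½) (ℚₚ.+-identityʳ ½) (ℚₚ.+-monoʳ-< ½ (ℚₚ.positive⁻¹ ½))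

2pμ≤1⇒p<1 : ∀ {p} m .{{_ : NonZero m}} → 0ℚ ≤ℚ p → 2ℚ * (p * ι m) ≤ℚ 1ℚ → p <ℚ 1ℚ
2pμ≤1⇒p<1 {p} m 0≤p 2pμ≤ = ℚₚ.≤-<-trans
  (ℚₚ.≤-trans (subst (_≤ℚ p * ι m) (ℚₚ.*-identityʳ p) (*-monoʳ-≤ 0≤p (1≤ι m))) (*-cancelˡ-≤ 0<2 2pμ≤)) ½<1

module _ (i : ℕ) {p : ℝ} (0≤p : 0ℚ ≤ℚ seq p i) (p≤1 : seq p i ≤ℚ 1ℚ) {m} .{{_ : NonZero m}} (H : Graph m) (n k k' : ℕ) (f : Graph n → Bool) where

  Pr-G-≥0 : 0ℚ ≤ℚ seq (Pr f (G[ H ] n p k k')) i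
  Pr-G-≥0 = subst (0ℚ ≤ℚ_) (sym (Pr≡𝔼 i f (G[ H ] n p k k')))
    (𝔼-≥0 (>>=-subProb i (Gnp-subProb i p 0≤p p≤1 n) λ G → >>=-subProb i (uniform-subProb i (obeying m n)) λ M → hide-subProb i (plant H M G) M k k') (𝟙 ∘ f) (0≤𝟙 ∘ f))

  Pr-AG-≥0 : 0ℚ ≤ℚ seq (Pr f (AG[ H ] n p k k')) i
  Pr-AG-≥0 = subst (0ℚ ≤ℚ_) (sym (trans (Pr≡𝔼 i f (AG[ H ] n p k k')) (𝔼-AG i H n p k k' (𝟙 ∘ f))))
    (𝔼-≥0 (Gnp-subProb i p 0≤p p≤1 n) _ λ G → 𝔼-≥0 (attackOn-subProb i G k k' (copies H G)) (𝟙 ∘ f) (0≤𝟙 ∘ f))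

-- The witnesses are y = x/m and w = x n/m², so that w = y n/m and m y = x.
comparison-at : ∀ i p {m} .{{_ : NonZero m}} n .{{_ : NonZero n}} (H : Graph m) → Balanced H → m ∣ n →
  let p̂ = seq p i ; μ = ι m ; ν = ι n in
  0ℚ <ℚ p̂ → 2ℚ * (p̂ * μ) ≤ℚ 1ℚ →
  ∀ A B .{{_ : NonZero B}} → avgDegree H * ι B ≤ℚ ι A →
  ∀ {x v} → 0ℚ ≤ℚ x → x ≤ℚ ½ → x + x ≤ℚ v → (2ℚ * μ ^ 4) ^ B ≤ℚ p̂ ^ A * ((x * ν) ^ 2) ^ B →
  ∀ k k' f β → 0ℚ ≤ℚ β → β ≤ℚ 1ℚ →
  let s = 1ℚ - β in
  β * (seq (Pr f (AG[ H ] n p k k')) i * (s * s) - v) ≤ℚ seq (Pr f (G[ H ] n p k k')) i * (s * s)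
comparison-at i p {m} n H bal m∣n 0<p 2pμ≤ A B avg≤ {x} {v} 0≤x x≤½ 2x≤v key k k' f β 0≤β β≤1 =
  subst₂ (λ a h → β * (a * (s * s) - v) ≤ℚ h * (s * s)) (sym (Pr≡𝔼 i f (AG[ H ] n p k k'))) (sym (Pr≡𝔼 i f (G[ H ] n p k k')))
    (comparison 0≤w 0≤y w≤ [1+y]^m≤ inside-≥ {{obs≢0}} k k' f β 0≤β β≤1)
  where
  s = 1ℚ - β
  p̂ = seq p i
  μ = ι m
  ν = ι n
  l = ι (n /ₙ m)
  y = x * ratio 1 m
  w = y * l

  0≤p : 0ℚ ≤ℚ p̂
  0≤p = ℚₚ.<⇒≤ 0<p

  pμ≤½ : p̂ * μ ≤ℚ ½
  pμ≤½ = *-cancelˡ-≤ 0<2 2pμ≤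

  p<1 : p̂ <ℚ 1ℚ
  p<1 = 2pμ≤1⇒p<1 m 0≤p 2pμ≤

  open Moments i p n H 0<p p<1 using (comparison)

  yμ≡x : y * μ ≡ x
  yμ≡x = trans (ℚₚ.*-assoc x (ratio 1 m) μ) (trans (cong (x *_) (trans (ratio-*-cancel 1 m) ι1≡1)) (ℚₚ.*-identityʳ x))

  lμ≡ν : l * μ ≡ ν
  lμ≡ν = trans (sym (ι-* (n /ₙ m) m)) (cong ι (trans (ℕₚ.*-comm (n /ₙ m) m) (m*[n/m]≡n m∣n)))

  0≤y : 0ℚ ≤ℚ y
  0≤y = *-≥0 0≤x (ratio-≥0 1 m)

  0≤w : 0ℚ ≤ℚ w
  0≤w = *-≥0 0≤y (0≤ι (n /ₙ m))

  y≤1 : y ≤ℚ 1ℚ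
  y≤1 = ℚₚ.≤-trans (subst₂ _≤ℚ_ (ℚₚ.*-identityʳ y) yμ≡x (*-monoʳ-≤ 0≤y (1≤ι m))) (ℚₚ.≤-trans x≤½ (ℚₚ.<⇒≤ ½<1))

  0<l : 0ℚ <ℚ l
  0<l with n /ₙ m in eq
  ... | suc l′ = 0<ι (suc l′)
  ... | zero   = contradiction (0<ι n) (ℚₚ.<-irrefl (sym (trans (sym lμ≡ν) (trans (cong (_* μ) (trans (cong ι eq) ι0≡0)) (ℚₚ.*-zeroˡ μ)))))

  l≤part : ∀ j → l ≤ℚ ι (length (part m n j))
  l≤part j = ι-mono-≤ (part-length m n m∣n j)

  w≤ : ∀ j → w ≤ℚ y * ι (length (part m n j))
  w≤ j = *-monoʳ-≤ 0≤y (l≤part j)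

  obs≢0 : NonZero (length (obeying m n))
  obs≢0 = ℕ.>-nonZero (ι-cancel-< (subst (_<ℚ ι (length (obeying m n))) (sym ι0≡0) (choices-nonZero (tabulate (part m n)) λ j →
    subst (λ xs → 0ℚ <ℚ ι (length xs)) (sym (lookup∘tabulate (part m n) j)) (ℚₚ.<-≤-trans 0<l (l≤part j)))))

  [1+y]^m≤ : (1ℚ + y) ^ m ≤ℚ 1ℚ + v
  [1+y]^m≤ = ℚₚ.≤-trans ([1+y]^m≤1+2x m 0≤y y≤1 (trans (ℚₚ.*-comm μ y) yμ≡x) x≤½) (ℚₚ.+-monoʳ-≤ 1ℚ 2x≤v)

  ½≤ : ½ ≤ℚ (1ℚ - p̂) ^ m
  ½≤ = ℚₚ.≤-trans (0≤b-a⇒a≤b (subst (0ℚ ≤ℚ_) (solve 2 (λ p μ → con ½ :- p :* μ := (con 1ℚ :- μ :* p) :- con ½) refl p̂ μ) (a≤b⇒0≤b-a pμ≤½)))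
    (bernoulli-≤ m 0≤p (ℚₚ.<⇒≤ p<1))

  wμ²≡xν : w * (μ * μ) ≡ x * ν
  wμ²≡xν = trans (solve 3 (λ y l μ → (y :* l) :* (μ :* μ) := (y :* μ) :* (l :* μ)) refl y l μ) (cong₂ _*_ yμ≡x lμ≡ν)

  -- As w μ² = x ν, the square (x ν)² equals 2 μ⁴ · w²/2, so cancelling (2 μ⁴)^B from `key` leaves
  -- the bound that `weightInside-≥` asks for.
  1≤ : 1ℚ ≤ℚ p̂ ^ A * (½ * (w * w)) ^ B
  1≤ = *-cancelˡ-≤ (^->0 B (*->0 0<2 (^->0 4 (0<ι m)))) (begin
    M ^ B * 1ℚ                                  ≡⟨ ℚₚ.*-identityʳ (M ^ B) ⟩
    M ^ B                                       ≤⟨ key ⟩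
    p̂ ^ A * ((x * ν) ^ 2) ^ B                   ≡⟨ cong (λ z → p̂ ^ A * (z ^ 2) ^ B) wμ²≡xν ⟨
    p̂ ^ A * ((w * (μ * μ)) ^ 2) ^ B             ≡⟨ cong (λ z → p̂ ^ A * z ^ B) (solve 2 (λ w μ → (w :* (μ :* μ)) :* ((w :* (μ :* μ)) :* con 1ℚ) :=
                                                     (con 2ℚ :* (μ :* (μ :* (μ :* (μ :* con 1ℚ))))) :* (con ½ :* (w :* w))) refl w μ) ⟩
    p̂ ^ A * (M * (½ * (w * w))) ^ B             ≡⟨ cong (p̂ ^ A *_) (^-distrib-* M (½ * (w * w)) B) ⟩
    p̂ ^ A * (M ^ B * (½ * (w * w)) ^ B)         ≡⟨ solve 3 (λ a b c → a :* (b :* c) := b :* (a :* c)) refl (p̂ ^ A) (M ^ B) ((½ * (w * w)) ^ B) ⟩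
    M ^ B * (p̂ ^ A * (½ * (w * w)) ^ B)         ∎)
    where
    open ℚₚ.≤-Reasoning
    M = 2ℚ * μ ^ 4

  inside-≥ : ∀ U → 1ℚ ≤ℚ weightInside p̂ H U * w ^ card U
  inside-≥ U = weightInside-≥ H U 0≤p (ℚₚ.<⇒≤ p<1) A B 0≤w (balanced-degreeOn H bal A B avg≤ U) ½≤ 1≤

-- Real numbers

both-eventually : ∀ {P Q : ℕ → Set} → Eventually P → Eventually Q → Eventually (λ i → P i × Q i)
both-eventually (M , ps) (N , qs) = M ℕ.⊔ N , λ i i≥ → ps i (ℕₚ.m⊔n≤o⇒m≤o M N i≥) , qs i (ℕₚ.m⊔n≤o⇒n≤o M N i≥)

map-eventually : ∀ {P Q : ℕ → Set} → (∀ {i} → P i → Q i) → Eventually P → Eventually Q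
map-eventually f (N , ps) = N , λ i i≥ → f (ps i i≥)

seq-^ : ∀ x k i → seq (x ^ℝ k) i ≡ seq x i ^ k
seq-^ x zero    i = refl
seq-^ x (suc k) i = cong (seq x i *_) (seq-^ x k i)

-- `≤ℝ` holds with every positive slack, so a slack of half the gap a - b already refutes b < a.
≤-fromℚ : ∀ {x a b} → (∀ i → seq x i ≡ a) → x ≤ℝ fromℚ b → a ≤ℚ b
≤-fromℚ {x} {a} {b} x≡a x≤b with a ℚₚ.≤? b
... | yes a≤b = a≤b
... | no  a≰b = contradiction (ℚₚ.≤-<-trans (subst (_≤ℚ b + e) (x≡a N) (le N ℕₚ.≤-refl)) b+e<a) (ℚₚ.<-irrefl refl)
  where
  0<a-b : 0ℚ <ℚ a - b
  0<a-b = subst (_<ℚ a - b) (ℚₚ.+-inverseʳ b) (ℚₚ.+-monoˡ-< (- b) (ℚₚ.≰⇒> a≰b))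
  e = ½ * (a - b)
  0<e : 0ℚ <ℚ e
  0<e = *->0 (ℚₚ.positive⁻¹ ½) 0<a-b
  N = proj₁ (x≤b e 0<e)
  le = proj₂ (x≤b e 0<e)
  b+e<a : b + e <ℚ a
  b+e<a = subst₂ _<ℚ_ (ℚₚ.+-identityʳ (b + e)) (solve 2 (λ a b → (b :+ con ½ :* (a :- b)) :+ con ½ :* (a :- b) := a) refl a b) (ℚₚ.+-monoʳ-< (b + e) 0<e)

p≤∣p∣ : ∀ p → p ≤ℚ ℚ.∣ p ∣
p≤∣p∣ p with ℚₚ.≤-total 0ℚ p
... | inj₁ 0≤p = ℚₚ.≤-reflexive (sym (ℚₚ.0≤p⇒∣p∣≡p 0≤p))
... | inj₂ p≤0 = ℚₚ.≤-trans p≤0 (ℚₚ.0≤∣p∣ p)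

private
  ∣a-b∣≤e⇒a≤b+e : ∀ a b {e} → ℚ.∣ a - b ∣ ≤ℚ e → a ≤ℚ b + e
  ∣a-b∣≤e⇒a≤b+e a b {e} le = subst (_≤ℚ b + e) (solve 2 (λ a b → b :+ (a :- b) := a) refl a b) (ℚₚ.+-monoʳ-≤ b (ℚₚ.≤-trans (p≤∣p∣ (a - b)) le))

-- Late terms lie within η/2 of each other; the other half of η is the fixed gap that `<ℝ` demands.
approximation : ∀ x η → 0ℚ <ℚ η → Eventually λ i → (x <ℝ fromℚ (seq x i + η)) × (fromℚ (seq x i - η) <ℝ x)
approximation x η 0<η = N , λ i i≥ →
  (e , 0<e , N , λ j j≥ → subst (seq x j + e ≤ℚ_) (solve 2 (λ a η → (a :+ con ½ :* η) :+ con ½ :* η := a :+ η) refl (seq x i) η) (ℚₚ.+-monoˡ-≤ e (∣a-b∣≤e⇒a≤b+e (seq x j) (seq x i) (close j i j≥ i≥)))) ,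
  (e , 0<e , N , λ j j≥ → subst₂ _≤ℚ_ (solve 2 (λ a η → a :- con ½ :* η := (a :- η) :+ con ½ :* η) refl (seq x i) η) (solve 2 (λ b e → (b :+ e) :- e := b) refl (seq x j) e)
    (ℚₚ.+-monoˡ-≤ (- e) (∣a-b∣≤e⇒a≤b+e (seq x i) (seq x j) (close i j i≥ j≥))))
  where
  e = ½ * η
  0<e : 0ℚ <ℚ e
  0<e = *->0 (ℚₚ.positive⁻¹ ½) 0<η
  N = proj₁ (cauchy x e 0<e)
  close = proj₂ (cauchy x e 0<e)

≈-<⇒≤ : ∀ {a b x} → fromℚ a ≈ℝ x → x <ℝ fromℚ b → a ≤ℚ b
≈-<⇒≤ {a} {b} {x} a≈x (e , 0<e , M , x+e≤b) = ℚₚ.≤-trans (∣a-b∣≤e⇒a≤b+e a (seq x i) (proj₂ (a≈x e 0<e) i (ℕₚ.m≤n⊔m M N))) (x+e≤b i (ℕₚ.m≤m⊔n M N))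
  where
  N = proj₁ (a≈x e 0<e)
  i = M ℕ.⊔ N

num : ℚ → ℕ
num q = ℤ.∣ ↥ q ∣

↥-positive : ∀ q → 0ℚ <ℚ q → ∃ λ a → ↥ q ≡ + suc a
↥-positive (mkℚ (+ suc a) d c)  0<q = a , refl
↥-positive (mkℚ (+ zero) d c)   0<q = contradiction (positive 0<q) λ ()
↥-positive (mkℚ -[1+ a ] d c)   0<q = contradiction (positive 0<q) λ ()

↥≡num : ∀ q → 0ℚ <ℚ q → ↥ q ≡ + num q
↥≡num q 0<q with ↥ q | ↥-positive q 0<q
... | _ | a , refl = refl

q*↧q≡num : ∀ q → 0ℚ <ℚ q → q * ι (↧ₙ q) ≡ ι (num q)
q*↧q≡num q 0<q = q*↧q≡↥q q (↥≡num q 0<q)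

archimedean : ∀ c → ∃ λ N → c ≤ℚ ι N
archimedean c with ℚₚ.≤-total c 0ℚ
... | inj₁ c≤0 = 0 , ℚₚ.≤-trans c≤0 (0≤ι 0)
... | inj₂ 0≤c with c ℚₚ.≟ 0ℚ
...   | yes refl = 0 , 0≤ι 0
...   | no  c≢0  = num c , subst₂ _≤ℚ_ (ℚₚ.*-identityʳ c) (q*↧q≡num c 0<c) (*-monoʳ-≤ 0≤c (1≤ι (↧ₙ c)))
  where
  0<c : 0ℚ <ℚ c
  0<c = ℚₚ.positive⁻¹ c {{ℚₚ.nonNeg∧nonZero⇒pos c {{nonNegative 0≤c}} {{ℚ.≢-nonZero c≢0}}}}

^ℤ-positive : ∀ n .{{_ : NonZero n}} q → 0ℚ <ℚ q → n ^ℤ (↥ q) ≡ ι n ^ num q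
^ℤ-positive n q 0<q = trans (cong (λ z → n ^ℤ z) (↥≡num q 0<q)) (trans (sym (ι-def (n ^ₙ num q))) (ι-^ n (num q)))

^ℤ-negative : ∀ n .{{_ : NonZero n}} q → 0ℚ <ℚ q → (n ^ℤ (↥ (- q))) * ι n ^ num q ≡ 1ℚ
^ℤ-negative n q 0<q = trans (cong₂ (λ z k → (n ^ℤ z) * ι n ^ k) (trans (ℚₚ.↥-neg q) (cong ℤ.-_ eq)) (cong ℤ.∣_∣ eq))
  (trans (cong ((+ 1 / (n ^ₙ suc j)) *_) (sym (ι-^ n (suc j)))) (trans (/-*-cancel 1 (n ^ₙ suc j)) ι1≡1))
  where
  j = proj₁ (↥-positive q 0<q)
  eq = proj₂ (↥-positive q 0<q)
  instance
    n^≢0 : NonZero (n ^ₙ suc j)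
    n^≢0 = ℕₚ.m^n≢0 n (suc j)

↧ₙ-neg : ∀ q → ↧ₙ (- q) ≡ ↧ₙ q
↧ₙ-neg q = ℤₚ.+-injective (ℚₚ.↧-neg q)

module _ {n : ℕ} .{{_ : NonZero n}} (y z : ℝ) (pow : IsPower n y z) {γ : ℚ} (0<γ : 0ℚ <ℚ γ) where

  private
    G = num γ
    D = ↧ₙ γ
    ν = ι n
    t = n ^ℤ (↥ (- γ))

    0<ν^G : 0ℚ <ℚ ν ^ G
    0<ν^G = ^->0 G (0<ι n)

    tν≡1 : t * ν ^ G ≡ 1ℚ
    tν≡1 = ^ℤ-negative n γ 0<γ

    0<t : 0ℚ <ℚ t
    0<t = ℚₚ.*-cancelʳ-<-nonNeg (ν ^ G) {{nonNegative (ℚₚ.<⇒≤ 0<ν^G)}} (subst₂ _<ℚ_ (sym (ℚₚ.*-zeroˡ (ν ^ G))) (sym tν≡1) 0<1)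

    t≤1 : t ≤ℚ 1ℚ
    t≤1 = subst₂ _≤ℚ_ (ℚₚ.*-identityʳ t) tν≡1 (*-monoʳ-≤ (ℚₚ.<⇒≤ 0<t) (1≤^ G (1≤ι n)))

    seq-^D : ∀ i → seq (z ^ℝ ↧ₙ (- γ)) i ≡ seq z i ^ D
    seq-^D i = trans (seq-^ z (↧ₙ (- γ)) i) (cong (seq z i ^_) (↧ₙ-neg γ))

  -- The slack allowed by `≤ℝ` is taken to be t itself, the power n^(-G) being approximated; this
  -- doubles the bound, whence the 2.
  upper-power : y <ℝ fromℚ (- γ) → Eventually λ i → seq z i ^ D * ν ^ G ≤ℚ 2ℚ
  upper-power y<-γ = map-eventually (λ {i} le → subst (seq z i ^ D * ν ^ G ≤ℚ_) (trans (ℚₚ.*-distribʳ-+ (ν ^ G) t t) (cong₂ _+_ tν≡1 tν≡1))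
    (*-monoˡ-≤ (ℚₚ.<⇒≤ 0<ν^G) (subst (_≤ℚ t + t) (seq-^D i) le))) (proj₂ (proj₂ pow) (- γ) y<-γ t 0<t)

  module _ (-γ<y : fromℚ (- γ) <ℝ y) where

    private
      ½t≤ : Eventually λ i → ½ * t ≤ℚ seq z i ^ D
      ½t≤ = map-eventually (λ {i} le → subst₂ _≤ℚ_ (solve 1 (λ t → t :- con ½ :* t := con ½ :* t) refl t) (solve 2 (λ u t → (u :+ con ½ :* t) :- con ½ :* t := u) refl (seq z i ^ D) t)
        (ℚₚ.+-monoˡ-≤ (- (½ * t)) (subst (λ u → t ≤ℚ u + ½ * t) (seq-^D i) le))) (proj₁ (proj₂ pow) (- γ) -γ<y (½ * t) (*->0 (ℚₚ.positive⁻¹ ½) 0<t))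

    -- With slack t/2 at least half of t survives, so the loss is again a factor 2.
    lower-power : Eventually λ i → 1ℚ ≤ℚ 2ℚ * (seq z i ^ D * ν ^ G)
    lower-power = map-eventually (λ {i} le → begin
      1ℚ                             ≡⟨ tν≡1 ⟨
      t * ν ^ G                      ≡⟨ solve 2 (λ t g → t :* g := con 2ℚ :* ((con ½ :* t) :* g)) refl t (ν ^ G) ⟩
      2ℚ * ((½ * t) * ν ^ G)         ≤⟨ *-monoʳ-≤ 0≤2 (*-monoˡ-≤ (ℚₚ.<⇒≤ 0<ν^G) le) ⟩
      2ℚ * (seq z i ^ D * ν ^ G)     ∎) ½t≤
      where open ℚₚ.≤-Reasoning

    -- An even D hides the sign of a term, and `0ℝ ≤ℝ z` yields no more than a bound -t/4 for late
    -- terms. A term u in [-t/4, 0] would have |u|^D ≤ |u| ≤ t/4, against u^D ≥ t/2.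
    power-positive : Eventually λ i → 0ℚ <ℚ seq z i
    power-positive = map-eventually (λ {i} (le , z≥-¼t) → positive-base (seq z i) le (0≤z+¼t⇒ (seq z i) z≥-¼t))
      (both-eventually ½t≤ (proj₁ pow (½ * (½ * t)) 0<¼t))
      where
      0<¼t : 0ℚ <ℚ ½ * (½ * t)
      0<¼t = *->0 (ℚₚ.positive⁻¹ ½) (*->0 (ℚₚ.positive⁻¹ ½) 0<t)
      0≤z+¼t⇒ : ∀ u → 0ℚ ≤ℚ u + ½ * (½ * t) → - u ≤ℚ ½ * (½ * t)
      0≤z+¼t⇒ u le = subst₂ _≤ℚ_ (ℚₚ.+-identityʳ (- u)) (solve 2 (λ u c → :- u :+ (u :+ c) := c) refl u (½ * (½ * t))) (ℚₚ.+-monoʳ-≤ (- u) le)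
      ¼t<½t : ½ * (½ * t) <ℚ ½ * t
      ¼t<½t = subst₂ _<ℚ_ (ℚₚ.+-identityʳ (½ * (½ * t))) (solve 1 (λ t → con ½ :* (con ½ :* t) :+ con ½ :* (con ½ :* t) := con ½ :* t) refl t) (ℚₚ.+-monoʳ-< (½ * (½ * t)) 0<¼t)
      ∣^∣ : ∀ u k → u ^ k ≤ℚ ℚ.∣ u ∣ ^ k
      ∣^∣ u k = subst (u ^ k ≤ℚ_) (∣^∣≡ k) (p≤∣p∣ (u ^ k))
        where
        ∣^∣≡ : ∀ k → ℚ.∣ u ^ k ∣ ≡ ℚ.∣ u ∣ ^ k
        ∣^∣≡ zero    = refl
        ∣^∣≡ (suc k) = trans (ℚₚ.∣p*q∣≡∣p∣*∣q∣ u (u ^ k)) (cong (ℚ.∣ u ∣ *_) (∣^∣≡ k))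
      positive-base : ∀ u → ½ * t ≤ℚ u ^ D → - u ≤ℚ ½ * (½ * t) → 0ℚ <ℚ u
      positive-base u ½t≤u^D -u≤¼t with u ℚₚ.≤? 0ℚ
      ... | no u≰0 = ℚₚ.≰⇒> u≰0
      ... | yes u≤0 = contradiction (ℚₚ.≤-<-trans (begin
        ½ * t                ≤⟨ ½t≤u^D ⟩
        u ^ D                ≤⟨ ∣^∣ u D ⟩
        ℚ.∣ u ∣ ^ D          ≡⟨ cong (_^ D) ∣u∣≡-u ⟩
        (- u) ^ D            ≤⟨ ^≤base (ℕ.pred D) ⟩
        - u                  ≤⟨ -u≤¼t ⟩
        ½ * (½ * t)          ∎) ¼t<½t) (ℚₚ.<-irrefl refl)
        where
        open ℚₚ.≤-Reasoning
        0≤-u : 0ℚ ≤ℚ - u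
        0≤-u = ℚₚ.neg-antimono-≤ u≤0
        ∣u∣≡-u : ℚ.∣ u ∣ ≡ - u
        ∣u∣≡-u = trans (sym (ℚₚ.∣-p∣≡∣p∣ u)) (ℚₚ.0≤p⇒∣p∣≡p 0≤-u)
        -u≤1 : - u ≤ℚ 1ℚ
        -u≤1 = ℚₚ.≤-trans -u≤¼t (ℚₚ.≤-trans (ℚₚ.<⇒≤ ¼t<½t) (ℚₚ.≤-trans (subst (½ * t ≤ℚ_) (ℚₚ.*-identityˡ t) (*-monoˡ-≤ (ℚₚ.<⇒≤ 0<t) (ℚₚ.≤ᵇ⇒≤ {½} {1ℚ} tt))) t≤1))
        ^≤base : ∀ k → (- u) ^ suc k ≤ℚ - u
        ^≤base k = subst ((- u) ^ suc k ≤ℚ_) (ℚₚ.*-identityʳ (- u)) (*-monoʳ-≤ 0≤-u (^≤1 k 0≤-u -u≤1))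

integer-power : ∀ {n m} .{{_ : NonZero n}} {y} → IsPower n y (fromℕ m) → ∀ r → 0ℚ <ℚ r → y <ℝ fromℚ r → ι m ^ ↧ₙ r ≤ℚ ι n ^ num r
integer-power {n} {m} pow r 0<r y<r = subst (ι m ^ ↧ₙ r ≤ℚ_) (^ℤ-positive n r 0<r)
  (≤-fromℚ {x = fromℕ m ^ℝ ↧ₙ r} (λ i → trans (seq-^ (fromℕ m) (↧ₙ r) i) (cong (_^ ↧ₙ r) (sym (ι-def m)))) (proj₂ (proj₂ pow) r y<r))

-- Choice of the rational exponents

4ℚ : ℚ
4ℚ = + 4 / 1

-- Rational bounds γ₂ < 1 − δ < γ₁, α < α′, ρ < ρ′ that still satisfy the inequalities assumed of δ, α and ρ.
record Exponents (δ α ρ : ℝ) : Set where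
  field
    α′ γ₁ γ₂ ρ′ : ℚ
    0<α′ : 0ℚ <ℚ α′
    0<γ₁ : 0ℚ <ℚ γ₁
    0<γ₂ : 0ℚ <ℚ γ₂
    0<ρ′ : 0ℚ <ℚ ρ′
    α<α′ : α <ℝ fromℚ α′
    ρ<ρ′ : ρ <ℝ fromℚ ρ′
    -γ₁<δ-1 : fromℚ (- γ₁) <ℝ δ -ℝ 1ℝ
    δ-1<-γ₂ : δ -ℝ 1ℝ <ℝ fromℚ (- γ₂)
    ρ′<γ₂ : ρ′ <ℚ γ₂
    4ρ′+α′γ₁<2 : 4ℚ * ρ′ + α′ * γ₁ <ℚ 2ℚ

  A₀ B₀ D₁ G₁ D₂ R D₃ G₃ : ℕ
  A₀  = num α′
  B₀  = ↧ₙ α′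
  D₁ = ↧ₙ γ₁
  G₁ = num γ₁
  D₂ = ↧ₙ ρ′
  R  = num ρ′
  D₃ = ↧ₙ γ₂
  G₃ = num γ₂

  exponent₁ : R *ₙ D₃ <ₙ G₃ *ₙ D₂
  exponent₁ = ι-cancel-< (subst₂ _<ℚ_ lhs rhs (ℚₚ.*-monoˡ-<-pos (ι D₂ * ι D₃) {{positive (*->0 (0<ι D₂) (0<ι D₃))}} ρ′<γ₂))
    where
    lhs : ρ′ * (ι D₂ * ι D₃) ≡ ι (R *ₙ D₃)
    lhs = trans (sym (ℚₚ.*-assoc ρ′ (ι D₂) (ι D₃))) (trans (cong (_* ι D₃) (q*↧q≡num ρ′ 0<ρ′)) (sym (ι-* R D₃)))
    rhs : γ₂ * (ι D₂ * ι D₃) ≡ ι (G₃ *ₙ D₂)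
    rhs = trans (solve 3 (λ g a b → g :* (a :* b) := (g :* b) :* a) refl γ₂ (ι D₂) (ι D₃)) (trans (cong (_* ι D₂) (q*↧q≡num γ₂ 0<γ₂)) (sym (ι-* G₃ D₂)))

  exponent₂ : R *ₙ (4 *ₙ B₀ *ₙ D₁) +ₙ G₁ *ₙ (A₀ *ₙ D₂) <ₙ 2 *ₙ B₀ *ₙ (D₁ *ₙ D₂)
  exponent₂ = ι-cancel-< (subst₂ _<ℚ_ lhs rhs (ℚₚ.*-monoˡ-<-pos P {{positive (*->0 (0<ι B₀) (*->0 (0<ι D₁) (0<ι D₂)))}} 4ρ′+α′γ₁<2))
    where
    open ≡-Reasoning
    P = ι B₀ * (ι D₁ * ι D₂)
    lhs : (4ℚ * ρ′ + α′ * γ₁) * P ≡ ι (R *ₙ (4 *ₙ B₀ *ₙ D₁) +ₙ G₁ *ₙ (A₀ *ₙ D₂))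
    lhs = begin
      (4ℚ * ρ′ + α′ * γ₁) * P
        ≡⟨ solve 6 (λ r a g b d₁ d₂ → (con 4ℚ :* r :+ a :* g) :* (b :* (d₁ :* d₂)) := (r :* d₂) :* (con 4ℚ :* b :* d₁) :+ (g :* d₁) :* ((a :* b) :* d₂))
             refl ρ′ α′ γ₁ (ι B₀) (ι D₁) (ι D₂) ⟩
      (ρ′ * ι D₂) * (4ℚ * ι B₀ * ι D₁) + (γ₁ * ι D₁) * ((α′ * ι B₀) * ι D₂)
        ≡⟨ cong₂ _+_ (cong₂ _*_ (q*↧q≡num ρ′ 0<ρ′) (cong (λ z → z * ι B₀ * ι D₁) (sym (ι-def 4)))) (cong₂ _*_ (q*↧q≡num γ₁ 0<γ₁) (cong (_* ι D₂) (q*↧q≡num α′ 0<α′))) ⟩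
      ι R * (ι 4 * ι B₀ * ι D₁) + ι G₁ * (ι A₀ * ι D₂)
        ≡⟨ cong₂ _+_ (trans (ι-* R (4 *ₙ B₀ *ₙ D₁)) (cong (ι R *_) (trans (ι-* (4 *ₙ B₀) D₁) (cong (_* ι D₁) (ι-* 4 B₀))))) (trans (ι-* G₁ (A₀ *ₙ D₂)) (cong (ι G₁ *_) (ι-* A₀ D₂))) ⟨
      ι (R *ₙ (4 *ₙ B₀ *ₙ D₁)) + ι (G₁ *ₙ (A₀ *ₙ D₂))
        ≡⟨ ι-+ (R *ₙ (4 *ₙ B₀ *ₙ D₁)) (G₁ *ₙ (A₀ *ₙ D₂)) ⟨
      ι (R *ₙ (4 *ₙ B₀ *ₙ D₁) +ₙ G₁ *ₙ (A₀ *ₙ D₂)) ∎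
    rhs : 2ℚ * P ≡ ι (2 *ₙ B₀ *ₙ (D₁ *ₙ D₂))
    rhs = begin
      2ℚ * (ι B₀ * (ι D₁ * ι D₂))          ≡⟨ cong (_* (ι B₀ * (ι D₁ * ι D₂))) (sym (ι-def 2)) ⟩
      ι 2 * (ι B₀ * (ι D₁ * ι D₂))         ≡⟨ ℚₚ.*-assoc (ι 2) (ι B₀) (ι D₁ * ι D₂) ⟨
      ι 2 * ι B₀ * (ι D₁ * ι D₂)           ≡⟨ trans (ι-* (2 *ₙ B₀) (D₁ *ₙ D₂)) (cong₂ _*_ (ι-* 2 B₀) (ι-* D₁ D₂)) ⟨
      ι (2 *ₙ B₀ *ₙ (D₁ *ₙ D₂))            ∎

exponents : ∀ δ α ρ → 0ℝ <ℝ δ → δ <ℝ 1ℝ → fromℕ 2 <ℝ α → α <ℝ fromℕ 3 → 0ℝ <ℝ ρ →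
  ρ <ℝ fromℚ (+ 1 / 2) *ℝ (1ℝ -ℝ δ) → ρ <ℝ fromℚ (+ 1 / 4) *ℝ (fromℕ 2 -ℝ α *ℝ (1ℝ -ℝ δ)) → Exponents δ α ρ
exponents δ α ρ (_ , 0<e₁ , δ>0) (_ , 0<e₂ , δ<1) (_ , 0<e₃ , α>2) (_ , 0<e₄ , α<3) (_ , 0<e₅ , ρ>0) (e₆ , 0<e₆ , ρ<₁) (e₇ , 0<e₇ , ρ<₂) = record
  { α′ = a₀ + η ; γ₁ = g₀ + η ; γ₂ = g₀ - η ; ρ′ = r₀ + η
  ; 0<α′ = ℚₚ.+-mono-≤-< 0≤a₀ 0<η
  ; 0<γ₁ = ℚₚ.+-mono-≤-< 0≤g₀ 0<η
  ; 0<γ₂ = ℚₚ.<-trans 0<ρ′ ρ′<γ₂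
  ; 0<ρ′ = 0<ρ′
  ; α<α′ = proj₁ (proj₁ close)
  ; ρ<ρ′ = proj₁ (proj₁ (proj₂ close))
  ; -γ₁<δ-1 = subst (λ c → fromℚ c <ℝ δ -ℝ 1ℝ) (solve 2 (λ d η → (d :+ :- con 1ℚ) :- η := :- ((con 1ℚ :+ :- d) :+ η)) refl (seq δ i₀) η) (proj₂ (proj₂ (proj₂ close)))
  ; δ-1<-γ₂ = subst (λ c → δ -ℝ 1ℝ <ℝ fromℚ c) (solve 2 (λ d η → (d :+ :- con 1ℚ) :+ η := :- ((con 1ℚ :+ :- d) :- η)) refl (seq δ i₀) η) (proj₁ (proj₂ (proj₂ close)))
  ; ρ′<γ₂ = ρ′<γ₂
  ; 4ρ′+α′γ₁<2 = 4ρ′+α′γ₁<2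
  }
  where
  -- e₆ and e₇ are the gaps in the two upper bounds on ρ. Every exponent moves by a quarter of c₀,
  -- little enough to keep both bounds strict; the cap 1 controls the quadratic term η² of α′ γ₁.
  c₀ = (e₆ ℚ.⊓ e₇) ℚ.⊓ 1ℚ
  η = ½ * (½ * c₀)
  ⊓->0 : ∀ {a b} → 0ℚ <ℚ a → 0ℚ <ℚ b → 0ℚ <ℚ a ℚ.⊓ b
  ⊓->0 {a} {b} 0<a 0<b with ℚₚ.⊓-sel a b
  ... | inj₁ eq = subst (0ℚ <ℚ_) (sym eq) 0<a
  ... | inj₂ eq = subst (0ℚ <ℚ_) (sym eq) 0<b
  0<c₀ : 0ℚ <ℚ c₀
  0<c₀ = ⊓->0 (⊓->0 0<e₆ 0<e₇) 0<1
  0<η : 0ℚ <ℚ η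
  0<η = *->0 (ℚₚ.positive⁻¹ ½) (*->0 (ℚₚ.positive⁻¹ ½) 0<c₀)
  c₀≤e₆ : c₀ ≤ℚ e₆
  c₀≤e₆ = ℚₚ.≤-trans (ℚₚ.p⊓q≤p (e₆ ℚ.⊓ e₇) 1ℚ) (ℚₚ.p⊓q≤p e₆ e₇)
  c₀≤e₇ : c₀ ≤ℚ e₇
  c₀≤e₇ = ℚₚ.≤-trans (ℚₚ.p⊓q≤p (e₆ ℚ.⊓ e₇) 1ℚ) (ℚₚ.p⊓q≤q e₆ e₇)
  c₀≤1 : c₀ ≤ℚ 1ℚ
  c₀≤1 = ℚₚ.p⊓q≤q (e₆ ℚ.⊓ e₇) 1ℚ
  α-close = approximation α η 0<η
  ρ-close = approximation ρ η 0<η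
  δ-close = approximation (δ -ℝ 1ℝ) η 0<η
  -- One common index turns the inequalities and the three approximations into statements about
  -- fixed rationals.
  all-close = both-eventually (both-eventually (both-eventually δ>0 δ<1) (both-eventually α>2 α<3))
    (both-eventually (both-eventually ρ>0 (both-eventually ρ<₁ ρ<₂)) (both-eventually α-close (both-eventually ρ-close δ-close)))
  i₀ = proj₁ all-close
  facts = proj₂ all-close i₀ ℕₚ.≤-refl
  close = proj₂ (proj₂ facts)
  a₀ = seq α i₀
  g₀ = 1ℚ - seq δ i₀
  r₀ = seq ρ i₀
  strip : ∀ {e u v} → 0ℚ <ℚ e → u + e ≤ℚ v → u ≤ℚ v
  strip {e} {u} 0<e le = ℚₚ.≤-trans (subst (_≤ℚ u + e) (ℚₚ.+-identityʳ u) (ℚₚ.+-monoʳ-≤ u (ℚₚ.<⇒≤ 0<e))) le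
  0≤g₀ : 0ℚ ≤ℚ g₀
  0≤g₀ = a≤b⇒0≤b-a {seq δ i₀} (strip {u = seq δ i₀} 0<e₂ (proj₂ (proj₁ (proj₁ facts))))
  g₀≤1 : g₀ ≤ℚ 1ℚ
  g₀≤1 = 0≤b-a⇒a≤b (subst (0ℚ ≤ℚ_) (solve 1 (λ d → d := con 1ℚ :- (con 1ℚ :- d)) refl (seq δ i₀)) (strip 0<e₁ (proj₁ (proj₁ (proj₁ facts)))))
  0≤a₀ : 0ℚ ≤ℚ a₀
  0≤a₀ = ℚₚ.≤-trans 0≤2 (strip 0<e₃ (proj₁ (proj₂ (proj₁ facts))))
  a₀≤3 : a₀ ≤ℚ + 3 / 1
  a₀≤3 = strip 0<e₄ (proj₂ (proj₂ (proj₁ facts)))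
  0≤r₀ : 0ℚ ≤ℚ r₀
  0≤r₀ = strip 0<e₅ (proj₁ (proj₁ (proj₂ facts)))
  r₀≤₁ : r₀ + e₆ ≤ℚ ½ * g₀
  r₀≤₁ = proj₁ (proj₂ (proj₁ (proj₂ facts)))
  r₀≤₂ : r₀ + e₇ ≤ℚ (+ 1 / 4) * (2ℚ - a₀ * g₀)
  r₀≤₂ = proj₂ (proj₂ (proj₁ (proj₂ facts)))
  0<ρ′ : 0ℚ <ℚ r₀ + η
  0<ρ′ = ℚₚ.+-mono-≤-< 0≤r₀ 0<η
  ρ′<γ₂ : r₀ + η <ℚ g₀ - η
  ρ′<γ₂ = ℚₚ.<-≤-trans (subst (_<ℚ (r₀ + η) + η) (ℚₚ.+-identityʳ (r₀ + η)) (ℚₚ.+-monoʳ-< (r₀ + η) 0<η))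
    (0≤b-a⇒a≤b (subst (0ℚ ≤ℚ_)
      (solve 4 (λ g r c e → (con ½ :* g :- (r :+ e)) :+ ((e :- c) :+ (con ½ :* g :+ con (+ 1 / 4) :* c)) :=
                            (g :- con ½ :* (con ½ :* c)) :- ((r :+ con ½ :* (con ½ :* c)) :+ con ½ :* (con ½ :* c))) refl g₀ r₀ c₀ e₆)
      (+-≥0 (a≤b⇒0≤b-a r₀≤₁) (+-≥0 (a≤b⇒0≤b-a c₀≤e₆) (+-≥0 (*-≥0 (ℚₚ.nonNegative⁻¹ ½) 0≤g₀) (*-≥0 (ℚₚ.nonNegative⁻¹ (+ 1 / 4)) (ℚₚ.<⇒≤ 0<c₀)))))))
  -- With η = c₀/4 the slack 2 − (4 ρ′ + α′ γ₁) is at least 4 e₇ − η (4 + a₀ + g₀ + η) ≥ 4 c₀ − 9 η = 7 η.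
  4ρ′+α′γ₁<2 : 4ℚ * (r₀ + η) + (a₀ + η) * (g₀ + η) <ℚ 2ℚ
  4ρ′+α′γ₁<2 = ℚₚ.<-≤-trans (subst (_<ℚ L + η) (ℚₚ.+-identityʳ L) (ℚₚ.+-monoʳ-< L 0<η))
    (0≤b-a⇒a≤b (subst (0ℚ ≤ℚ_)
      (solve 5 (λ a g r c e → let η = con ½ :* (con ½ :* c) in
          con 4ℚ :* (con (+ 1 / 4) :* (con 2ℚ :- a :* g) :- (r :+ e)) :+ (con 4ℚ :* (e :- c) :+ (η :* (con (+ 3 / 1) :- a) :+ (η :* (con 1ℚ :- g) :+ (con (+ 1 / 4) :* (η :* (con 1ℚ :- c)) :+ con (+ 27 / 4) :* η)))) :=
          con 2ℚ :- ((con 4ℚ :* (r :+ η) :+ (a :+ η) :* (g :+ η)) :+ η)) refl a₀ g₀ r₀ c₀ e₇)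
      (+-≥0 (*-≥0 (ℚₚ.nonNegative⁻¹ 4ℚ) (a≤b⇒0≤b-a r₀≤₂)) (+-≥0 (*-≥0 (ℚₚ.nonNegative⁻¹ 4ℚ) (a≤b⇒0≤b-a c₀≤e₇))
        (+-≥0 (*-≥0 0≤η (a≤b⇒0≤b-a a₀≤3)) (+-≥0 (*-≥0 0≤η (a≤b⇒0≤b-a g₀≤1))
          (+-≥0 (*-≥0 (ℚₚ.nonNegative⁻¹ (+ 1 / 4)) (*-≥0 0≤η (a≤b⇒0≤b-a c₀≤1))) (*-≥0 (ℚₚ.nonNegative⁻¹ (+ 27 / 4)) 0≤η))))))))
    where
    L = 4ℚ * (r₀ + η) + (a₀ + η) * (g₀ + η)
    0≤η : 0ℚ ≤ℚ η
    0≤η = ℚₚ.<⇒≤ 0<η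

-- A negative β can occur, since 0 ≤ℝ β only bounds the terms of β below by −e; the error term then absorbs it.
divide-by-[1-β]² : ∀ {β a h v e} → let s = 1ℚ - β in
  0ℚ ≤ℚ a → 0ℚ ≤ℚ h → v ≤ℚ 1ℚ → 0ℚ ≤ℚ e → 0ℚ ≤ℚ β + e → 0ℚ <ℚ s →
  (0ℚ ≤ℚ β → β ≤ℚ 1ℚ → β * (a * (s * s) - v) ≤ℚ h * (s * s)) →
  β * (a - v * recip (s * (s * 1ℚ))) ≤ℚ h + e
divide-by-[1-β]² {β} {a} {h} {v} {e} 0≤a 0≤h v≤1 0≤e 0≤β+e 0<s main = *-cancelˡ-≤ 0<S (subst (_≤ℚ S * (h + e)) (sym cleared) bound)
  where
  s = 1ℚ - β
  S = s * (s * 1ℚ)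
  r = recip S
  0<S : 0ℚ <ℚ S
  0<S = *->0 0<s (*->0 0<s 0<1)
  cleared : S * (β * (a - v * r)) ≡ β * (a * (s * s) - v)
  cleared = trans (solve 5 (λ s β a v r → (s :* (s :* con 1ℚ)) :* (β :* (a :- v :* r)) := β :* (a :* (s :* s) :- v :* (r :* (s :* (s :* con 1ℚ))))) refl s β a v r)
    (cong (λ z → β * (a * (s * s) - z)) (trans (cong (v *_) (recip-*-cancel S 0<S)) (ℚₚ.*-identityʳ v)))
  bound : β * (a * (s * s) - v) ≤ℚ S * (h + e)
  bound with ℚₚ.≤-total 0ℚ β
  ... | inj₁ 0≤β = ℚₚ.≤-trans (main 0≤β (0≤b-a⇒a≤b (ℚₚ.<⇒≤ 0<s)))
    (0≤b-a⇒a≤b (subst (0ℚ ≤ℚ_) (solve 3 (λ s h e → (s :* (s :* con 1ℚ)) :* e := (s :* (s :* con 1ℚ)) :* (h :+ e) :- h :* (s :* s)) refl s h e) (*-≥0 (ℚₚ.<⇒≤ 0<S) 0≤e)))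
  -- Put t = -β, so that S = 1 + t (2 + t). The summand e of S e pays for the only negative
  -- contribution t v, because t ≤ e and v ≤ 1.
  ... | inj₂ β≤0 = 0≤b-a⇒a≤b (subst (0ℚ ≤ℚ_)
    (solve 5 (λ b a h v e → let s = con 1ℚ :- b ; S = s :* (s :* con 1ℚ) ; t = :- b in
        S :* h :+ ((t :* (con 2ℚ :+ t)) :* e :+ ((b :+ e) :+ (t :* (a :* S) :+ t :* (con 1ℚ :- v)))) := S :* (h :+ e) :- b :* (a :* (s :* s) :- v)) refl β a h v e)
    (+-≥0 (*-≥0 (ℚₚ.<⇒≤ 0<S) 0≤h) (+-≥0 (*-≥0 (*-≥0 0≤-β (+-≥0 0≤2 0≤-β)) 0≤e) (+-≥0 0≤β+e
      (+-≥0 (*-≥0 0≤-β (*-≥0 0≤a (ℚₚ.<⇒≤ 0<S))) (*-≥0 0≤-β (a≤b⇒0≤b-a v≤1)))))))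
    where
    0≤-β : 0ℚ ≤ℚ - β
    0≤-β = ℚₚ.neg-antimono-≤ β≤0

-- Thresholds for n, and the passage back to the reals

module Thresholds {δ α ρ : ℝ} (E : Exponents δ α ρ) {x : ℚ} (0<x : 0ℚ <ℚ x) where

  open Exponents E

  private
    T₁ T₂ X : ℚ
    T₁ = 2ℚ ^ (D₂ *ₙ D₃) * 2ℚ ^ D₂
    T₂ = 2ℚ ^ (B₀ *ₙ (D₁ *ₙ D₂)) * 2ℚ ^ (A₀ *ₙ D₂)
    X  = x ^ (2 *ₙ B₀ *ₙ (D₁ *ₙ D₂))
    N₁ = archimedean T₁
    N₂ = archimedean (T₂ * recip X)

    0<X : 0ℚ <ℚ X
    0<X = ^->0 (2 *ₙ B₀ *ₙ (D₁ *ₙ D₂)) 0<x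

  -- Built from the exponents and x alone, hence fixed before n, p, H, f and the index i are known.
  -- T₁ and T₂ are the constants that one factor ν has to absorb, the second with the help of the
  -- power X of x.
  n₀ : ℕ
  n₀ = proj₁ N₁ ℕ.⊔ proj₁ N₂

  module _ {n} (n₀≤n : n₀ ≤ n) where

    T₁≤ν : T₁ ≤ℚ ι n
    T₁≤ν = ℚₚ.≤-trans (proj₂ N₁) (ι-mono-≤ (ℕₚ.m⊔n≤o⇒m≤o (proj₁ N₁) (proj₁ N₂) n₀≤n))

    T₂≤Xν : T₂ ≤ℚ X * ι n
    T₂≤Xν = subst (_≤ℚ X * ι n) (trans (solve 3 (λ x t r → x :* (t :* r) := t :* (r :* x)) refl X T₂ (recip X)) (trans (cong (T₂ *_) (recip-*-cancel X 0<X)) (ℚₚ.*-identityʳ T₂)))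
      (*-monoʳ-≤ (ℚₚ.<⇒≤ 0<X) (ℚₚ.≤-trans (proj₂ N₂) (ι-mono-≤ (ℕₚ.m⊔n≤o⇒n≤o (proj₁ N₁) (proj₁ N₂) n₀≤n))))

module Comparison {δ α ρ : ℝ} (ε β : ℝ) (E : Exponents δ α ρ) (0<ε : 0ℝ <ℝ ε) (ε<1/7 : ε <ℝ fromℚ (+ 1 / 7)) (0≤β : 0ℝ ≤ℝ β) (β<1 : β <ℝ 1ℝ) where

  private
    -- A rational that stays below the terms of ε from some index on. Unlike those terms it does not
    -- vary with the index, so n₀ may depend on it.
    x = proj₁ 0<ε
    0<x = proj₁ (proj₂ 0<ε)
    e₁ = proj₁ ε<1/7
    0<e₁ = proj₁ (proj₂ ε<1/7)
    e₂ = proj₁ β<1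
    0<e₂ = proj₁ (proj₂ β<1)

  open Exponents E
  open Thresholds E 0<x using (T₁≤ν; T₂≤Xν)
  open Thresholds E 0<x using (n₀) public

  x≤ : ∀ {i} → 0ℚ + x ≤ℚ seq ε i → x ≤ℚ seq ε i
  x≤ {i} = subst (_≤ℚ seq ε i) (ℚₚ.+-identityˡ x)

  ε≤1/7 : ∀ {i} → seq ε i + e₁ ≤ℚ + 1 / 7 → seq ε i ≤ℚ + 1 / 7
  ε≤1/7 {i} = ℚₚ.≤-trans (subst (_≤ℚ seq ε i + e₁) (ℚₚ.+-identityʳ (seq ε i)) (ℚₚ.+-monoʳ-≤ (seq ε i) (ℚₚ.<⇒≤ 0<e₁)))

  -- The slack e granted by `≤ℝ` serves twice: as the error in the conclusion and as the lower bound
  -- -e on the terms of β, which `divide-by-[1-β]²` asks for.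
  eventually-≤ : ∀ (n m : ℕ) .{{_ : NonZero n}} .{{_ : NonZero m}} → n₀ ≤ n → m ∣ n → IsPower n ρ (fromℕ m) →
    ∀ (p : ℝ) → IsPower n (δ -ℝ 1ℝ) p → ∀ (H : Graph m) → Balanced H → fromℚ (avgDegree H) ≈ℝ α →
    ∀ (k k' : ℕ) → HasIndependentSet H k' → k' ≤ k → k ≤ n ∸ m → ∀ (f : Graph n → Bool) →
    β *ℝ (Pr f (AG[ H ] n p k k') -ℝ (fromℕ 4 *ℝ ε) ÷ℝ ((1ℝ -ℝ β) ^ℝ 2) [ 0<x⇒0<x² (1ℝ -ℝ β) (x<1⇒0<1-x β β<1) ])
      ≤ℝ Pr f (G[ H ] n p k k')
  eventually-≤ n m n₀≤n m∣n m-power p p-power H bal avg≈α k k' _ _ _ f e 0<e =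
    map-eventually (λ {i} (((0<p , p≥) , p≤) , ((x≤ε , ε<1/7) , (0≤β+e , β<1))) → at i 0<p p≥ p≤ (x≤ x≤ε) (ε≤1/7 ε<1/7) 0≤β+e β<1)
      (both-eventually
        (both-eventually (both-eventually (power-positive (δ -ℝ 1ℝ) p p-power 0<γ₁ -γ₁<δ-1) (lower-power (δ -ℝ 1ℝ) p p-power 0<γ₁ -γ₁<δ-1)) (upper-power (δ -ℝ 1ℝ) p p-power 0<γ₂ δ-1<-γ₂))
        (both-eventually (both-eventually (proj₂ (proj₂ 0<ε)) (proj₂ (proj₂ ε<1/7))) (both-eventually (0≤β e 0<e) (proj₂ (proj₂ β<1)))))
    where
    μ = ι m
    ν = ι n
    μ≤ : μ ^ D₂ ≤ℚ ν ^ R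
    μ≤ = integer-power {y = ρ} m-power _ 0<ρ′ ρ<ρ′

    avg≤ : avgDegree H * ι B₀ ≤ℚ ι A₀
    avg≤ = subst (avgDegree H * ι B₀ ≤ℚ_) (q*↧q≡num _ 0<α′) (*-monoˡ-≤ (0≤ι B₀) (≈-<⇒≤ {avgDegree H} {x = α} avg≈α α<α′))

    at : ∀ i → let p̂ = seq p i in 0ℚ <ℚ p̂ → 1ℚ ≤ℚ 2ℚ * (p̂ ^ D₁ * ν ^ G₁) → p̂ ^ D₃ * ν ^ G₃ ≤ℚ 2ℚ →
         x ≤ℚ seq ε i → seq ε i ≤ℚ + 1 / 7 → 0ℚ ≤ℚ seq β i + e → seq β i + e₂ ≤ℚ 1ℚ →
         seq β i * (seq (Pr f (AG[ H ] n p k k')) i - (4ℚ * seq ε i) * recip ((1ℚ - seq β i) * ((1ℚ - seq β i) * 1ℚ))) ≤ℚ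
         seq (Pr f (G[ H ] n p k k')) i + e
    -- The choice v = 4 ε covers the relative variance 2 x, and ε < 1/7 keeps it at most 1.
    at i 0<p p≥ p≤ x≤ε ε≤1/7 0≤β+e β<1 = divide-by-[1-β]² {v = 4ℚ * seq ε i} (Pr-AG-≥0 i 0≤p p≤1 H n k k' f) (Pr-G-≥0 i 0≤p p≤1 H n k k' f)
      (*-monoʳ-4 ε≤1/7) (ℚₚ.<⇒≤ 0<e) 0≤β+e
      (ℚₚ.<-≤-trans 0<e₂ (0≤b-a⇒a≤b (subst (0ℚ ≤ℚ_) (solve 2 (λ b e → con 1ℚ :- (b :+ e) := (con 1ℚ :- b) :- e) refl (seq β i) e₂) (a≤b⇒0≤b-a β<1))))
      (comparison-at i p n H bal m∣n 0<p small A₀ B₀ avg≤ (ℚₚ.<⇒≤ 0<x) x≤½ 2x≤4ε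
        (2μ⁴≤p^A[xν]² A₀ B₀ D₁ D₂ R G₁ 0≤p (0≤ι m) (1≤ι n) (ℚₚ.<⇒≤ 0<x) μ≤ p≥ exponent₂ (T₂≤Xν n₀≤n)) k k' f (seq β i))
      where
      0≤p = ℚₚ.<⇒≤ 0<p
      small : 2ℚ * (seq p i * μ) ≤ℚ 1ℚ
      small = 2pμ≤1 D₂ D₃ R G₃ 0≤p (0≤ι m) (1≤ι n) μ≤ p≤ exponent₁ (T₁≤ν n₀≤n)
      p≤1 = ℚₚ.<⇒≤ (2pμ≤1⇒p<1 m 0≤p small)
      *-monoʳ-4 : seq ε i ≤ℚ + 1 / 7 → 4ℚ * seq ε i ≤ℚ 1ℚ
      *-monoʳ-4 le = ℚₚ.≤-trans (*-monoʳ-≤ (ℚₚ.nonNegative⁻¹ 4ℚ) le) (ℚₚ.≤ᵇ⇒≤ {4ℚ * (+ 1 / 7)} {1ℚ} tt)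
      x≤½ : x ≤ℚ ½
      x≤½ = ℚₚ.≤-trans x≤ε (ℚₚ.≤-trans ε≤1/7 (ℚₚ.≤ᵇ⇒≤ {+ 1 / 7} {½} tt))
      2x≤4ε : x + x ≤ℚ 4ℚ * seq ε i
      2x≤4ε = 0≤b-a⇒a≤b (subst (0ℚ ≤ℚ_) (solve 2 (λ x ε → con 2ℚ :* (ε :- x) :+ con 2ℚ :* ε := con 4ℚ :* ε :- (x :+ x)) refl x (seq ε i))
        (+-≥0 (*-≥0 0≤2 (a≤b⇒0≤b-a x≤ε)) (*-≥0 0≤2 (ℚₚ.≤-trans (ℚₚ.<⇒≤ 0<x) x≤ε))))

theoremC2 :
    ∀ (δ ε α ρ β : ℝ) →
    0ℝ <ℝ δ → (δ<1 : δ <ℝ 1ℝ) →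
    0ℝ <ℝ ε → ε <ℝ fromℚ (+ 1 / 7) →
    fromℕ 2 <ℝ α →
    α <ℝ fromℕ 2 ÷ℝ (1ℝ -ℝ δ) [ x<1⇒0<1-x δ δ<1 ] →
    α <ℝ fromℕ 3 →
    0ℝ <ℝ ρ →
    ρ <ℝ fromℚ (+ 1 / 2) *ℝ (1ℝ -ℝ δ) →
    ρ <ℝ fromℚ (+ 1 / 4) *ℝ (fromℕ 2 -ℝ α *ℝ (1ℝ -ℝ δ)) →
    0ℝ ≤ℝ β → (β<1 : β <ℝ 1ℝ) →
    ∃ λ (n₀ : ℕ) →
      ∀ (n m : ℕ) .{{_ : NonZero n}} .{{_ : NonZero m}} →
      n₀ ≤ n →
      m ∣ n →
      IsPower n ρ (fromℕ m) →
      ∀ (p : ℝ) → IsPower n (δ -ℝ 1ℝ) p →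
      ∀ (H : Graph m) → Balanced H → fromℚ (avgDegree H) ≈ℝ α →
      ∀ (k k' : ℕ) → HasIndependentSet H k' → k' ≤ k → k ≤ n ∸ m →
      ∀ (f : Graph n → Bool) →
      β *ℝ (Pr f (AG[ H ] n p k k') -ℝ (fromℕ 4 *ℝ ε) ÷ℝ ((1ℝ -ℝ β) ^ℝ 2) [ 0<x⇒0<x² (1ℝ -ℝ β) (x<1⇒0<1-x β β<1) ])
        ≤ℝ Pr f (G[ H ] n p k k')
theoremC2 δ ε α ρ β 0<δ δ<1 0<ε ε<1/7 2<α _ α<3 0<ρ ρ<₁ ρ<₂ 0≤β β<1 = n₀ , eventually-≤
  where open Comparison ε β (exponents δ α ρ 0<δ δ<1 2<α α<3 0<ρ ρ<₁ ρ<₂) 0<ε ε<1/7 0≤β β<1
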